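{- Let $k \geq 3$ be an integer. There exists a bijection $\varphi : SP_{k-1} \rightarrow IS_k$ such that $\overrightarrow{fr}(\varphi(f)) = \overrightarrow{fix}(f)$ for all $f \in SP_{k-1}$.
   Context: For a positive integer $n$, $[n]=\{1,\dots,n\}$. A surjective pistol of height $n$ is a surjective map $f:[2n]\to\{2,4,\dots,2n\}$ with $f(j)\ge j$ for all $j\in[2n]$; $SP_n$ denotes the set of them. For $f\in SP_{k-1}$, $\overrightarrow{fix}(f)=(t_1,\dots,t_{k-2})\in\{0,1\}^{k-2}$ where $t_i=1$ iff $f(2i)=2i$. A partition $\lambda=(\lambda_1\ge\dots\ge\lambda_m)$ (possibly empty) is drawn as its Ferrers diagram in French convention: left-justified rows, the $i$-th row from bottom to top having $\lambda_i$ cells. The hook length of a cell $c$ is the number of cells in its row weakly to its right (including $c$) plus the number of cells strictly above it in its column. For a positive integer $k$, the $k$-boundary $\partial^k(\lambda)$ is the set of cells of $\lambda$ of hook length at most $k$ (a skew diagram); its $k$-rim is the lower border of $\partial^k(\lambda)$. $rs^k(\lambda)$ (resp. $cs^k(\lambda)$) is the sequence of lengths of the rows of $\partial^k(\lambda)$ from bottom to top (resp. heights of its columns from left to right). $\lambda$ is a $k$-shape if $rs^k(\lambda)$ and $cs^k(\lambda)$ are both partitions (weakly decreasing). For a $k$-shape $\lambda$ and positive integers $u,v$, $H_u(\lambda)$ (resp. $V_v(\lambda)$) is the set of cells of $\partial^k(\lambda)$ lying in a row of $\partial^k(\lambda)$ of length $u$ (resp. in a column of $\partial^k(\lambda)$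 of height $v$); $V_0(\lambda)=\emptyset$. The horizontal steps of the $k$-rim are the bottom edges of the lowest cells of the columns of $\partial^k(\lambda)$; a set $S$ of cells contains such a step if the corresponding lowest cell lies in $S$ (so the number of horizontal steps of the $k$-rim in $H_u(\lambda)\cap V_v(\lambda)$ is the number of columns of $\partial^k(\lambda)$ of height $v$ whose lowest cell lies in a row of $\partial^k(\lambda)$ of length $u$). An irreducible $k$-shape is a $k$-shape $\lambda$ such that for every $i\in[k]$, each of the sets $H_i(\lambda)\cap V_{k-i}(\lambda)$ and $H_i(\lambda)\cap V_{k+1-i}(\lambda)$ contains at most $i-1$ horizontal steps of the $k$-rim of $\lambda$. $IS_k$ denotes the set of irreducible $k$-shapes. For $k\ge3$ and $\lambda\in IS_k$, an integer $i\in[k-2]$ is a free $k$-site of $\lambda$ if $H_{k-i}(\lambda)\cap V_{i+1}(\lambda)=\emptyset$, and $\overrightarrow{fr}(\lambda)=(t_1,\dots,t_{k-2})$ with $t_i=1$ iff $i$ is a free $k$-site. -}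

module Defs where

open import Data.Nat using (ℕ; zero; suc; _+_; _*_; _∸_; _≤_; _≥_; _<_; _≡ᵇ_; _≤ᵇ_)
open import Data.Nat.Divisibility using (_∣_)
open import Data.Bool using (Bool; true; false; _∧_; _∨_; not; if_then_else_)
open import Data.List using (List; []; _∷_; length; map; upTo; foldr)
open import Data.List.Relation.Unary.All using (All)
open import Data.List.Relation.Unary.Linked using (Linked)
open import Data.Product using (Σ; ∃; _×_; _,_; proj₁)
open import Relation.Binary.Bundles using (Setoid)
open import Relation.Binary.PropositionalEquality using (_≡_; refl; sym; trans)

-- Generic helpers (all indices are 1-based, as in the paper)

range : ℕ → List ℕ
range n = map suc (upTo n)

-- 1-based lookup with default 0 outside the list
at : List ℕ → ℕ → ℕ
at []       _             = 0
at (x ∷ xs) 0             = 0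
at (x ∷ xs) 1             = x
at (x ∷ xs) (suc (suc j)) = at xs (suc j)

count : {A : Set} → (A → Bool) → List A → ℕ
count p []       = 0
count p (x ∷ xs) = if p x then suc (count p xs) else count p xs

anyᵇ : {A : Set} → (A → Bool) → List A → Bool
anyᵇ p []       = false
anyᵇ p (x ∷ xs) = p x ∨ anyᵇ p xs

-- first element of a list satisfying a test (0 if none)
firstWith : (ℕ → Bool) → List ℕ → ℕ
firstWith p []       = 0
firstWith p (x ∷ xs) = if p x then x else firstWith p xs

WeaklyDecreasing : List ℕ → Set
WeaklyDecreasing = Linked _≥_

-- Surjective pistols.  A map f : [2n] → {2,4,…,2n} is represented by the
-- list (f(1), …, f(2n)) of its values.

IsSP : ℕ → List ℕ → Set
IsSP n f =
  (length f ≡ 2 * n)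
  × (∀ j → 1 ≤ j → j ≤ 2 * n → (2 ∣ at f j) × (j ≤ at f j) × (at f j ≤ 2 * n))
  × (∀ i → 1 ≤ i → i ≤ n → ∃ λ j → (1 ≤ j) × (j ≤ 2 * n) × (at f j ≡ 2 * i))

SP : ℕ → Setoid _ _
SP n = record
  { Carrier       = Σ (List ℕ) (IsSP n)
  ; _≈_           = λ f g → proj₁ f ≡ proj₁ g
  ; isEquivalence = record { refl = refl ; sym = sym ; trans = trans }
  }

fix : ℕ → List ℕ → List Bool
fix n f = map (λ i → at f (2 * i) ≡ᵇ 2 * i) (range (n ∸ 1))

-- Partitions (French convention): sh = (λ_1 ≥ … ≥ λ_m > 0), rows listed
-- from bottom to top.  Cell (r , c) = column c of row r, 1 ≤ c ≤ λ_r.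

IsPartition : List ℕ → Set
IsPartition sh = WeaklyDecreasing sh × All (0 <_) sh

colHt : List ℕ → ℕ → ℕ
colHt sh c = count (λ x → c ≤ᵇ x) sh

-- hook length of cell (r , c): cells weakly right in its row plus cells
-- strictly above it in its column
hook : List ℕ → ℕ → ℕ → ℕ
hook sh r c = suc (at sh r ∸ c) + (colHt sh c ∸ r)

inBd : ℕ → List ℕ → ℕ → ℕ → Bool
inBd k sh r c = (1 ≤ᵇ r) ∧ (1 ≤ᵇ c) ∧ (c ≤ᵇ at sh r) ∧ (hook sh r c ≤ᵇ k)

bdRow : ℕ → List ℕ → ℕ → ℕ
bdRow k sh r = count (λ c → inBd k sh r c) (range (at sh r))

bdCol : ℕ → List ℕ → ℕ → ℕ
bdCol k sh c = count (λ r → inBd k sh r c) (range (colHt sh c))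

rs : ℕ → List ℕ → List ℕ
rs k sh = map (bdRow k sh) (range (length sh))

cs : ℕ → List ℕ → List ℕ
cs k sh = map (bdCol k sh) (range (at sh 1))

IsKShape : ℕ → List ℕ → Set
IsKShape k sh = IsPartition sh × WeaklyDecreasing (rs k sh) × WeaklyDecreasing (cs k sh)

lowestRow : ℕ → List ℕ → ℕ → ℕ
lowestRow k sh c = firstWith (λ r → inBd k sh r c) (range (colHt sh c))

-- number of horizontal steps of the k-rim in H_u(sh) ∩ V_v(sh):
-- columns of ∂^k(sh) of height v (v ≥ 1; V_0 = ∅) whose lowest cell lies
-- in a row of ∂^k(sh) of length u
steps : ℕ → List ℕ → ℕ → ℕ → ℕ
steps k sh u v =
  count (λ c → (1 ≤ᵇ v) ∧ (bdCol k sh c ≡ᵇ v) ∧ (bdRow k sh (lowestRow k sh c) ≡ᵇ u))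
        (range (at sh 1))

IsIrreducible : ℕ → List ℕ → Set
IsIrreducible k sh =
  IsKShape k sh
  × (∀ i → 1 ≤ i → i ≤ k →
       (steps k sh i (k ∸ i) ≤ i ∸ 1) × (steps k sh i (suc k ∸ i) ≤ i ∸ 1))

IS : ℕ → Setoid _ _
IS k = record
  { Carrier       = Σ (List ℕ) (IsIrreducible k)
  ; _≈_           = λ x y → proj₁ x ≡ proj₁ y
  ; isEquivalence = record { refl = refl ; sym = sym ; trans = trans }
  }

meets : ℕ → List ℕ → ℕ → ℕ → Bool
meets k sh u v =
  anyᵇ (λ r → anyᵇ (λ c → inBd k sh r c ∧ (bdRow k sh r ≡ᵇ u) ∧ (bdCol k sh c ≡ᵇ v))
                   (range (at sh r)))
       (range (length sh))

fr : ℕ → List ℕ → List Bool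
fr k sh = map (λ i → not (meets k sh (k ∸ i) (suc i))) (range (k ∸ 2))

{-# OPTIONS --safe #-}

-- A k-shape is built column by column from the right. A column is given by its height v in ∂ᵏ and a
-- threshold t ∈ {k + 1 − v, k − v}: it closes the rows of length at least t and lengthens the others. That rs
-- and cs decrease means that the pairs (v, t) come in the order (1, k), (1, k−1), (2, k−1), (2, k−2), …, and
-- irreducibility that each pair is used fewer than t times. Stage i consists of the columns (i, k−i) followed
-- by the columns (i+1, k−i); the latter are absent exactly when i is a free site. The lengths of the open rows
-- form a set of residues modulo t = k − i containing 0; a column rotates this set, and passing to the threshold
-- t − 1 merges the residues t − 1 and 0.
--
-- For a pistol f of height n = k − 1, consider at stage i the set of values greater than 2i taken by f on [2i],
-- together with 2n. Given the set reached after a stage, the number of ways to come from a set of given size,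
-- with f(2i) = 2i or not, respectively with or without columns (i+1, k−i), depends only on the two sizes and is
-- the same on both sides. Numbering these ways from the last stage down to the first yields the bijection.

module Submission where

open import Defs
open import Data.Nat using (ℕ; zero; suc; _+_; _*_; _∸_; _≤_; _<_; _≥_; _≡ᵇ_; _≤ᵇ_; z≤n; s≤s; _≤′_; ≤′-refl; ≤′-step; _≤?_; _≟_; ⌊_/2⌋; ⌈_/2⌉)
open import Data.Nat.Properties
open import Data.Nat.Divisibility using (_∣_; divides)
open import Data.Bool using (Bool; true; false; _∧_; not; if_then_else_) renaming (T to IsTrue)
open import Data.Unit using (⊤; tt)
open import Data.Empty using (⊥; ⊥-elim)
open import Data.List using (List; []; _∷_; _++_; length; map; upTo; replicate)
open import Data.List.Properties using (map-upTo; length-map; length-upTo; map-∘; map-cong; length-++; length-replicate; ++-assoc; ++-cancelˡ; ∷-injective; ∷-injectiveˡ; ∷-injectiveʳ)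
open import Data.List.Relation.Unary.All as All using (All; []; _∷_)
import Data.List.Relation.Unary.All.Properties as AllP
open import Data.List.Relation.Unary.Any using (here; there)
open import Data.List.Relation.Unary.Linked as Linked using (Linked; []; [-]; _∷_)
open import Data.List.Relation.Unary.Unique.Propositional using (Unique; []; _∷_)
open import Data.List.Membership.Propositional using (_∈_; _∉_)
open import Data.List.Membership.Propositional.Properties using (∈-map⁺; ∈-map⁻; ∈-++⁺ˡ; ∈-++⁺ʳ; ∈-++⁻; ∈-upTo⁺)
open import Data.List.Membership.DecPropositional _≟_ using (_∈?_)
open import Data.Product using (Σ; ∃; _×_; _,_; proj₁; proj₂)
open import Data.Sum using (_⊎_; inj₁; inj₂)
open import Function using (_∘_)
open import Relation.Nullary using (¬_; Dec; yes; no; contradiction)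
open import Relation.Binary.PropositionalEquality using (_≡_; _≢_; refl; sym; trans; cong; cong₂; subst; subst₂; module ≡-Reasoning)
open import Function.Bundles using (Bijection)

-- The marks of the two sides, values of a pistol and residues of row lengths, are never matched
-- with one another; only their numbers agree. So a code stores positions in lists, and each side
-- reads the same code with its own lists. Going backwards is essential, because then the number of
-- choices depends on the size alone. Let m marks besides the permanent one remain after a stage.
-- Undoing its first half leaves m' = m or m' = m + 1 marks, in m' + 1 ways each, exactly one of
-- them being the fixed point, respectively the empty run. Undoing the other half keeps m' in m' + 1
-- ways and lowers it in m' ways.
--
-- The two bits of a step are what is forgotten going forwards. For pistols they tell whether a
-- value of f is 2n or repeats an earlier one. For columns the first bit undoes the merging of t - 1
-- and 0. The second comes from the columns (i+1, k-i) being taller by one than the columns (i,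
-- k-i): they open a row whether or not a row of length t gets closed, so the residue 0 is forgotten
-- there too.
--
-- The pair (1, k) never occurs: fewer than k columns cannot complete a row of length k. Hence
-- stages start at 1.

≤ᵇ-true : ∀ {m n} → m ≤ n → (m ≤ᵇ n) ≡ true
≤ᵇ-true {m} {n} p with m ≤ᵇ n | ≤⇒≤ᵇ p
... | true | _ = refl

≤ᵇ-true⁻ : ∀ {m n} → (m ≤ᵇ n) ≡ true → m ≤ n
≤ᵇ-true⁻ {m} {n} eq = ≤ᵇ⇒≤ m n (subst IsTrue (sym eq) tt)

≤ᵇ-false⁻ : ∀ {m n} → (m ≤ᵇ n) ≡ false → n < m
≤ᵇ-false⁻ eq = ≰⇒> λ p → case-⊥ (trans (sym (≤ᵇ-true p)) eq)
  where case-⊥ : true ≡ false → ⊥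
        case-⊥ ()

≡ᵇ-true : ∀ {m n} → m ≡ n → (m ≡ᵇ n) ≡ true
≡ᵇ-true {m} {n} p with m ≡ᵇ n | ≡⇒≡ᵇ m n p
... | true | _ = refl

≡ᵇ-true⁻ : ∀ {m n} → (m ≡ᵇ n) ≡ true → m ≡ n
≡ᵇ-true⁻ {m} {n} eq = ≡ᵇ⇒≡ m n (subst IsTrue (sym eq) tt)

≡ᵇ-false : ∀ {m n} → m ≢ n → (m ≡ᵇ n) ≡ false
≡ᵇ-false {m} {n} h with m ≡ᵇ n in e
... | true  = contradiction (≡ᵇ-true⁻ e) h
... | false = refl

bool-ext : ∀ {a b} → (a ≡ true → b ≡ true) → (b ≡ true → a ≡ true) → a ≡ b
bool-ext {false} {false} f g = refl
bool-ext {false} {true}  f g = g refl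
bool-ext {true}  {b}     f g = sym (f refl)

bool-ext-false : ∀ {a b} → (a ≡ false → b ≡ false) → (b ≡ false → a ≡ false) → a ≡ b
bool-ext-false {false}         f g = sym (f refl)
bool-ext-false {true}  {false} f g = g refl
bool-ext-false {true}  {true}  f g = refl

∧-true : ∀ {a b} → a ≡ true → b ≡ true → a ∧ b ≡ true
∧-true refl refl = refl

∧-true⁻ : ∀ {a b} → a ∧ b ≡ true → a ≡ true × b ≡ true
∧-true⁻ {true} {true} eq = refl , refl

-- Counting, ranges and 1-based lookup

count-++ : ∀ {A : Set} (p : A → Bool) xs ys → count p (xs ++ ys) ≡ count p xs + count p ys
count-++ p []       ys = refl
count-++ p (x ∷ xs) ys with p x
... | true  = cong suc (count-++ p xs ys)
... | false = count-++ p xs ys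

count-map : ∀ {A B : Set} (p : B → Bool) (g : A → B) xs → count p (map g xs) ≡ count (p ∘ g) xs
count-map p g []       = refl
count-map p g (x ∷ xs) rewrite count-map p g xs = refl

count-cong : ∀ {A : Set} {p q : A → Bool} → (∀ x → p x ≡ q x) → ∀ xs → count p xs ≡ count q xs
count-cong h []       = refl
count-cong h (x ∷ xs) rewrite h x | count-cong h xs = refl

range-suc : ∀ n → range (suc n) ≡ 1 ∷ map suc (range n)
range-suc n = cong (λ l → 1 ∷ map suc l) (sym (map-upTo suc n))

count-range-suc : ∀ p n → count p (range (suc n))
  ≡ (if p 1 then suc (count (p ∘ suc) (range n)) else count (p ∘ suc) (range n))
count-range-suc p n = trans (cong (count p) (range-suc n))
  (cong (λ x → if p 1 then suc x else x) (count-map p suc (range n)))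

count-range-cong : ∀ {p q} → (∀ c → p (suc c) ≡ q (suc c)) → ∀ n → count p (range n) ≡ count q (range n)
count-range-cong {p} {q} h n
  rewrite count-map p suc (upTo n) | count-map q suc (upTo n) = count-cong h (upTo n)

length-range : ∀ n → length (range n) ≡ n
length-range n = trans (length-map suc (upTo n)) (length-upTo n)

map-range-suc : ∀ {A : Set} (f : ℕ → A) n → map f (range (suc n)) ≡ f 1 ∷ map (f ∘ suc) (range n)
map-range-suc f n = trans (cong (map f) (range-suc n)) (cong (f 1 ∷_) (sym (map-∘ (range n))))

map-range-cong : ∀ {A : Set} {f g : ℕ → A} n → (∀ i → 1 ≤ i → i ≤ n → f i ≡ g i) →
                 map f (range n) ≡ map g (range n)
map-range-cong zero h = refl
map-range-cong {f = f} {g} (suc n) h = trans (map-range-suc f n) (trans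
  (cong₂ _∷_ (h 1 ≤-refl (s≤s z≤n)) (map-range-cong n λ i p q → h (suc i) (s≤s z≤n) (s≤s q)))
  (sym (map-range-suc g n)))

at-map-range : ∀ (f : ℕ → ℕ) n r → 1 ≤ r → r ≤ n → at (map f (range n)) r ≡ f r
at-map-range f (suc n) (suc zero) p (s≤s q) = refl
at-map-range f (suc n) (suc (suc r)) p (s≤s q) =
  trans (cong (λ l → at l (suc (suc r))) (map-range-suc f n)) (at-map-range (f ∘ suc) n (suc r) (s≤s z≤n) q)

at-0 : ∀ xs → at xs 0 ≡ 0
at-0 []       = refl
at-0 (x ∷ xs) = refl

at-beyond : ∀ xs r → length xs < r → at xs r ≡ 0
at-beyond []       r             p       = refl
at-beyond (x ∷ xs) (suc zero)    (s≤s ())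
at-beyond (x ∷ xs) (suc (suc r)) (s≤s p) = at-beyond xs (suc r) p

at-replicate : ∀ n r x → 1 ≤ r → r ≤ n → at (replicate n x) r ≡ x
at-replicate (suc n) (suc zero)    x p q       = refl
at-replicate (suc n) (suc (suc r)) x p (s≤s q) = at-replicate n (suc r) x (s≤s z≤n) q

∈⇒at : ∀ {x xs} → x ∈ xs → ∃ λ r → 1 ≤ r × r ≤ length xs × at xs r ≡ x
∈⇒at (here refl) = 1 , s≤s z≤n , s≤s z≤n , refl
∈⇒at (there m) with ∈⇒at m
... | suc r , p , q , e = suc (suc r) , s≤s z≤n , s≤s q , e

at⇒∈ : ∀ xs r → 1 ≤ r → r ≤ length xs → at xs r ∈ xs
at⇒∈ (x ∷ xs) (suc zero)    p q       = here refl
at⇒∈ (x ∷ xs) (suc (suc r)) p (s≤s q) = there (at⇒∈ xs (suc r) (s≤s z≤n) q)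

at-pos⇒≤length : ∀ xs r → 1 ≤ at xs r → r ≤ length xs
at-pos⇒≤length xs r p with r ≤? length xs
... | yes q = q
... | no ¬q = contradiction p (subst (λ z → ¬ 1 ≤ z) (sym (at-beyond xs r (≰⇒> ¬q))) λ ())

-- Decreasing sequences and column heights

Decr : (ℕ → ℕ) → Set
Decr f = ∀ r → 1 ≤ r → f (suc r) ≤ f r

decr-anti : ∀ {f} → Decr f → ∀ {r r'} → 1 ≤ r → r ≤ r' → f r' ≤ f r
decr-anti {f} h {r} p q = go (≤⇒≤′ q)
  where
  go : ∀ {r'} → r ≤′ r' → f r' ≤ f r
  go ≤′-refl     = ≤-refl
  go (≤′-step q) = ≤-trans (h _ (≤-trans p (≤′⇒≤ q))) (go q)

linked⇒decr : ∀ {xs} → Linked _≥_ xs → Decr (at xs)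
linked⇒decr []      r             p = z≤n
linked⇒decr [-]     (suc zero)    p = z≤n
linked⇒decr [-]     (suc (suc r)) p = z≤n
linked⇒decr (x ∷ l) (suc zero)    p = x
linked⇒decr (x ∷ l) (suc (suc r)) p = linked⇒decr l (suc r) (s≤s z≤n)

decr⇒linked : ∀ xs → (∀ r → 1 ≤ r → r < length xs → at xs (suc r) ≤ at xs r) → Linked _≥_ xs
decr⇒linked []           h = []
decr⇒linked (x ∷ [])     h = [-]
decr⇒linked (x ∷ y ∷ xs) h =
  h 1 ≤-refl (s≤s (s≤s z≤n)) ∷ decr⇒linked (y ∷ xs) λ { (suc r) p q → h (suc (suc r)) (s≤s z≤n) (s≤s q) }

colHt-at : ∀ s → Decr (at s) → ∀ {c r} → 1 ≤ c → 1 ≤ r → c ≤ at s r → r ≤ colHt s c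
colHt-at [] h {c} (s≤s p) q ()
colHt-at (x ∷ s) h {c} {r} p q le with c ≤ᵇ x in eq
colHt-at (x ∷ s) h {c} {suc zero}    p q le | true  = s≤s z≤n
colHt-at (x ∷ s) h {c} {suc (suc r)} p q le | true  =
  s≤s (colHt-at s (λ { (suc r) _ → h (suc (suc r)) (s≤s z≤n) }) p (s≤s z≤n) le)
... | false = contradiction (≤-trans le (decr-anti h ≤-refl q)) (<⇒≱ (≤ᵇ-false⁻ eq))

at-colHt : ∀ s → Decr (at s) → ∀ {c r} → 1 ≤ c → 1 ≤ r → r ≤ colHt s c → c ≤ at s r
at-colHt [] h p (s≤s q) ()
at-colHt (x ∷ s) h {c} {r} p q le with c ≤ᵇ x in eq
at-colHt (x ∷ s) h {c} {suc zero}    p q le       | true  = ≤ᵇ-true⁻ eq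
at-colHt (x ∷ s) h {c} {suc (suc r)} p q (s≤s le) | true  =
  at-colHt s (λ { (suc r) _ → h (suc (suc r)) (s≤s z≤n) }) p (s≤s z≤n) le
at-colHt (x ∷ s) h {c} {suc r} p q le | false =
  contradiction
    (≤-trans (at-colHt s (λ { (suc r) _ → h (suc (suc r)) (s≤s z≤n) }) p q le)
             (decr-anti h ≤-refl (s≤s (z≤n {suc r}))))
    (<⇒≱ (≤ᵇ-false⁻ eq))

at<colHt : ∀ s → Decr (at s) → ∀ {c r} → 1 ≤ c → colHt s c < r → at s r < c
at<colHt s h {c} {suc r} p lt = ≰⇒> λ le → <⇒≱ lt (colHt-at s h p (s≤s z≤n) le)

-- Used to recognise the depth of a given column as the number of rows reaching a threshold. The
-- premise `1 ≤ d` guards against `at s 0`, which is 0.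
colHt-unique : ∀ s → Decr (at s) → ∀ {c d} → 1 ≤ c → (1 ≤ d → c ≤ at s d) → at s (suc d) < c →
               d ≡ colHt s c
colHt-unique s h {c} {d} p lo hi = ≤-antisym (lower d lo) (≮⇒≥ λ lt → <⇒≱ hi (at-colHt s h p (s≤s z≤n) lt))
  where
  lower : ∀ d → (1 ≤ d → c ≤ at s d) → d ≤ colHt s c
  lower zero    lo = z≤n
  lower (suc d) lo = colHt-at s h p (s≤s z≤n) (lo (s≤s z≤n))

colHt≤length : ∀ s c → colHt s c ≤ length s
colHt≤length []      c = z≤n
colHt≤length (x ∷ s) c with c ≤ᵇ x
... | true  = s≤s (colHt≤length s c)
... | false = m≤n⇒m≤1+n (colHt≤length s c)

-- Adding a column on the left

addcol : ℕ → List ℕ → List ℕ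
addcol h s = map suc s ++ replicate (h ∸ length s) 1

length-addcol : ∀ h s → length s ≤ h → length (addcol h s) ≡ h
length-addcol h s p
  rewrite length-++ (map suc s) {replicate (h ∸ length s) 1} | length-map suc s
        | length-replicate (h ∸ length s) {1} = m+[n∸m]≡n p

at-addcol : ∀ h s r → length s ≤ h → 1 ≤ r → r ≤ h → at (addcol h s) r ≡ suc (at s r)
at-addcol h       []      r             p       q le       = at-replicate h r 1 q le
at-addcol (suc h) (x ∷ s) (suc zero)    (s≤s p) q le       = refl
at-addcol (suc h) (x ∷ s) (suc (suc r)) (s≤s p) q (s≤s le) = at-addcol h s (suc r) p (s≤s z≤n) le

at-addcol> : ∀ h s r → length s ≤ h → h < r → at (addcol h s) r ≡ 0
at-addcol> h s r p lt = at-beyond (addcol h s) r (subst (_< r) (sym (length-addcol h s p)) lt)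

colHt-addcol-1 : ∀ h s → length s ≤ h → colHt (addcol h s) 1 ≡ h
colHt-addcol-1 zero    []      p = refl
colHt-addcol-1 (suc h) []      p = cong suc (colHt-addcol-1 h [] z≤n)
colHt-addcol-1 (suc h) (x ∷ s) (s≤s p) = cong suc (colHt-addcol-1 h s p)

colHt-replicate : ∀ n c → colHt (replicate n 1) (suc (suc c)) ≡ 0
colHt-replicate zero    c = refl
colHt-replicate (suc n) c = colHt-replicate n c

colHt-addcol-suc : ∀ h s c → colHt (addcol h s) (suc (suc c)) ≡ colHt s (suc c)
colHt-addcol-suc h s c
  rewrite count-++ (λ x → suc (suc c) ≤ᵇ x) (map suc s) (replicate (h ∸ length s) 1)
        | count-map (λ x → suc (suc c) ≤ᵇ x) suc s
        | colHt-replicate (h ∸ length s) c = +-identityʳ _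

decr-addcol : ∀ h s → length s ≤ h → Decr (at s) → Decr (at (addcol h s))
decr-addcol h s p dec r q with suc r ≤? h
... | yes le rewrite at-addcol h s (suc r) p (s≤s z≤n) le
                   | at-addcol h s r p q (≤-trans (n≤1+n r) le) = s≤s (dec r q)
... | no ¬le rewrite at-addcol> h s (suc r) p (≰⇒> ¬le) = z≤n

-- The part of a new column that lies in ∂ᵏ

inCol : ℕ → ℕ → ℕ → Bool
inCol d v r = (suc d ≤ᵇ r) ∧ (r ≤ᵇ d + v)

inCol-true : ∀ {d v r} → d < r → r ≤ d + v → inCol d v r ≡ true
inCol-true p q = ∧-true (≤ᵇ-true p) (≤ᵇ-true q)

inCol-true⁻ : ∀ {d v r} → inCol d v r ≡ true → d < r × r ≤ d + v
inCol-true⁻ e with ∧-true⁻ e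
... | p , q = ≤ᵇ-true⁻ p , ≤ᵇ-true⁻ q

inCol-false : ∀ {d v r} → ¬ (d < r × r ≤ d + v) → inCol d v r ≡ false
inCol-false {d} {v} {r} n with inCol d v r in eq
... | true  = contradiction (inCol-true⁻ {d} {v} eq) n
... | false = refl

inBd-true⁻ : ∀ {k s r c} → inBd k s r c ≡ true → 1 ≤ r × 1 ≤ c × c ≤ at s r × hook s r c ≤ k
inBd-true⁻ {k} {s} {r} {c} e with ∧-true⁻ {1 ≤ᵇ r} e
... | p , e₁ with ∧-true⁻ {1 ≤ᵇ c} e₁
... | q , e₂ with ∧-true⁻ {c ≤ᵇ at s r} e₂
... | x , y = ≤ᵇ-true⁻ p , ≤ᵇ-true⁻ q , ≤ᵇ-true⁻ x , ≤ᵇ-true⁻ y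

inBd-true : ∀ {k s r c} → 1 ≤ r → 1 ≤ c → c ≤ at s r → hook s r c ≤ k → inBd k s r c ≡ true
inBd-true p q x y = ∧-true (≤ᵇ-true p) (∧-true (≤ᵇ-true q) (∧-true (≤ᵇ-true x) (≤ᵇ-true y)))

-- In a new first column of height `d + v` the cell of row `d` has hook length `suc (at s d) + v`
-- and that of row `suc d` has `at s (suc d) + v`. So hook lengths pass `k` exactly between these
-- two rows. The guard on `hi` admits `v = 0`, a case that `add-good` has to refute.
record Split (k : ℕ) (s : List ℕ) (d v : ℕ) : Set where
  field
    dec : Decr (at s)
    len : length s ≤ d + v
    lo  : 1 ≤ d → k ≤ at s d + v
    hi  : 1 ≤ v → at s (suc d) + v ≤ k

-- Hook lengths strictly decrease going up a column, so the inequalities of `Split` at the two rows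
-- around the cut decide all the others.
inBd-addcol-1 : ∀ {k s d v} → Split k s d v → ∀ r → inBd k (addcol (d + v) s) r 1 ≡ inCol d v r
inBd-addcol-1 {k} {s} {d} {v} sp r = bool-ext to from
    where
    open Split sp
    h = d + v
    hook-addcol-1 : ∀ r → 1 ≤ r → r ≤ h → hook (addcol h s) r 1 ≡ suc (at s r) + (h ∸ r)
    hook-addcol-1 r p q rewrite at-addcol h s r len p q | colHt-addcol-1 h s len = refl
    to : inBd k (addcol h s) r 1 ≡ true → inCol d v r ≡ true
    to e with inBd-true⁻ {k} {addcol h s} {r} {1} e
    ... | p , _ , x , y = inCol-true (≰⇒> r≰d) r≤h
      where
      r≤h : r ≤ h
      r≤h = subst (r ≤_) (length-addcol h s len) (at-pos⇒≤length (addcol h s) r x)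
      y' : suc (at s r) + (h ∸ r) ≤ k
      y' = subst (_≤ k) (hook-addcol-1 r p r≤h) y
      r≰d : ¬ r ≤ d
      r≰d r≤d = <⇒≱ (s≤s (≤-trans (lo (≤-trans p r≤d))
                  (+-mono-≤ (decr-anti dec p r≤d)
                            (subst (_≤ h ∸ r) (m+n∸m≡n d v) (∸-monoʳ-≤ h r≤d))))) y'
    from : inCol d v r ≡ true → inBd k (addcol h s) r 1 ≡ true
    from e with inCol-true⁻ {d} {v} e
    ... | d<r , r≤h = inBd-true {k} {addcol h s} p ≤-refl
            (subst (1 ≤_) (sym (at-addcol h s r len p r≤h)) (s≤s z≤n))
            (subst (_≤ k) (sym (hook-addcol-1 r p r≤h))
              (≤-trans (≤-reflexive (sym (+-suc (at s r) (h ∸ r))))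
              (≤-trans (+-mono-≤ (decr-anti dec (s≤s z≤n) d<r) h∸r<v) (hi 1≤v))))
      where
      p : 1 ≤ r
      p = ≤-trans (s≤s z≤n) d<r
      h∸r<v : suc (h ∸ r) ≤ v
      h∸r<v = subst (_≤ v) (+-∸-assoc 1 r≤h)
                (subst (suc h ∸ r ≤_) (m+n∸m≡n d v) (∸-monoʳ-≤ (suc h) d<r))
      1≤v : 1 ≤ v
      1≤v = +-cancelˡ-≤ d 1 v (≤-trans (subst (_≤ r) (sym (+-comm d 1)) d<r) r≤h)

firstWith-cong : ∀ {p q : ℕ → Bool} → (∀ x → p x ≡ q x) → ∀ xs → firstWith p xs ≡ firstWith q xs
firstWith-cong e []       = refl
firstWith-cong e (x ∷ xs) rewrite e x | firstWith-cong e xs = refl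

module _ (k : ℕ) (s : List ℕ) (h : ℕ) (len : length s ≤ h) where

  -- A hook looks only to the right and upwards, so a column added on the left leaves the old hook
  -- lengths unchanged. Rows above `h` are empty in both shapes.
  inBd-addcol-suc : ∀ r c → inBd k (addcol h s) r (suc (suc c)) ≡ inBd k s r (suc c)
  inBd-addcol-suc zero c = refl
  inBd-addcol-suc (suc r) c with suc r ≤? h
  ... | yes q rewrite at-addcol h s (suc r) len (s≤s z≤n) q | colHt-addcol-suc h s c = refl
  ... | no ¬q rewrite at-addcol> h s (suc r) len (≰⇒> ¬q)
                    | at-beyond s (suc r) (≤-<-trans len (≰⇒> ¬q)) = refl

  bdRow-addcol : ∀ r → bdRow k (addcol h s) r
    ≡ (if inBd k (addcol h s) r 1 then suc (bdRow k s r) else bdRow k s r)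
  bdRow-addcol zero rewrite at-0 (addcol h s) | at-0 s = refl
  bdRow-addcol (suc r) with suc r ≤? h
  ... | yes q = begin
      count (inBd k (addcol h s) (suc r)) (range (at (addcol h s) (suc r)))
        ≡⟨ cong (λ n → count (inBd k (addcol h s) (suc r)) (range n)) (at-addcol h s (suc r) len (s≤s z≤n) q) ⟩
      count (inBd k (addcol h s) (suc r)) (range (suc (at s (suc r))))
        ≡⟨ count-range-suc (inBd k (addcol h s) (suc r)) (at s (suc r)) ⟩
      (if inBd k (addcol h s) (suc r) 1 then suc X else X)
        ≡⟨ cong (λ n → if inBd k (addcol h s) (suc r) 1 then suc n else n)
             (count-range-cong (inBd-addcol-suc (suc r)) (at s (suc r))) ⟩
      _ ∎
    where
    open ≡-Reasoning
    X = count (inBd k (addcol h s) (suc r) ∘ suc) (range (at s (suc r)))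
  ... | no ¬q rewrite at-addcol> h s (suc r) len (≰⇒> ¬q)
                    | at-beyond s (suc r) (≤-<-trans len (≰⇒> ¬q)) = refl

  bdCol-addcol-suc : ∀ c → bdCol k (addcol h s) (suc (suc c)) ≡ bdCol k s (suc c)
  bdCol-addcol-suc c = trans
    (cong (λ n → count (λ r → inBd k (addcol h s) r (suc (suc c))) (range n)) (colHt-addcol-suc h s c))
    (count-cong (λ r → inBd-addcol-suc r c) (range (colHt s (suc c))))

  lowestRow-addcol-suc : ∀ c → lowestRow k (addcol h s) (suc (suc c)) ≡ lowestRow k s (suc c)
  lowestRow-addcol-suc c = trans
    (cong (λ n → firstWith (λ r → inBd k (addcol h s) r (suc (suc c))) (range n)) (colHt-addcol-suc h s c))
    (firstWith-cong (λ r → inBd-addcol-suc r c) (range (colHt s (suc c))))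

  cs-addcol : 1 ≤ h → cs k (addcol h s) ≡ bdCol k (addcol h s) 1 ∷ cs k s
  cs-addcol p = trans (cong (λ n → map (bdCol k (addcol h s)) (range n)) (at-addcol h s 1 len ≤-refl p))
    (trans (map-range-suc (bdCol k (addcol h s)) (at s 1)) (cong (bdCol k (addcol h s) 1 ∷_) (begin
      map (bdCol k (addcol h s) ∘ suc) (map suc (upTo (at s 1)))  ≡⟨ map-∘ (upTo (at s 1)) ⟨
      map (bdCol k (addcol h s) ∘ suc ∘ suc) (upTo (at s 1))      ≡⟨ map-cong bdCol-addcol-suc (upTo (at s 1)) ⟩
      map (bdCol k s ∘ suc) (upTo (at s 1))                       ≡⟨ map-∘ (upTo (at s 1)) ⟩
      cs k s ∎)))
    where open ≡-Reasoning

count-all : ∀ {p : ℕ → Bool} n → (∀ c → c < n → p (suc c) ≡ true) → count p (range n) ≡ n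
count-all zero h = refl
count-all {p} (suc n) h = trans (count-range-suc p n)
  (trans (cong (λ b → if b then suc X else X) (h 0 (s≤s z≤n))) (cong suc (count-all n λ c q → h (suc c) (s≤s q))))
  where X = count (p ∘ suc) (range n)

count-inCol : ∀ d v → count (inCol d v) (range (d + v)) ≡ v
count-inCol zero v = count-all v λ c q → inCol-true {0} (s≤s z≤n) q
count-inCol (suc d) v = trans (count-range-suc (inCol (suc d) v) (d + v))
  (trans (count-range-cong (λ c → refl) (d + v)) (count-inCol d v))

firstWith-inCol : ∀ d v → firstWith (inCol d (suc v)) (range (d + suc v)) ≡ suc d
firstWith-inCol d v = go (d + suc v) d (inCol d (suc v)) (m<m+n d (s≤s z≤n))
    (λ { c (s≤s q) → inCol-false {d} λ { (x , _) → <⇒≱ x q } }) (inCol-true {d} ≤-refl (≤-trans (≤-reflexive (sym (+-comm d 1))) (+-monoʳ-≤ d (s≤s z≤n))))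
  where
  shift : ∀ (p : ℕ → Bool) xs x → firstWith (p ∘ suc) xs ≡ suc x → firstWith p (map suc xs) ≡ suc (suc x)
  shift p (y ∷ xs) x e with p (suc y)
  ... | true  = cong suc e
  ... | false = shift p xs x e
  go : ∀ n d (p : ℕ → Bool) → d < n → (∀ c → c < suc d → p c ≡ false) → p (suc d) ≡ true →
       firstWith p (range n) ≡ suc d
  go (suc n) zero p q lo e rewrite e = refl
  go (suc n) (suc d) p (s≤s q) lo e = trans (cong (firstWith p) (range-suc n))
    (trans (cong (λ b → if b then 1 else firstWith p (map suc (range n))) (lo 1 (s≤s (s≤s z≤n))))
           (shift p (range n) d (go n d (p ∘ suc) q (λ c x → lo (suc c) (s≤s x)) e)))

-- A partition is given by the list of its columns (d , v), from left to right: v cells of ∂ᵏ on top of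
-- d cells of hook length greater than k.

sh : List (ℕ × ℕ) → List ℕ
sh []            = []
sh ((d , v) ∷ C) = addcol (d + v) (sh C)

rl : List (ℕ × ℕ) → ℕ → ℕ
rl []            r = 0
rl ((d , v) ∷ C) r = if inCol d v r then suc (rl C r) else rl C r

-- The premises are those of `Split` together with `1 ≤ v`. No k-shape is lost: its column heights
-- decrease and, for `k ≥ 1`, its last column meets ∂ᵏ, so all of them are positive.
data Good (k : ℕ) : List (ℕ × ℕ) → Set where
  []   : Good k []
  good : ∀ {d v C} → 1 ≤ v → length (sh C) ≤ d + v → (1 ≤ d → k ≤ at (sh C) d + v) →
         at (sh C) (suc d) + v ≤ k → Good k C → Good k ((d , v) ∷ C)

good-decr : ∀ {k C} → Good k C → Decr (at (sh C))
good-decr [] r p = z≤n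
good-decr (good {d} {v} {C} _ len _ _ g) = decr-addcol (d + v) (sh C) len (good-decr g)

good-split : ∀ {k d v C} → 1 ≤ v → length (sh C) ≤ d + v → (1 ≤ d → k ≤ at (sh C) d + v) →
             at (sh C) (suc d) + v ≤ k → Good k C → Split k (sh C) d v
good-split _ len lo hi g = record { dec = good-decr g ; len = len ; lo = lo ; hi = λ _ → hi }

sh-pos : ∀ C → All (0 <_) (sh C)
sh-pos []            = []
sh-pos ((d , v) ∷ C) = AllP.++⁺ (AllP.map⁺ (All.universal (λ _ → s≤s z≤n) (sh C)))
                                (AllP.replicate⁺ (d + v ∸ length (sh C)) (s≤s z≤n))

rl-in : ∀ {d v C r} → d < r → r ≤ d + v → rl ((d , v) ∷ C) r ≡ suc (rl C r)
rl-in {d} {v} {C} {r} p q rewrite inCol-true {d} {v} p q = refl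

rl-out : ∀ {d v C r} → ¬ (d < r × r ≤ d + v) → rl ((d , v) ∷ C) r ≡ rl C r
rl-out {d} {v} {C} {r} n rewrite inCol-false {d} {v} n = refl

rl-mono-∷ : ∀ c C r → rl C r ≤ rl (c ∷ C) r
rl-mono-∷ (d , v) C r with inCol d v r
... | true  = n≤1+n _
... | false = ≤-refl

at-shift≥ : ∀ h s r → length s ≤ h → 1 ≤ r → at s r ≤ at (addcol h s) r
at-shift≥ h s r len p with r ≤? h
... | yes q rewrite at-addcol h s r len p q = n≤1+n _
... | no ¬q rewrite at-beyond s r (≤-<-trans len (≰⇒> ¬q)) = z≤n

rl≤at : ∀ {k C} → Good k C → ∀ r → 1 ≤ r → rl C r ≤ at (sh C) r
rl≤at [] r _ = z≤n
rl≤at (good {d} {v} {C} _ len _ _ g) r p with inCol d v r in e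
... | false = ≤-trans (rl≤at g r p) (at-shift≥ (d + v) (sh C) r len p)
... | true with inCol-true⁻ {d} {v} e
...   | _ , q rewrite at-addcol (d + v) (sh C) r len p q = s≤s (rl≤at g r p)

bdRow≡rl : ∀ {k C} → Good k C → ∀ r → bdRow k (sh C) r ≡ rl C r
bdRow≡rl [] r = refl
bdRow≡rl {k} (good {d} {v} {C} 1≤v len lo hi g) r = begin
  bdRow k (addcol (d + v) (sh C)) r
    ≡⟨ bdRow-addcol k (sh C) (d + v) len r ⟩
  (if inBd k (addcol (d + v) (sh C)) r 1 then suc (bdRow k (sh C) r) else bdRow k (sh C) r)
    ≡⟨ cong₂ (λ b x → if b then suc x else x) (inBd-addcol-1 (good-split 1≤v len lo hi g) r) (bdRow≡rl g r) ⟩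
  (if inCol d v r then suc (rl C r) else rl C r) ∎
  where open ≡-Reasoning

bdCol-first : ∀ {k s d v} → Split k s d v → bdCol k (addcol (d + v) s) 1 ≡ v
bdCol-first {k} {s} {d} {v} sp = begin
  count (λ r → inBd k (addcol (d + v) s) r 1) (range (colHt (addcol (d + v) s) 1))
    ≡⟨ cong (λ n → count (λ r → inBd k (addcol (d + v) s) r 1) (range n)) (colHt-addcol-1 (d + v) s (Split.len sp)) ⟩
  count (λ r → inBd k (addcol (d + v) s) r 1) (range (d + v))
    ≡⟨ count-cong (inBd-addcol-1 sp) (range (d + v)) ⟩
  count (inCol d v) (range (d + v))
    ≡⟨ count-inCol d v ⟩
  v ∎
  where open ≡-Reasoning

lowestRow-first : ∀ {k s d v} → Split k s d v → 1 ≤ v → lowestRow k (addcol (d + v) s) 1 ≡ suc d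
lowestRow-first {k} {s} {d} {suc v} sp _ = begin
  firstWith (λ r → inBd k (addcol (d + suc v) s) r 1) (range (colHt (addcol (d + suc v) s) 1))
    ≡⟨ cong (λ n → firstWith (λ r → inBd k (addcol (d + suc v) s) r 1) (range n)) (colHt-addcol-1 (d + suc v) s (Split.len sp)) ⟩
  firstWith (λ r → inBd k (addcol (d + suc v) s) r 1) (range (d + suc v))
    ≡⟨ firstWith-cong (inBd-addcol-1 sp) (range (d + suc v)) ⟩
  firstWith (inCol d (suc v)) (range (d + suc v))
    ≡⟨ firstWith-inCol d v ⟩
  suc d ∎
  where open ≡-Reasoning

-- Reading `cs`, `steps` and `meets` off the columns

cs≡heights : ∀ {k C} → Good k C → cs k (sh C) ≡ map proj₂ C
cs≡heights [] = refl
cs≡heights {k} (good {d} {v} {C} 1≤v len lo hi g) =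
  trans (cs-addcol k (sh C) (d + v) len (m≤n⇒m≤o+n d 1≤v))
        (cong₂ _∷_ (bdCol-first (good-split 1≤v len lo hi g)) (cs≡heights g))

-- The test `F` is arbitrary because the induction removes columns, whereas the test needed for
-- `steps` refers to row lengths of the whole shape.
count-columns : ∀ {k C} → Good k C → (F : ℕ → ℕ → Bool) →
  count (λ c → F (bdCol k (sh C) c) (lowestRow k (sh C) c)) (range (at (sh C) 1))
    ≡ count (λ { (d , v) → F v (suc d) }) C
count-columns [] F = refl
count-columns {k} (good {d} {v} {C} 1≤v len lo hi g) F = begin
  count P (range (at S 1))
    ≡⟨ cong (λ n → count P (range n)) (at-addcol (d + v) (sh C) 1 len ≤-refl (m≤n⇒m≤o+n d 1≤v)) ⟩
  count P (range (suc (at (sh C) 1)))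
    ≡⟨ count-range-suc P (at (sh C) 1) ⟩
  (if P 1 then suc (count (P ∘ suc) (range (at (sh C) 1))) else count (P ∘ suc) (range (at (sh C) 1)))
    ≡⟨ cong₂ (λ b x → if b then suc x else x)
         (cong₂ F (bdCol-first (good-split 1≤v len lo hi g)) (lowestRow-first (good-split 1≤v len lo hi g) 1≤v))
         (trans (count-range-cong (λ c → cong₂ F (bdCol-addcol-suc k (sh C) (d + v) len c) (lowestRow-addcol-suc k (sh C) (d + v) len c)) (at (sh C) 1))
                (count-columns g F)) ⟩
  (if F v (suc d) then suc X else X) ∎
  where
  open ≡-Reasoning
  S = addcol (d + v) (sh C)
  P = λ c → F (bdCol k S c) (lowestRow k S c)
  X = count (λ { (d , v) → F v (suc d) }) C

isStep : (ℕ → ℕ) → ℕ → ℕ → ℕ × ℕ → Bool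
isStep ρ u v (d , v') = (1 ≤ᵇ v) ∧ (v' ≡ᵇ v) ∧ (ρ (suc d) ≡ᵇ u)

steps≡count : ∀ {k C} → Good k C → ∀ u v → steps k (sh C) u v ≡ count (isStep (rl C) u v) C
steps≡count {k} {C} g u v = trans
  (count-columns g (λ x y → (1 ≤ᵇ v) ∧ (x ≡ᵇ v) ∧ (bdRow k (sh C) y ≡ᵇ u)))
  (count-cong (λ { (d , v') → cong (λ z → (1 ≤ᵇ v) ∧ (v' ≡ᵇ v) ∧ (z ≡ᵇ u)) (bdRow≡rl g (suc d)) }) C)

inBd⇒col : ∀ {k C} → Good k C → ∀ r c → inBd k (sh C) r (suc c) ≡ true →
  ∃ λ d → (d , bdCol k (sh C) (suc c)) ∈ C × d < r
inBd⇒col {k} [] zero c ()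
inBd⇒col {k} [] (suc r) c ()
inBd⇒col {k} (good {d} {v} {C} 1≤v len lo hi g) r zero e
  = d , here (cong (d ,_) (bdCol-first (good-split 1≤v len lo hi g))) , proj₁ (inCol-true⁻ {d} {v} (trans (sym (inBd-addcol-1 (good-split 1≤v len lo hi g) r)) e))
inBd⇒col {k} (good {d} {v} {C} 1≤v len lo hi g) r (suc c) e
  with inBd⇒col g r c (trans (sym (inBd-addcol-suc k (sh C) (d + v) len r c)) e)
... | d' , m , lt = d' , there (subst (λ z → (d' , z) ∈ C) (sym (bdCol-addcol-suc k (sh C) (d + v) len c)) m) , lt

col⇒inBd : ∀ {k C} → Good k C → ∀ {d v} → (d , v) ∈ C →
  ∃ λ c → inBd k (sh C) (suc d) (suc c) ≡ true × bdCol k (sh C) (suc c) ≡ v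
col⇒inBd (good {d} {v} 1≤v len lo hi g) (here refl) =
  0 , trans (inBd-addcol-1 (good-split 1≤v len lo hi g) (suc d))
        (inCol-true {d} ≤-refl (≤-trans (≤-reflexive (+-comm 1 d)) (+-monoʳ-≤ d 1≤v)))
    , bdCol-first (good-split 1≤v len lo hi g)
col⇒inBd {k} (good {d} {v} {C} _ len _ _ g) {d'} (there m) with col⇒inBd g m
... | c , e , e' = suc c , trans (inBd-addcol-suc k (sh C) (d + v) len (suc d') c) e , trans (bdCol-addcol-suc k (sh C) (d + v) len c) e'

anyᵇ-true : ∀ {A : Set} (p : A → Bool) {x xs} → x ∈ xs → p x ≡ true → anyᵇ p xs ≡ true
anyᵇ-true p {xs = y ∷ xs} (here refl) e rewrite e = refl
anyᵇ-true p {xs = y ∷ xs} (there m) e with p y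
... | true  = refl
... | false = anyᵇ-true p m e

anyᵇ-true⁻ : ∀ {A : Set} (p : A → Bool) xs → anyᵇ p xs ≡ true → ∃ λ x → x ∈ xs × p x ≡ true
anyᵇ-true⁻ p (y ∷ xs) e with p y in eq
... | true  = y , here refl , eq
... | false with anyᵇ-true⁻ p xs e
...   | x , m , e' = x , there m , e'

∈-range : ∀ {n r} → r < n → suc r ∈ range n
∈-range q = ∈-map⁺ suc (∈-upTo⁺ q)

meets-true : ∀ {k C d v} → Good k C → (d , v) ∈ C → meets k (sh C) (rl C (suc d)) v ≡ true
meets-true {k} {C} {d} {v} g m with col⇒inBd g m
... | c , e , e' with inBd-true⁻ {k} {sh C} {suc d} {suc c} e
...   | _ , _ , c≤ , _ = anyᵇ-true _ (∈-range (at-pos⇒≤length (sh C) (suc d) (≤-trans (s≤s z≤n) c≤)))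
        (anyᵇ-true _ (∈-range c≤) (∧-true e (∧-true (≡ᵇ-true (bdRow≡rl g (suc d))) (≡ᵇ-true e'))))

meets-true⁻ : ∀ {k C u v} → Good k C → meets k (sh C) u v ≡ true →
  ∃ λ d → ∃ λ r → (d , v) ∈ C × d < r × rl C r ≡ u
meets-true⁻ {k} {C} {u} {v} g e with anyᵇ-true⁻ _ (range (length (sh C))) e
... | r , _ , e₁ with anyᵇ-true⁻ _ (range (at (sh C) r)) e₁
... | c , c∈ , e₂ with ∈-map⁻ suc c∈
... | c' , _ , refl with ∧-true⁻ {inBd k (sh C) r (suc c')} e₂
... | e₃ , e₄ with ∧-true⁻ {bdRow k (sh C) r ≡ᵇ u} e₄
... | e₅ , e₆ with inBd⇒col g r c' e₃
... | d , m , lt = d , r , subst (λ z → (d , z) ∈ C) (≡ᵇ-true⁻ e₆) m , lt , trans (sym (bdRow≡rl g r)) (≡ᵇ-true⁻ e₅)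

-- Passing between k-shapes and lists of columns

good⇒kshape : ∀ {k C} → Good k C → Linked _≥_ (map proj₂ C) → Decr (rl C) → IsKShape k (sh C)
good⇒kshape {k} {C} g hts dec =
    (decr⇒linked (sh C) (λ r p _ → good-decr g r p) , sh-pos C)
  , decr⇒linked (rs k (sh C)) rows
  , subst (Linked _≥_) (sym (cs≡heights g)) hts
  where
  len : length (rs k (sh C)) ≡ length (sh C)
  len = trans (length-map _ (range (length (sh C)))) (length-range (length (sh C)))
  rows : ∀ r → 1 ≤ r → r < length (rs k (sh C)) → at (rs k (sh C)) (suc r) ≤ at (rs k (sh C)) r
  rows r p q = subst₂ _≤_ (sym (at-rs (suc r) (s≤s z≤n) q')) (sym (at-rs r p (<⇒≤ q'))) (dec r p)
    where
    q' = subst (r <_) len q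
    at-rs : ∀ r → 1 ≤ r → r ≤ length (sh C) → at (rs k (sh C)) r ≡ rl C r
    at-rs r p q = trans (at-map-range (bdRow k (sh C)) (length (sh C)) r p q) (bdRow≡rl g r)

decol : List ℕ → List ℕ
decol []                = []
decol (zero ∷ xs)       = decol xs
decol (suc zero ∷ xs)   = decol xs
decol (suc (suc x) ∷ xs) = suc x ∷ decol xs

decol-addcol : ∀ h s → All (0 <_) s → decol (addcol h s) ≡ s
decol-addcol zero    []          _        = refl
decol-addcol (suc h) []          _        = decol-addcol h [] []
decol-addcol zero    (suc x ∷ s) (_ ∷ ps) = cong (suc x ∷_) (trans (cong (λ z → decol (map suc s ++ replicate z 1)) (sym (0∸n≡0 (length s)))) (decol-addcol zero s ps))
decol-addcol (suc h) (suc x ∷ s) (_ ∷ ps) = cong (suc x ∷_) (decol-addcol h s ps)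

decol-ones : ∀ s → Linked _≥_ (suc zero ∷ s) → All (0 <_) s → decol s ≡ [] × s ≡ replicate (length s) 1
decol-ones [] l _ = refl , refl
decol-ones (suc zero ∷ s) (_ ∷ l) (_ ∷ ps) with decol-ones s l ps
... | e , e' = e , cong (1 ∷_) e'
decol-ones (suc (suc y) ∷ s) (s≤s () ∷ l) _

decol-pos : ∀ s → All (0 <_) (decol s)
decol-pos []                = []
decol-pos (zero ∷ xs)       = decol-pos xs
decol-pos (suc zero ∷ xs)   = decol-pos xs
decol-pos (suc (suc x) ∷ xs) = s≤s z≤n ∷ decol-pos xs

length-decol : ∀ s → length (decol s) ≤ length s
length-decol []                = z≤n
length-decol (zero ∷ xs)       = m≤n⇒m≤1+n (length-decol xs)
length-decol (suc zero ∷ xs)   = m≤n⇒m≤1+n (length-decol xs)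
length-decol (suc (suc x) ∷ xs) = s≤s (length-decol xs)

-- In a partition the rows of length 1, which `decol` drops, come last, so the padding of `addcol`
-- restores them in place.
addcol-decol : ∀ s → Linked _≥_ s → All (0 <_) s → addcol (length s) (decol s) ≡ s
addcol-decol [] l p = refl
addcol-decol (suc zero ∷ s) l (_ ∷ ps) with decol-ones s l ps
... | e , e' rewrite e = cong (1 ∷_) (sym e')
addcol-decol (suc (suc x) ∷ s) l (_ ∷ ps) = cong (suc (suc x) ∷_) (addcol-decol s (Linked.tail l) ps)

decr-decol : ∀ s → Linked _≥_ s → All (0 <_) s → Linked _≥_ (decol s)
decr-decol [] l p = []
decr-decol (suc zero ∷ s) l (_ ∷ ps) rewrite proj₁ (decol-ones s l ps) = []
decr-decol (suc (suc x) ∷ []) l (_ ∷ ps) = [-]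
decr-decol (suc (suc x) ∷ suc zero ∷ s) (_ ∷ l) (_ ∷ _ ∷ ps) rewrite proj₁ (decol-ones s l ps) = [-]
decr-decol (suc (suc x) ∷ suc (suc y) ∷ s) (s≤s q ∷ l) (_ ∷ ps) = q ∷ decr-decol (suc (suc y) ∷ s) l ps

-- The shape without its first column determines the tail, the first column of ∂ᵏ determines `v`,
-- and the number of rows is `d + v`.
good-unique : ∀ {k C C'} → Good k C → Good k C' → sh C ≡ sh C' → C ≡ C'
good-unique [] [] e = refl
good-unique [] (good {d} {v} {C} 1≤v len _ _ _) e =
  contradiction (m≤n⇒m≤o+n d 1≤v) (subst (λ z → ¬ 1 ≤ z) (trans (cong length e) (length-addcol (d + v) (sh C) len)) λ ())
good-unique (good {d} {v} {C} 1≤v len _ _ _) [] e =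
  contradiction (m≤n⇒m≤o+n d 1≤v) (subst (λ z → ¬ 1 ≤ z) (trans (cong length (sym e)) (length-addcol (d + v) (sh C) len)) λ ())
good-unique {k} (good {d} {v} {C} 1≤v len lo hi g) (good {d'} {v'} {C'} 1≤v' len' lo' hi' g') e
  with good-unique g g' (trans (sym (decol-addcol (d + v) (sh C) (sh-pos C)))
                        (trans (cong decol e) (decol-addcol (d' + v') (sh C') (sh-pos C'))))
... | refl with trans (sym (bdCol-first (good-split 1≤v len lo hi g)))
                (trans (cong (λ s → bdCol k s 1) e) (bdCol-first (good-split 1≤v' len' lo' hi' g')))
... | refl with +-cancelʳ-≡ v d d' (trans (sym (length-addcol (d + v) (sh C) len))
                (trans (cong length e) (length-addcol (d' + v) (sh C) len')))
... | refl = refl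

-- Descends from the top of the column and stops at the first row whose hook length exceeds `k`, or
-- at 0. The failed test at one row is the upper bound needed at the next, so no monotonicity of `a`
-- enters.
hook-split : ∀ k (a : ℕ → ℕ) h → ∃ λ d → ∃ λ v → d + v ≡ h × (1 ≤ d → k ≤ a d + v) × (1 ≤ v → a (suc d) + v ≤ k)
hook-split k a h = go h 0 (+-identityʳ h) λ ()
  where
  go : ∀ d v → d + v ≡ h → (1 ≤ v → a (suc d) + v ≤ k) →
       ∃ λ d → ∃ λ v → d + v ≡ h × (1 ≤ d → k ≤ a d + v) × (1 ≤ v → a (suc d) + v ≤ k)
  go zero    v e hi = 0 , v , e , (λ ()) , hi
  go (suc d) v e hi with k ≤? a (suc d) + v
  ... | yes p = suc d , v , e , (λ _ → p) , hi
  ... | no ¬p = go d (suc v) (trans (+-suc d v) e) λ _ → subst (_≤ k) (sym (+-suc (a (suc d)) v)) (≰⇒> ¬p)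

add-good : ∀ {k C h} → 1 ≤ k → Good k C → length (sh C) ≤ h → 1 ≤ h → Linked _≥_ (cs k (addcol h (sh C))) →
           ∃ λ d → ∃ λ v → d + v ≡ h × Good k ((d , v) ∷ C)
add-good {k} {C} {h} 1≤k g len 1≤h l with hook-split k (at (sh C)) h
... | d , suc v , refl , lo , hi = d , suc v , refl , good (s≤s z≤n) len lo (hi (s≤s z≤n)) g
-- A column without cells in ∂ᵏ contradicts the decrease of `cs` if there is a column to its right;
-- if there is none, `lo` reads `k ≤ 0`.
... | d , zero , refl , lo , hi = ⊥-elim (absurd g lo l')
  where
  sp : Split k (sh C) d 0
  sp = record { dec = good-decr g ; len = len ; lo = lo ; hi = hi }
  l' : Linked _≥_ (0 ∷ map proj₂ C)
  l' = subst (Linked _≥_) (trans (cs-addcol k (sh C) (d + 0) len 1≤h) (cong₂ _∷_ (bdCol-first sp) (cs≡heights g))) l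
  absurd : ∀ {C} → Good k C → (1 ≤ d → k ≤ at (sh C) d + 0) → Linked _≥_ (0 ∷ map proj₂ C) → ⊥
  absurd [] lo l = <⇒≱ 1≤k (lo (subst (1 ≤_) (+-identityʳ d) 1≤h))
  absurd (good 1≤v _ _ _ _) lo (q ∷ _) = <⇒≱ 1≤v q

-- Induction on a bound for the width, which drops by one under `decol`.
kshape⇒good : ∀ {k} → 1 ≤ k → ∀ s → IsPartition s → Linked _≥_ (cs k s) → ∃ λ C → Good k C × sh C ≡ s
kshape⇒good {k} 1≤k s = go (at s 1) s ≤-refl
  where
  width : ∀ {n} x s → x ≤ n → Linked _≥_ (suc x ∷ s) → All (0 <_) s → at (decol (suc x ∷ s)) 1 ≤ n
  width zero s le l ps rewrite proj₁ (decol-ones s l ps) = z≤n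
  width (suc x) s le l ps = le
  go : ∀ n s → at s 1 ≤ n → IsPartition s → Linked _≥_ (cs k s) → ∃ λ C → Good k C × sh C ≡ s
  go n [] _ _ _ = [] , [] , refl
  go zero (zero ∷ s) _ (_ , () ∷ _) _
  go (suc n) (zero ∷ s) _ (_ , () ∷ _) _
  go (suc n) (suc x ∷ s) (s≤s le) (l , p ∷ ps) cd = rest
      (go n (decol S) (width x s le l ps) (decr-decol S l (p ∷ ps) , decol-pos S)
          (Linked.tail (subst (Linked _≥_) (cs-addcol k (decol S) (length S) (length-decol S) (s≤s z≤n)) cd')))
    where
    S = suc x ∷ s
    eqS : addcol (length S) (decol S) ≡ S
    eqS = addcol-decol S l (p ∷ ps)
    cd' : Linked _≥_ (cs k (addcol (length S) (decol S)))
    cd' = subst (λ z → Linked _≥_ (cs k z)) (sym eqS) cd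
    rest : (∃ λ C → Good k C × sh C ≡ decol S) → ∃ λ C → Good k C × sh C ≡ S
    rest (C , g , e) with add-good 1≤k g (subst (λ z → length z ≤ length S) (sym e) (length-decol S)) (s≤s z≤n)
                            (subst (λ z → Linked _≥_ (cs k (addcol (length S) z))) (sym e) cd')
    ... | d , v , e' , g' = (d , v) ∷ C , g' , trans (cong₂ addcol e' e) eqS

-- Above the top row `rl` vanishes, so the finite list `rs` controls the whole function.
kshape-rows : ∀ {k C} → Good k C → Linked _≥_ (rs k (sh C)) → Decr (rl C)
kshape-rows {k} {C} g l r p with suc r ≤? length (sh C)
... | yes q = subst₂ _≤_ (at-rs (suc r) (s≤s z≤n) q) (at-rs r p (<⇒≤ q)) (linked⇒decr l r p)
  where
  at-rs : ∀ r → 1 ≤ r → r ≤ length (sh C) → at (rs k (sh C)) r ≡ rl C r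
  at-rs r p q = trans (at-map-range (bdRow k (sh C)) (length (sh C)) r p q) (bdRow≡rl g r)
... | no ¬q = subst (_≤ rl C r) (sym (n≤0⇒n≡0 (subst (rl C (suc r) ≤_) (at-beyond (sh C) (suc r) (≰⇒> ¬q))
                (rl≤at g (suc r) (s≤s z≤n))))) z≤n

-- Selection and deletion by position

nth : ℕ → List ℕ → ℕ
nth a       []       = 0
nth zero    (x ∷ xs) = x
nth (suc a) (x ∷ xs) = nth a xs

del : ℕ → List ℕ → List ℕ
del a       []       = []
del zero    (x ∷ xs) = xs
del (suc a) (x ∷ xs) = x ∷ del a xs

nth-∈ : ∀ a xs → a < length xs → nth a xs ∈ xs
nth-∈ zero    (x ∷ xs) p       = here refl
nth-∈ (suc a) (x ∷ xs) (s≤s p) = there (nth-∈ a xs p)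

∈-del⁻ : ∀ a xs {y} → y ∈ del a xs → y ∈ xs
∈-del⁻ zero    (x ∷ xs) m         = there m
∈-del⁻ (suc a) (x ∷ xs) (here e)  = here e
∈-del⁻ (suc a) (x ∷ xs) (there m) = there (∈-del⁻ a xs m)

∈-del : ∀ a xs {y} → y ≢ nth a xs → y ∈ xs → y ∈ del a xs
∈-del zero    (x ∷ xs) h (here e)  = contradiction e h
∈-del zero    (x ∷ xs) h (there m) = m
∈-del (suc a) (x ∷ xs) h (here e)  = here e
∈-del (suc a) (x ∷ xs) h (there m) = there (∈-del a xs h m)

length-del : ∀ a xs → a < length xs → suc (length (del a xs)) ≡ length xs
length-del zero    (x ∷ xs) p       = refl
length-del (suc a) (x ∷ xs) (s≤s p) = cong suc (length-del a xs p)

All-∉ : ∀ {x : ℕ} {xs} → All (x ≢_) xs → x ∉ xs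
All-∉ (p ∷ _) (here e)  = p e
All-∉ (_ ∷ h) (there m) = All-∉ h m

∉-All : ∀ {x : ℕ} xs → x ∉ xs → All (x ≢_) xs
∉-All []       h = []
∉-All (y ∷ xs) h = (λ e → h (here e)) ∷ ∉-All xs (h ∘ there)

unique-del : ∀ a xs → Unique xs → Unique (del a xs)
unique-del a       []       []      = []
unique-del zero    (x ∷ xs) (_ ∷ u) = u
unique-del (suc a) (x ∷ xs) (h ∷ u) = ∉-All (del a xs) (λ m → All-∉ h (∈-del⁻ a xs m)) ∷ unique-del a xs u

nth∉del : ∀ a xs → Unique xs → a < length xs → nth a xs ∉ del a xs
nth∉del zero    (x ∷ xs) (h ∷ u) p       m         = All-∉ h m
nth∉del (suc a) (x ∷ xs) (h ∷ u) (s≤s p) (here e)  = All-∉ h (subst (_∈ xs) e (nth-∈ a xs p))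
nth∉del (suc a) (x ∷ xs) (h ∷ u) (s≤s p) (there m) = nth∉del a xs u p m

nth-injective : ∀ a b xs → Unique xs → a < length xs → b < length xs → nth a xs ≡ nth b xs → a ≡ b
nth-injective zero    zero    xs       u       p q e = refl
nth-injective zero    (suc b) (x ∷ xs) (h ∷ u) p (s≤s q) e = contradiction (subst (_∈ xs) (sym e) (nth-∈ b xs q)) (All-∉ h)
nth-injective (suc a) zero    (x ∷ xs) (h ∷ u) (s≤s p) q e = contradiction (subst (_∈ xs) e (nth-∈ a xs p)) (All-∉ h)
nth-injective (suc a) (suc b) (x ∷ xs) (h ∷ u) (s≤s p) (s≤s q) e = cong suc (nth-injective a b xs u p q e)

∈⇒nth : ∀ {x xs} → x ∈ xs → ∃ λ a → a < length xs × nth a xs ≡ x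
∈⇒nth (here e)  = 0 , s≤s z≤n , sym e
∈⇒nth (there m) with ∈⇒nth m
... | a , p , e = suc a , s≤s p , e

length-0⇒∉ : ∀ {xs} {y : ℕ} → length xs ≡ 0 → y ∉ xs
length-0⇒∉ {[]} _ ()

-- A code lists the choices (e , a , g , b) of the stages i, …, 1: e tells whether the first half of the
-- stage has one more mark before it than after it, g whether the second half has one mark less; a and b
-- are positions in the lists of marks. Here m counts the marks besides the permanent one.

Step : Set
Step = Bool × ℕ × Bool × ℕ

Ok : ℕ → ℕ → List Step → Set
Ok zero    m []      = m ≡ 0
Ok zero    m (_ ∷ _) = ⊥
Ok (suc i) m []      = ⊥
Ok (suc i) m ((e , a , g , b) ∷ c) =
    a < suc (if e then suc m else m)
  × b < (if g then (if e then suc m else m) else suc (if e then suc m else m))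
  × Ok i (if g then (if e then suc m else m) ∸ 1 else (if e then suc m else m)) c

-- This is the statistic shared by both sides: it vanishes at `v` exactly for a fixed point 2v of
-- the pistol, and exactly for a free site `v` of the shape.
aAt : ℕ → List Step → ℕ → ℕ
aAt zero    c                       v = 0
aAt (suc i) []                      v = 0
aAt (suc i) ((e , a , g , b) ∷ c)   v = if v ≡ᵇ suc i then a else aAt i c v

-- Pistols and their codes

module _ (n : ℕ) where

  -- Pistols: values are halved and read from the right, so a list q ∷ p ∷ g of Pre (suc i) stands for
  -- f(2i+2) , f(2i+1) , f(2i) , ….  The marks at stage i are the values strictly between i and n
  -- taken by f(1) , … , f(2i); the value n is permanently marked.

  data Pre : ℕ → List ℕ → Set where
    done : Pre 0 []
    step : ∀ {i g p q} → Pre i g → suc i ≤ p → p ≤ n → suc i ≤ q → q ≤ n → suc i ∈ q ∷ p ∷ g →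
           Pre (suc i) (q ∷ p ∷ g)

  record Marks (i : ℕ) (M : List ℕ) : Set where
    field
      inRange : All (λ y → i < y × y < n) M
      unique  : Unique M

  Match : ℕ → List ℕ → List ℕ → Set
  Match i M g = ∀ y → i < y → y < n → (y ∈ M → y ∈ g) × (y ∈ g → y ∈ M)

  -- Undoes the halved value `q` of f(2i). Position 0 means `q = i`. For any other `q`, surjectivity
  -- forces `i` among the earlier values, so it joins the marks. The bit `e` tells whether `q` is
  -- `n` or repeats an earlier value; a new `q` other than `i` leaves the marks.
  stepA : ℕ → List ℕ → Bool → ℕ → ℕ × List ℕ
  stepA i M true  zero    = i , i ∷ M
  stepA i M true  (suc a) = nth a (n ∷ M) , i ∷ M
  stepA i M false zero    = i , M
  stepA i M false (suc a) = nth a M , i ∷ del a M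

  -- Undoes the halved value of f(2i - 1). It is `n` or repeats a mark when the bit is false;
  -- otherwise it is taken here for the first time and leaves the marks.
  stepB : List ℕ → Bool → ℕ → ℕ × List ℕ
  stepB R false b = nth b (n ∷ R) , R
  stepB R true  b = nth b R , del b R

  decP : ℕ → List ℕ → List Step → List ℕ
  decP i M [] = []
  decP i M ((e , a , g , b) ∷ c) =
    let q , R = stepA i M e a
        p , S = stepB R g b
    in q ∷ p ∷ decP (i ∸ 1) S c

  module _ {i M} (st : Marks i M) where
    open Marks st

    marks-> : ∀ {y} → y ∈ M → i < y
    marks-> m = proj₁ (All.lookup inRange m)

    marks-< : ∀ {y} → y ∈ M → y < n
    marks-< m = proj₂ (All.lookup inRange m)

    unique-n∷ : Unique (n ∷ M)
    unique-n∷ = ∉-All M (λ m → n≮n n (marks-< m)) ∷ unique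

    marks-del : ∀ a → Marks i (del a M)
    marks-del a = record
      { inRange = All.tabulate λ m → All.lookup inRange (∈-del⁻ a M m)
      ; unique  = unique-del a M unique
      }

  marks-∷ : ∀ {i M} → suc i < n → Marks (suc i) M → Marks i (suc i ∷ M)
  marks-∷ {i} {M} i<n st = record
    { inRange = (≤-refl , i<n) ∷ All.map (λ { (p , q) → <⇒≤ p , q }) inRange
    ; unique  = ∉-All M (λ m → n≮n (suc i) (marks-> st m)) ∷ unique
    }
    where open Marks st

  marks-weaken : ∀ {i M} → Marks (suc i) M → Marks i M
  marks-weaken st = record { inRange = All.map (λ { (p , q) → <⇒≤ p , q }) inRange ; unique = unique }
    where open Marks st

  -- `isE` and `isE⁻` express the bit through `q` and the elements of `R`, and `isFix`, `isFix⁻` do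
  -- the same for `a = 0`. Injectivity needs this form, since a pistol determines `R` at first only
  -- as a set.
  record SoundA (i : ℕ) (M : List ℕ) (e : Bool) (a q : ℕ) (R : List ℕ) : Set where
    field
      marks : Marks i R
      size  : length R ≡ (if e then suc (length M) else length M)
      q≥    : suc i ≤ q
      q≤    : q ≤ n
      hit   : suc i ∈ q ∷ R
      match : ∀ y → suc i < y → y < n → (y ∈ M → y ∈ q ∷ R) × (y ∈ q ∷ R → y ∈ M)
      isE   : e ≡ true → suc i ∈ R × (q ≡ suc i ⊎ q ∈ n ∷ R)
      isE⁻  : suc i ∈ R → (q ≡ suc i ⊎ q ∈ n ∷ R) → e ≡ true
      isFix : a ≡ 0 → q ≡ suc i
      isFix⁻ : q ≡ suc i → a ≡ 0

  soundA : ∀ {i M} → suc i < n → Marks (suc i) M → ∀ e a → a < suc (if e then suc (length M) else length M) →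
           SoundA i M e a (proj₁ (stepA (suc i) M e a)) (proj₂ (stepA (suc i) M e a))
  soundA {i} {M} i<n st true zero p = record
    { marks = marks-∷ i<n st ; size = refl ; q≥ = ≤-refl ; q≤ = <⇒≤ i<n ; hit = here refl
    ; match = λ y lt _ → (λ m → there (there m)) ,
        λ { (here e) → contradiction (sym e) (<⇒≢ lt) ; (there (here e)) → contradiction (sym e) (<⇒≢ lt) ; (there (there m)) → m }
    ; isE = λ _ → here refl , inj₁ refl ; isE⁻ = λ _ _ → refl ; isFix = λ _ → refl ; isFix⁻ = λ _ → refl }
  soundA {i} {M} i<n st true (suc a) (s≤s p) = record
    { marks = marks-∷ i<n st ; size = refl ; q≥ = <⇒≤ q> ; q≤ = q≤n ; hit = there (here refl)
    ; match = λ y lt y<n → (λ m → there (there m)) ,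
        λ { (here e) → drop-n y<n (subst (_∈ n ∷ M) (sym e) q∈) ; (there (here e)) → contradiction (sym e) (<⇒≢ lt) ; (there (there m)) → m }
    ; isE = λ _ → here refl , inj₂ (widen q∈)
    ; isE⁻ = λ _ _ → refl ; isFix = λ () ; isFix⁻ = λ e → contradiction (sym e) (<⇒≢ q>) }
    where
    q = nth a (n ∷ M)
    q∈ : q ∈ n ∷ M
    q∈ = nth-∈ a (n ∷ M) p
    bounds : ∀ {y} → y ∈ n ∷ M → suc i < y × y ≤ n
    bounds (here e)  = subst (λ z → suc i < z × z ≤ n) (sym e) (i<n , ≤-refl)
    bounds (there m) = marks-> st m , <⇒≤ (marks-< st m)
    q> = proj₁ (bounds q∈)
    q≤n = proj₂ (bounds q∈)
    drop-n : ∀ {y} → y < n → y ∈ n ∷ M → y ∈ M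
    drop-n lt (here e)  = contradiction e (<⇒≢ lt)
    drop-n lt (there m) = m
    widen : ∀ {y} → y ∈ n ∷ M → y ∈ n ∷ suc i ∷ M
    widen (here e)  = here e
    widen (there m) = there (there m)
  soundA {i} {M} i<n st false zero p = record
    { marks = marks-weaken st ; size = refl ; q≥ = ≤-refl ; q≤ = <⇒≤ i<n ; hit = here refl
    ; match = λ y lt _ → there , λ { (here e) → contradiction (sym e) (<⇒≢ lt) ; (there m) → m }
    ; isE = λ () ; isE⁻ = λ m _ → contradiction (marks-> st m) (n≮n (suc i)) ; isFix = λ _ → refl ; isFix⁻ = λ _ → refl }
  soundA {i} {M} i<n st false (suc a) (s≤s p) = record
    { marks = marks-∷ i<n (marks-del st a) ; size = length-del a M p ; q≥ = <⇒≤ (marks-> st q∈) ; q≤ = <⇒≤ (marks-< st q∈)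
    ; hit = there (here refl)
    ; match = λ y lt _ → to y ,
        λ { (here e) → subst (_∈ M) (sym e) q∈ ; (there (here e)) → contradiction (sym e) (<⇒≢ lt) ; (there (there m)) → ∈-del⁻ a M m }
    ; isE = λ ()
    ; isE⁻ = λ { _ (inj₁ e) → contradiction (sym e) (<⇒≢ (marks-> st q∈))
               ; _ (inj₂ (here e)) → contradiction e (<⇒≢ (marks-< st q∈))
               ; _ (inj₂ (there (here e))) → contradiction (sym e) (<⇒≢ (marks-> st q∈))
               ; _ (inj₂ (there (there m))) → contradiction m (nth∉del a M (Marks.unique st) p) }
    ; isFix = λ () ; isFix⁻ = λ e → contradiction (sym e) (<⇒≢ (marks-> st q∈)) }
    where
    q∈ : nth a M ∈ M
    q∈ = nth-∈ a M p
    to : ∀ y → y ∈ M → y ∈ nth a M ∷ suc i ∷ del a M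
    to y m with y ≟ nth a M
    ... | yes e = here e
    ... | no ¬e = there (there (∈-del a M ¬e m))

  record SoundB (i : ℕ) (R : List ℕ) (g : Bool) (p : ℕ) (S : List ℕ) : Set where
    field
      marks : Marks i S
      size  : length S ≡ (if g then length R ∸ 1 else length R)
      p≥    : suc i ≤ p
      p≤    : p ≤ n
      match : ∀ y → i < y → y < n → (y ∈ R → y ∈ p ∷ S) × (y ∈ p ∷ S → y ∈ R)
      isG   : g ≡ false → p ∈ n ∷ S
      isG⁻  : p ∈ n ∷ S → g ≡ false

  soundB : ∀ {i R} → suc i < n → Marks i R → ∀ g b → b < (if g then length R else suc (length R)) →
           SoundB i R g (proj₁ (stepB R g b)) (proj₂ (stepB R g b))
  soundB {i} {R} i<n st false b q = record
    { marks = st ; size = refl ; p≥ = proj₁ (bounds p∈) ; p≤ = proj₂ (bounds p∈)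
    ; match = λ y _ y<n → there , λ { (here e) → drop-n y<n (subst (_∈ n ∷ R) (sym e) p∈) ; (there m) → m }
    ; isG = λ _ → p∈ ; isG⁻ = λ _ → refl }
    where
    p∈ = nth-∈ b (n ∷ R) q
    bounds : ∀ {y} → y ∈ n ∷ R → suc i ≤ y × y ≤ n
    bounds (here e)  = subst (λ z → suc i ≤ z × z ≤ n) (sym e) (<⇒≤ i<n , ≤-refl)
    bounds (there m) = marks-> st m , <⇒≤ (marks-< st m)
    drop-n : ∀ {y} → y < n → y ∈ n ∷ R → y ∈ R
    drop-n lt (here e)  = contradiction e (<⇒≢ lt)
    drop-n lt (there m) = m
  soundB {i} {R} i<n st true b q = record
    { marks = marks-del st b ; size = cong (_∸ 1) (length-del b R q) ; p≥ = marks-> st p∈ ; p≤ = <⇒≤ (marks-< st p∈)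
    ; match = λ y _ _ → to y , λ { (here e) → subst (_∈ R) (sym e) p∈ ; (there m) → ∈-del⁻ b R m }
    ; isG = λ () ; isG⁻ = λ { (here e) → contradiction e (<⇒≢ (marks-< st p∈))
                             ; (there m) → contradiction m (nth∉del b R (Marks.unique st) q) } }
    where
    p∈ = nth-∈ b R q
    to : ∀ y → y ∈ R → y ∈ nth b R ∷ del b R
    to y m with y ≟ nth b R
    ... | yes e = here e
    ... | no ¬e = there (∈-del b R ¬e m)

  ∈-∷-map : ∀ {x y : ℕ} {xs ys} → (y ∈ xs → y ∈ ys) → y ∈ x ∷ xs → y ∈ x ∷ ys
  ∈-∷-map f (here e)  = here e
  ∈-∷-map f (there m) = there (f m)

  record SoundStep (i : ℕ) (M : List ℕ) (s : Step) (c : List Step) : Set where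
    private
      e = proj₁ s ; a = proj₁ (proj₂ s) ; g = proj₁ (proj₂ (proj₂ s)) ; b = proj₂ (proj₂ (proj₂ s))
      q = proj₁ (stepA (suc i) M e a) ; R = proj₂ (stepA (suc i) M e a)
      p = proj₁ (stepB R g b) ; S = proj₂ (stepB R g b)
    field
      A      : SoundA i M e a q R
      B      : SoundB i R g p S
      pre    : Pre i (decP i S c)
      matchR : Match i R (p ∷ decP i S c)
      matchS : Match i S (decP i S c)
      okTail : Ok i (length S) c

  soundP : ∀ i {M} c → i < n → Marks i M → Ok i (length M) c → Pre i (decP i M c) × Match i M (decP i M c)
  soundStep : ∀ i {M} s c → suc i < n → Marks (suc i) M → Ok (suc i) (length M) (s ∷ c) → SoundStep i M s c

  soundStep i {M} (e , a , g , b) c i<n st (a< , b< , ok) = record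
    { A = A ; B = B ; pre = proj₁ rec ; matchS = proj₂ rec ; okTail = ok'
    ; matchR = λ y p q → (λ m → ∈-∷-map (proj₁ (proj₂ rec y p q)) (proj₁ (SB.match y p q) m))
                       , (λ m → proj₂ (SB.match y p q) (∈-∷-map (proj₂ (proj₂ rec y p q)) m)) }
    where
    A = soundA i<n st e a a<
    module SA = SoundA A
    B = soundB i<n SA.marks g b (subst (λ z → b < (if g then z else suc z)) (sym SA.size) b<)
    module SB = SoundB B
    ok' : Ok i (length (proj₂ (stepB (proj₂ (stepA (suc i) M e a)) g b))) c
    ok' = subst (λ z → Ok i z c) (sym (trans SB.size (cong (λ z → if g then z ∸ 1 else z) SA.size))) ok
    rec = soundP i c (<⇒≤ i<n) SB.marks ok'

  soundP zero [] _ st ok = done , λ y p q → (λ m → contradiction m (length-0⇒∉ ok)) , λ ()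
  soundP (suc i) (s ∷ c) i<n st ok =
      step SS.pre SB.p≥ SB.p≤ SA.q≥ SA.q≤ (∈-∷-map (proj₁ (SS.matchR (suc i) ≤-refl i<n)) SA.hit)
    , λ y p q → (λ m → ∈-∷-map (proj₁ (SS.matchR y (<⇒≤ p) q)) (proj₁ (SA.match y p q) m))
              , (λ m → proj₂ (SA.match y p q) (∈-∷-map (proj₂ (SS.matchR y (<⇒≤ p) q)) m))
    where
    module SS = SoundStep (soundStep i s c i<n st ok)
    module SA = SoundA SS.A
    module SB = SoundB SS.B

  decP-injective : ∀ i {M} c c' → i < n → Marks i M → Ok i (length M) c → Ok i (length M) c' →
                   decP i M c ≡ decP i M c' → c ≡ c'
  decP-injective zero [] [] _ _ _ _ _ = refl
  decP-injective (suc i) {M} (s@(e , a , g , b) ∷ c) (s'@(e' , a' , g' , b') ∷ c') i<n st ok ok' eq =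
      finish e≡e'
    where
    S  = soundStep i s c i<n st ok
    S' = soundStep i s' c' i<n st ok'
    module SS  = SoundStep S
    module SS' = SoundStep S'
    module SA  = SoundA SS.A
    module SA' = SoundA SS'.A
    module SB  = SoundB SS.B
    module SB' = SoundB SS'.B
    R  = proj₂ (stepA (suc i) M e a)
    R' = proj₂ (stepA (suc i) M e' a')
    q≡ = ∷-injectiveˡ eq
    p≡ = ∷-injectiveˡ (∷-injectiveʳ eq)
    g≡ = ∷-injectiveʳ (∷-injectiveʳ eq)
    -- Both lists hold the marks of the same tail `p ∷ …`, so they have the same elements, though
    -- possibly in different orders.
    R⇒R' : ∀ {y} → y ∈ R → y ∈ R'
    R⇒R' {y} m = proj₂ (SS'.matchR y y> y<) (subst₂ (λ x xs → y ∈ x ∷ xs) p≡ g≡ (proj₁ (SS.matchR y y> y<) m))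
      where y> = marks-> SA.marks m ; y< = marks-< SA.marks m
    R'⇒R : ∀ {y} → y ∈ R' → y ∈ R
    R'⇒R {y} m = proj₂ (SS.matchR y y> y<) (subst₂ (λ x xs → y ∈ x ∷ xs) (sym p≡) (sym g≡) (proj₁ (SS'.matchR y y> y<) m))
      where y> = marks-> SA'.marks m ; y< = marks-< SA'.marks m
    e≡e' : e ≡ e'
    e≡e' = bool-ext
      (λ t → let (m , d) = SA.isE t in SA'.isE⁻ (R⇒R' m) (conv q≡ R⇒R' d))
      (λ t → let (m , d) = SA'.isE t in SA.isE⁻ (R'⇒R m) (conv (sym q≡) R'⇒R d))
      where
      conv : ∀ {q q' R R'} → q ≡ q' → (∀ {y : ℕ} → y ∈ R → y ∈ R') → q ≡ suc i ⊎ q ∈ n ∷ R → q' ≡ suc i ⊎ q' ∈ n ∷ R'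
      conv refl f (inj₁ x) = inj₁ x
      conv refl f (inj₂ x) = inj₂ (∈-∷-map f x)
    a-eq : ∀ e a a' → a < suc (if e then suc (length M) else length M) → a' < suc (if e then suc (length M) else length M) →
           proj₁ (stepA (suc i) M e a) ≡ proj₁ (stepA (suc i) M e a') →
           (a ≡ 0 → a' ≡ 0) → (a' ≡ 0 → a ≡ 0) → a ≡ a'
    a-eq e     zero    a'       _       _       _ f f' = sym (f refl)
    a-eq e     (suc a) zero     _       _       _ f f' = f' refl
    a-eq true  (suc a) (suc a') (s≤s p) (s≤s q) h _ _ = cong suc (nth-injective a a' (n ∷ M) (unique-n∷ st) p q h)
    a-eq false (suc a) (suc a') (s≤s p) (s≤s q) h _ _ = cong suc (nth-injective a a' M (Marks.unique st) p q h)
    b-eq : ∀ R → Marks i R → ∀ g b b' → b < (if g then length R else suc (length R)) → b' < (if g then length R else suc (length R)) →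
           proj₁ (stepB R g b) ≡ proj₁ (stepB R g b') → b ≡ b'
    b-eq R st false b b' p q h = nth-injective b b' (n ∷ R) (unique-n∷ st) p q h
    b-eq R st true  b b' p q h = nth-injective b b' R (Marks.unique st) p q h
    g≡g' : g ≡ g'
    g≡g' = bool-ext-false (λ t → SB'.isG⁻ (moveS (SB.isG t))) (λ t → SB.isG⁻ (moveS' (SB'.isG t)))
      where
      Sl = proj₂ (stepB R g b)
      Sl' = proj₂ (stepB R' g' b')
      moveS : proj₁ (stepB R g b) ∈ n ∷ Sl → proj₁ (stepB R' g' b') ∈ n ∷ Sl'
      moveS (here x)  = here (trans (sym p≡) x)
      moveS (there m) = there (subst (_∈ Sl') p≡ (proj₂ (SS'.matchS _ y> y<) (subst (proj₁ (stepB R g b) ∈_) g≡ (proj₁ (SS.matchS _ y> y<) m))))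
        where y> = marks-> SB.marks m ; y< = marks-< SB.marks m
      moveS' : proj₁ (stepB R' g' b') ∈ n ∷ Sl' → proj₁ (stepB R g b) ∈ n ∷ Sl
      moveS' (here x)  = here (trans p≡ x)
      moveS' (there m) = there (subst (_∈ Sl) (sym p≡) (proj₂ (SS.matchS _ y> y<) (subst (proj₁ (stepB R' g' b') ∈_) (sym g≡) (proj₁ (SS'.matchS _ y> y<) m))))
        where y> = marks-> SB'.marks m ; y< = marks-< SB'.marks m
    finish : e ≡ e' → (e , a , g , b) ∷ c ≡ (e' , a' , g' , b') ∷ c'
    finish refl with a-eq e a a' (proj₁ ok) (proj₁ ok') q≡
                       (λ z → SA'.isFix⁻ (trans (sym q≡) (SA.isFix z))) (λ z → SA.isFix⁻ (trans q≡ (SA'.isFix z)))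
    ... | refl with g≡g'
    -- With the bits `e` and the positions `a` identified, `R` and `R'` are the same list, and equal
    -- values now sit at equal positions.
    ... | refl with b-eq R SA.marks g b b' (subst (λ z → b < (if g then z else suc z)) (sym SA.size) (proj₁ (proj₂ ok)))
                       (subst (λ z → b' < (if g then z else suc z)) (sym SA.size) (proj₁ (proj₂ ok'))) p≡
    ... | refl = cong ((e , a , g , b) ∷_) (decP-injective i c c' (<⇒≤ i<n) SB.marks SS.okTail SS'.okTail g≡)

  -- A value that equals `n` or is already present contributes no further mark.
  absorb : ∀ {y q h} → y < n → q ∈ n ∷ h → y ∈ q ∷ h → y ∈ h
  absorb lt _           (there m)   = m
  absorb lt (there m)   (here refl) = m
  absorb lt (here refl) (here refl) = contradiction lt (n≮n n)

  -- Three questions recover the choice of `stepA`: whether `q = suc i`, whether `suc i` occurs in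
  -- `h`, and, if `q` differs from `suc i`, whether `q` is in `n ∷ h`. The premise that `suc i` is
  -- hit excludes one combination.
  findA : ∀ {i M q h} → suc i < n → Marks (suc i) M → suc i ≤ q → q ≤ n → suc i ∈ q ∷ h → Match (suc i) M (q ∷ h) →
    ∃ λ e → ∃ λ a → a < suc (if e then suc (length M) else length M) × proj₁ (stepA (suc i) M e a) ≡ q
      × Match i (proj₂ (stepA (suc i) M e a)) h
  findA {i} {M} {q} {h} i<n st q≥ q≤ hit mt with q ≟ suc i | suc i ∈? h
  ... | yes refl | no I∉h = false , 0 , s≤s z≤n , refl , λ y p p' → to y p p' , from y p p'
    where
    to : ∀ y → i < y → y < n → y ∈ M → y ∈ h
    to y p p' m with proj₁ (mt y (marks-> st m) p') m
    ... | here e   = contradiction (sym e) (<⇒≢ (marks-> st m))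
    ... | there m' = m'
    from : ∀ y → i < y → y < n → y ∈ h → y ∈ M
    from y p p' m with y ≟ suc i
    ... | yes refl = contradiction m I∉h
    ... | no  y≢   = proj₂ (mt y (≤∧≢⇒< p (y≢ ∘ sym)) p') (there m)
  ... | yes refl | yes I∈h = true , 0 , s≤s z≤n , refl , λ y p p' → to y p p' , from y p p'
    where
    to : ∀ y → i < y → y < n → y ∈ suc i ∷ M → y ∈ h
    to y p p' (here refl) = I∈h
    to y p p' (there m) with proj₁ (mt y (marks-> st m) p') m
    ... | here e   = contradiction (sym e) (<⇒≢ (marks-> st m))
    ... | there m' = m'
    from : ∀ y → i < y → y < n → y ∈ h → y ∈ suc i ∷ M
    from y p p' m with y ≟ suc i
    ... | yes refl = here refl
    ... | no  y≢   = there (proj₂ (mt y (≤∧≢⇒< p (y≢ ∘ sym)) p') (there m))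
  ... | no q≢ | no I∉h = contradiction (strip hit) I∉h
    where
    strip : suc i ∈ q ∷ h → suc i ∈ h
    strip (here e)  = contradiction (sym e) q≢
    strip (there m) = m
  ... | no q≢ | yes I∈h with q ∈? n ∷ h
  ...   | yes q∈ = true , suc a , s≤s a< , a≡ , λ y p p' → to y p p' , from y p p'
    where
    I<q = ≤∧≢⇒< q≥ (q≢ ∘ sym)
    q∈nM : q ∈ n ∷ M
    q∈nM with q ≟ n
    ... | yes e = here e
    ... | no ne = there (proj₂ (mt q I<q (≤∧≢⇒< q≤ ne)) (here refl))
    a = proj₁ (∈⇒nth q∈nM)
    a< = proj₁ (proj₂ (∈⇒nth q∈nM))
    a≡ = proj₂ (proj₂ (∈⇒nth q∈nM))
    to : ∀ y → i < y → y < n → y ∈ suc i ∷ M → y ∈ h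
    to y p p' (here refl) = I∈h
    to y p p' (there m) = absorb p' q∈ (proj₁ (mt y (marks-> st m) p') m)
    from : ∀ y → i < y → y < n → y ∈ h → y ∈ suc i ∷ M
    from y p p' m with y ≟ suc i
    ... | yes refl = here refl
    ... | no  y≢   = there (proj₂ (mt y (≤∧≢⇒< p (y≢ ∘ sym)) p') (there m))
  ...   | no q∉ = false , suc a , s≤s a< , a≡ , λ y p p' → to y p p' , from y p p'
    where
    q∈M : q ∈ M
    q∈M = proj₂ (mt q (≤∧≢⇒< q≥ (q≢ ∘ sym)) (≤∧≢⇒< q≤ (q∉ ∘ here))) (here refl)
    a = proj₁ (∈⇒nth q∈M)
    a< = proj₁ (proj₂ (∈⇒nth q∈M))
    a≡ = proj₂ (proj₂ (∈⇒nth q∈M))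
    to : ∀ y → i < y → y < n → y ∈ suc i ∷ del a M → y ∈ h
    to y p p' (here refl) = I∈h
    to y p p' (there m) with proj₁ (mt y (marks-> st (∈-del⁻ a M m)) p') (∈-del⁻ a M m)
    ... | there m'  = m'
    ... | here refl = contradiction (subst (_∈ del a M) (sym a≡) m) (nth∉del a M (Marks.unique st) a<)
    from : ∀ y → i < y → y < n → y ∈ h → y ∈ suc i ∷ del a M
    from y p p' m with y ≟ suc i
    ... | yes refl = here refl
    ... | no  y≢   = there (∈-del a M (λ e → q∉ (there (subst (_∈ h) (trans e a≡) m)))
                       (proj₂ (mt y (≤∧≢⇒< p (y≢ ∘ sym)) p') (there m)))

  findB : ∀ {i R p h} → Marks i R → suc i ≤ p → p ≤ n → Match i R (p ∷ h) →
    ∃ λ g → ∃ λ b → b < (if g then length R else suc (length R)) × proj₁ (stepB R g b) ≡ p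
      × Match i (proj₂ (stepB R g b)) h
  findB {i} {R} {p} {h} st p≥ p≤ mt with p ∈? n ∷ h
  ... | yes p∈ = false , b , b< , b≡ , λ y q q' → to y q q' , λ m → proj₂ (mt y q q') (there m)
    where
    p∈nR : p ∈ n ∷ R
    p∈nR with p ≟ n
    ... | yes e = here e
    ... | no ne = there (proj₂ (mt p p≥ (≤∧≢⇒< p≤ ne)) (here refl))
    b = proj₁ (∈⇒nth p∈nR)
    b< = proj₁ (proj₂ (∈⇒nth p∈nR))
    b≡ = proj₂ (proj₂ (∈⇒nth p∈nR))
    to : ∀ y → i < y → y < n → y ∈ R → y ∈ h
    to y q q' m = absorb q' p∈ (proj₁ (mt y q q') m)
  ... | no p∉ = true , b , b< , b≡ , λ y q q' → to y q q' ,
        λ m → ∈-del b R (λ e → p∉ (there (subst (_∈ h) (trans e b≡) m))) (proj₂ (mt y q q') (there m))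
    where
    p∈R : p ∈ R
    p∈R = proj₂ (mt p p≥ (≤∧≢⇒< p≤ (p∉ ∘ here))) (here refl)
    b = proj₁ (∈⇒nth p∈R)
    b< = proj₁ (proj₂ (∈⇒nth p∈R))
    b≡ = proj₂ (proj₂ (∈⇒nth p∈R))
    to : ∀ y → i < y → y < n → y ∈ del b R → y ∈ h
    to y q q' m with proj₁ (mt y q q') (∈-del⁻ b R m)
    ... | there m'  = m'
    ... | here refl = contradiction (subst (_∈ del b R) (sym b≡) m) (nth∉del b R (Marks.unique st) b<)

  completeP : ∀ {i g} M → i < n → Pre i g → Marks i M → Match i M g → ∃ λ c → Ok i (length M) c × decP i M c ≡ g
  completeP []      i<n done st mt = [] , refl , refl
  completeP (x ∷ M) i<n done st mt = contradiction (proj₁ (mt x (marks-> st (here refl)) (marks-< st (here refl))) (here refl)) λ ()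
  completeP {suc i} M i<n (step {g = h} {p} {q} pre p≥ p≤ q≥ q≤ hit) st mt with findA i<n st q≥ q≤ hit mt
  ... | e , a , a< , q≡ , mtR with soundA i<n st e a a<
  ... | A with findB (SoundA.marks A) p≥ p≤ mtR
  ... | g , b , b< , p≡ , mtS with soundB i<n (SoundA.marks A) g b b<
  ... | B with completeP _ (<⇒≤ i<n) pre (SoundB.marks B) mtS
  ... | c , ok , c≡ = (e , a , g , b) ∷ c
      , (a< , subst (λ z → b < (if g then z else suc z)) (SoundA.size A) b<
            , subst (λ z → Ok i z c) (trans (SoundB.size B) (cong (λ z → if g then z ∸ 1 else z) (SoundA.size A))) ok)
      , cong₂ _∷_ q≡ (cong₂ _∷_ p≡ c≡)

  -- From halved, reversed lists to pistols

  unfoldP : List ℕ → List ℕ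
  unfoldP (q ∷ p ∷ g) = unfoldP g ++ 2 * p ∷ 2 * q ∷ []
  unfoldP _           = []

  at-++ˡ : ∀ xs ys j → j ≤ length xs → at (xs ++ ys) j ≡ at xs j
  at-++ˡ []       ys zero          p       = at-0 ys
  at-++ˡ (x ∷ xs) ys zero          p       = refl
  at-++ˡ (x ∷ xs) ys (suc zero)    p       = refl
  at-++ˡ (x ∷ xs) ys (suc (suc j)) (s≤s p) = at-++ˡ xs ys (suc j) p

  at-++ʳ : ∀ xs ys j → at (xs ++ ys) (length xs + suc j) ≡ at ys (suc j)
  at-++ʳ []       ys j = refl
  at-++ʳ (x ∷ xs) ys j rewrite +-suc (length xs) j =
    trans (cong (at (xs ++ ys)) (sym (+-suc (length xs) j))) (at-++ʳ xs ys j)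

  length-unfoldP : ∀ {i g} → Pre i g → length (unfoldP g) ≡ 2 * i
  length-unfoldP done = refl
  length-unfoldP {suc i} (step {g = g} pre _ _ _ _ _) =
    trans (length-++ (unfoldP g)) (trans (cong (_+ 2) (length-unfoldP pre)) (trans (+-comm (2 * i) 2) (sym (*-suc 2 i))))

  module _ {i : ℕ} {g : List ℕ} {p q : ℕ} (len : length (unfoldP g) ≡ 2 * i) where

    at-old : ∀ j → j ≤ 2 * i → at (unfoldP (q ∷ p ∷ g)) j ≡ at (unfoldP g) j
    at-old j h = at-++ˡ (unfoldP g) _ j (subst (j ≤_) (sym len) h)

    at-p : at (unfoldP (q ∷ p ∷ g)) (suc (2 * i)) ≡ 2 * p
    at-p = trans (cong (at (unfoldP (q ∷ p ∷ g))) (trans (+-comm 1 (2 * i)) (cong (_+ 1) (sym len)))) (at-++ʳ (unfoldP g) _ 0)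

    at-q : at (unfoldP (q ∷ p ∷ g)) (suc (suc (2 * i))) ≡ 2 * q
    at-q = trans (cong (at (unfoldP (q ∷ p ∷ g))) (trans (+-comm 2 (2 * i)) (cong (_+ 2) (sym len)))) (at-++ʳ (unfoldP g) _ 1)

  data Last2 (m : ℕ) : ℕ → Set where
    old : ∀ {j} → j ≤ m → Last2 m j
    fst : Last2 m (suc m)
    snd : Last2 m (suc (suc m))

  last2 : ∀ {m j} → j ≤ suc (suc m) → Last2 m j
  last2 {m} {j} p with m≤n⇒m<n∨m≡n p
  ... | inj₂ refl = snd
  ... | inj₁ (s≤s q) with m≤n⇒m<n∨m≡n q
  ...   | inj₂ refl    = fst
  ...   | inj₁ (s≤s r) = old r

  ≤2*suc : ∀ i {j} → j ≤ 2 * suc i → j ≤ suc (suc (2 * i))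
  ≤2*suc i p = ≤-trans p (≤-reflexive (*-suc 2 i))

  unfoldP-bounds : ∀ {i g} → Pre i g → ∀ j → 1 ≤ j → j ≤ 2 * i →
    (2 ∣ at (unfoldP g) j) × (j ≤ at (unfoldP g) j) × (at (unfoldP g) j ≤ 2 * n)
  unfoldP-bounds done j p q = contradiction (≤-trans p q) λ ()
  unfoldP-bounds {suc i} (step {g = g} {p = p} {q = q} pre p≥ p≤ q≥ q≤ _) j 1≤j j≤ with last2 (≤2*suc i j≤)
  ... | old h = subst (λ z → (2 ∣ z) × (j ≤ z) × (z ≤ 2 * n)) (sym (at-old {i} {g} {p} {q} (length-unfoldP pre) j h)) (unfoldP-bounds pre j 1≤j h)
  ... | fst = subst (λ z → (2 ∣ z) × (j ≤ z) × (z ≤ 2 * n)) (sym (at-p {i} {g} {p} {q} (length-unfoldP pre)))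
        (divides p (*-comm 2 p) , ≤-trans (n≤1+n _) (≤-trans (≤-reflexive (sym (*-suc 2 i))) (*-monoʳ-≤ 2 p≥)) , *-monoʳ-≤ 2 p≤)
  ... | snd = subst (λ z → (2 ∣ z) × (j ≤ z) × (z ≤ 2 * n)) (sym (at-q {i} {g} {p} {q} (length-unfoldP pre)))
        (divides q (*-comm 2 q) , ≤-trans (≤-reflexive (sym (*-suc 2 i))) (*-monoʳ-≤ 2 q≥) , *-monoʳ-≤ 2 q≤)

  ∈⇒unfoldP : ∀ {i g y} → Pre i g → y ∈ g → ∃ λ j → (1 ≤ j) × (j ≤ 2 * i) × (at (unfoldP g) j ≡ 2 * y)
  ∈⇒unfoldP {suc i} (step {g = g} {p = p} {q = q} pre _ _ _ _ _) (here refl) =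
    suc (suc (2 * i)) , s≤s z≤n , ≤-reflexive (sym (*-suc 2 i)) , at-q {i} {g} {p} {q} (length-unfoldP pre)
  ∈⇒unfoldP {suc i} (step {g = g} {p = p} {q = q} pre _ _ _ _ _) (there (here refl)) =
    suc (2 * i) , s≤s z≤n , ≤-trans (n≤1+n _) (≤-reflexive (sym (*-suc 2 i))) , at-p {i} {g} {p} {q} (length-unfoldP pre)
  ∈⇒unfoldP {suc i} (step {g = g} {p = p} {q = q} pre _ _ _ _ _) (there (there m)) with ∈⇒unfoldP pre m
  ... | j , 1≤j , j≤ , e = j , 1≤j , ≤-trans j≤ (*-monoʳ-≤ 2 (n≤1+n i)) , trans (at-old {i} {g} {p} {q} (length-unfoldP pre) j j≤) e

  unfoldP⇒∈ : ∀ {i g y} → Pre i g → ∀ j → 1 ≤ j → j ≤ 2 * i → at (unfoldP g) j ≡ 2 * y → y ∈ g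
  unfoldP⇒∈ done j p q e = contradiction (≤-trans p q) λ ()
  unfoldP⇒∈ {suc i} {y = y} (step {g = g} {p = p} {q = q} pre _ _ _ _ _) j 1≤j j≤ e with last2 (≤2*suc i j≤)
  ... | old h = there (there (unfoldP⇒∈ pre j 1≤j h (trans (sym (at-old {i} {g} {p} {q} (length-unfoldP pre) j h)) e)))
  ... | fst = there (here (*-cancelˡ-≡ y p 2 (trans (sym e) (at-p {i} {g} {p} {q} (length-unfoldP pre)))))
  ... | snd = here (*-cancelˡ-≡ y q 2 (trans (sym e) (at-q {i} {g} {p} {q} (length-unfoldP pre))))

  pre-hit : ∀ {i g} → Pre i g → ∀ v → 1 ≤ v → v ≤ i → v ∈ g
  pre-hit done v p q = contradiction (≤-trans p q) λ ()
  pre-hit (step pre _ _ _ _ hit) v p q with m≤n⇒m<n∨m≡n q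
  ... | inj₂ refl    = hit
  ... | inj₁ (s≤s r) = there (there (pre-hit pre v p r))

  pre⇒SP : ∀ {g} → Pre n g → IsSP n (unfoldP g)
  pre⇒SP pre = length-unfoldP pre , unfoldP-bounds pre , λ v p q → ∈⇒unfoldP pre (pre-hit pre v p q)

  split-last2 : ∀ m (f : List ℕ) → length f ≡ suc (suc m) → ∃ λ f₀ → ∃ λ x → ∃ λ y → f ≡ f₀ ++ x ∷ y ∷ [] × length f₀ ≡ m
  split-last2 zero    (x ∷ y ∷ [])  e = [] , x , y , refl , refl
  split-last2 (suc m) (z ∷ f) e with split-last2 m f (suc-injective e)
  ... | f₀ , x , y , refl , l = z ∷ f₀ , x , y , refl , cong suc l

  -- Since f(j) ≥ j, the value 2v is taken only at positions up to 2v. So the first `i` values are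
  -- already hit within the first 2i positions, and surjectivity can be checked stage by stage.
  SP⇒pre : ∀ i f → length f ≡ 2 * i →
    (∀ j → 1 ≤ j → j ≤ 2 * i → (2 ∣ at f j) × (j ≤ at f j) × (at f j ≤ 2 * n)) →
    (∀ v → 1 ≤ v → v ≤ i → ∃ λ j → (1 ≤ j) × (j ≤ 2 * i) × (at f j ≡ 2 * v)) →
    ∃ λ g → Pre i g × unfoldP g ≡ f
  SP⇒pre zero [] len bd sj = [] , done , refl
  SP⇒pre (suc i) f len bd sj with split-last2 (2 * i) f (trans len (*-suc 2 i))
  ... | f₀ , x , y , refl , len₀ with bd (suc (2 * i)) (s≤s z≤n) (≤-trans (n≤1+n _) (≤-reflexive (sym (*-suc 2 i))))
                                    | bd (suc (suc (2 * i))) (s≤s z≤n) (≤-reflexive (sym (*-suc 2 i)))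
  ... | d₁ , lo₁ , hi₁ | d₂ , lo₂ , hi₂ = q ∷ p ∷ g , pre , f≡
    where
    at-x : at (f₀ ++ x ∷ y ∷ []) (suc (2 * i)) ≡ x
    at-x = trans (cong (at (f₀ ++ x ∷ y ∷ [])) (trans (+-comm 1 (2 * i)) (cong (_+ 1) (sym len₀)))) (at-++ʳ f₀ _ 0)
    at-y : at (f₀ ++ x ∷ y ∷ []) (suc (suc (2 * i))) ≡ y
    at-y = trans (cong (at (f₀ ++ x ∷ y ∷ [])) (trans (+-comm 2 (2 * i)) (cong (_+ 2) (sym len₀)))) (at-++ʳ f₀ _ 1)
    old≡ : ∀ j → j ≤ 2 * i → at (f₀ ++ x ∷ y ∷ []) j ≡ at f₀ j
    old≡ j h = at-++ˡ f₀ _ j (subst (j ≤_) (sym len₀) h)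
    rec = SP⇒pre i f₀ len₀
      (λ j 1≤j j≤ → subst (λ z → (2 ∣ z) × (j ≤ z) × (z ≤ 2 * n)) (old≡ j j≤) (bd j 1≤j (≤-trans j≤ (*-monoʳ-≤ 2 (n≤1+n i)))))
      λ v 1≤v v≤ → let (j , 1≤j , j≤ , e) = sj v 1≤v (m≤n⇒m≤1+n v≤)
                       j≤' = ≤-trans (proj₁ (proj₂ (bd j 1≤j j≤))) (≤-trans (≤-reflexive e) (*-monoʳ-≤ 2 v≤))
                   in j , 1≤j , j≤' , trans (sym (old≡ j j≤')) e
    g = proj₁ rec
    p = _∣_.quotient d₁
    q = _∣_.quotient d₂
    x≡ : x ≡ 2 * p
    x≡ = trans (sym at-x) (trans (_∣_.equality d₁) (*-comm p 2))
    y≡ : y ≡ 2 * q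
    y≡ = trans (sym at-y) (trans (_∣_.equality d₂) (*-comm q 2))
    f≡ : unfoldP (q ∷ p ∷ g) ≡ f₀ ++ x ∷ y ∷ []
    f≡ = cong₂ _++_ (proj₂ (proj₂ rec)) (cong₂ (λ a b → a ∷ b ∷ []) (sym x≡) (sym y≡))
    hit : suc i ∈ q ∷ p ∷ g
    hit with sj (suc i) (s≤s z≤n) ≤-refl
    ... | j , 1≤j , j≤ , e with last2 (≤2*suc i j≤)
    ...   | old h = there (there (unfoldP⇒∈ (proj₁ (proj₂ rec)) j 1≤j h
                      (trans (cong (λ z → at z j) (proj₂ (proj₂ rec))) (trans (sym (old≡ j h)) e))))
    ...   | fst = there (here (*-cancelˡ-≡ (suc i) p 2 (trans (sym e) (trans at-x x≡))))
    ...   | snd = here (*-cancelˡ-≡ (suc i) q 2 (trans (sym e) (trans at-y y≡)))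
    pre : Pre (suc i) (q ∷ p ∷ g)
    pre = step (proj₁ (proj₂ rec))
      (*-cancelˡ-< 2 i p (≤-trans lo₁ (≤-reflexive (trans at-x x≡))))
      (*-cancelˡ-≤ 2 (≤-trans (≤-reflexive (sym (trans at-x x≡))) hi₁))
      (*-cancelˡ-≤ 2 (≤-trans (≤-reflexive (*-suc 2 i)) (≤-trans lo₂ (≤-reflexive (trans at-y y≡)))))
      (*-cancelˡ-≤ 2 (≤-trans (≤-reflexive (sym (trans at-y y≡))) hi₂))
      hit

  unfoldP-injective : ∀ {i g g'} → Pre i g → Pre i g' → unfoldP g ≡ unfoldP g' → g ≡ g'
  unfoldP-injective done done e = refl
  unfoldP-injective {suc i} (step {g = g} {p = p} {q = q} pre _ _ _ _ _) (step {g = g'} {p = p'} {q = q'} pre' _ _ _ _ _) e =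
    cong₂ _∷_ (*-cancelˡ-≡ q q' 2 (trans (sym (at-q {i} {g} {p} {q} l)) (trans (cong (λ z → at z (suc (suc (2 * i)))) e) (at-q {i} {g'} {p'} {q'} l'))))
     (cong₂ _∷_ (*-cancelˡ-≡ p p' 2 (trans (sym (at-p {i} {g} {p} {q} l)) (trans (cong (λ z → at z (suc (2 * i))) e) (at-p {i} {g'} {p'} {q'} l'))))
       (unfoldP-injective pre pre' (++-prefix (unfoldP g) (unfoldP g') (trans l (sym l')) e)))
    where
    l  = length-unfoldP pre
    l' = length-unfoldP pre'
    ++-prefix : ∀ (xs ys : List ℕ) {us vs} → length xs ≡ length ys → xs ++ us ≡ ys ++ vs → xs ≡ ys
    ++-prefix []       []       _ _ = refl
    ++-prefix (x ∷ xs) (y ∷ ys) l e = cong₂ _∷_ (∷-injectiveˡ e) (++-prefix xs ys (suc-injective l) (∷-injectiveʳ e))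

  -- The last two values can only be 2n, and nothing lies strictly between `n ∸ 1` and `n`. So a
  -- code has `n ∸ 1` stages and starts with no marks.
  toSP : List Step → List ℕ
  toSP c = unfoldP (n ∷ n ∷ decP (n ∸ 1) [] c)

  marks-[] : ∀ i → Marks i []
  marks-[] i = record { inRange = [] ; unique = [] }

  module _ (m : ℕ) (n≡ : n ≡ suc m) where

    private
      m<n : m < n
      m<n = ≤-reflexive (sym n≡)
      n∸1 : n ∸ 1 ≡ m
      n∸1 = cong (_∸ 1) n≡

    dec-pre : ∀ c → Ok m 0 c → Pre m (decP (n ∸ 1) [] c)
    dec-pre c ok = subst (λ z → Pre m (decP z [] c)) (sym n∸1) (proj₁ (soundP m c m<n (marks-[] m) ok))

    full-pre : ∀ {g} → Pre m g → Pre n (n ∷ n ∷ g)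
    full-pre {g} pre = subst (λ z → Pre z (n ∷ n ∷ g)) (sym n≡)
      (step pre m<n ≤-refl m<n ≤-refl (here (sym n≡)))

    toSP-isSP : ∀ c → Ok m 0 c → IsSP n (toSP c)
    toSP-isSP c ok = pre⇒SP (full-pre (dec-pre c ok))

    toSP-injective : ∀ c c' → Ok m 0 c → Ok m 0 c' → toSP c ≡ toSP c' → c ≡ c'
    toSP-injective c c' ok ok' e = decP-injective m c c' m<n (marks-[] m) ok ok'
      (subst (λ z → decP z [] c ≡ decP z [] c') n∸1
        (∷-injectiveʳ (∷-injectiveʳ (unfoldP-injective (full-pre (dec-pre c ok)) (full-pre (dec-pre c' ok')) e))))

    toSP-surjective : ∀ f → IsSP n f → ∃ λ c → Ok m 0 c × toSP c ≡ f
    toSP-surjective f (len , bd , sj) with SP⇒pre n f len bd sj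
    ... | g , pre , e = peel n≡ pre e
      where
      peel : ∀ {i g} → i ≡ suc m → Pre i g → unfoldP g ≡ f → ∃ λ c → Ok m 0 c × toSP c ≡ f
      peel refl (step {p = p} {q} pre p≥ p≤ q≥ q≤ _) e
        with completeP [] m<n pre (marks-[] m) (λ y p q → contradiction (≤-trans q (≤-reflexive n≡)) (≤⇒≯ p))
      ... | c , ok , c≡ = c , ok , trans (cong unfoldP (cong₂ _∷_ (max q≥ q≤) (cong₂ _∷_ (max p≥ p≤)
                             (trans (cong (λ z → decP z [] c) n∸1) c≡)))) e
        where
        max : ∀ {x} → suc m ≤ x → x ≤ n → n ≡ x
        max p q = ≤-antisym (≤-trans (≤-reflexive n≡) p) q

    private
      at-decP : ∀ i {M} c → i < n → Marks i M → Ok i (length M) c → ∀ v → 1 ≤ v → v ≤ i →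
        (at (unfoldP (decP i M c)) (2 * v) ≡ᵇ 2 * v) ≡ (aAt i c v ≡ᵇ 0)
      at-decP zero c _ _ _ v p q = contradiction (≤-trans p q) λ ()
      at-decP (suc i) {M} (s@(e , a , g , b) ∷ c) i<n st ok v 1≤v v≤ = go (v ≟ suc i)
        where
        module SS = SoundStep (soundStep i s c i<n st ok)
        module SA = SoundA SS.A
        module SB = SoundB SS.B
        q = proj₁ (stepA (suc i) M e a)
        R = proj₂ (stepA (suc i) M e a)
        p = proj₁ (stepB R g b)
        S = proj₂ (stepB R g b)
        h = decP i S c
        l = length-unfoldP SS.pre
        go : Dec (v ≡ suc i) → (at (unfoldP (q ∷ p ∷ h)) (2 * v) ≡ᵇ 2 * v) ≡ ((if v ≡ᵇ suc i then a else aAt i c v) ≡ᵇ 0)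
        go (yes refl) rewrite ≡ᵇ-true {suc i} refl = bool-ext
          (λ t → ≡ᵇ-true (SA.isFix⁻ (*-cancelˡ-≡ q (suc i) 2 (trans (sym at≡) (≡ᵇ-true⁻ t)))))
          (λ t → ≡ᵇ-true (trans at≡ (cong (2 *_) (SA.isFix (≡ᵇ-true⁻ t)))))
          where
          at≡ : at (unfoldP (q ∷ p ∷ h)) (2 * suc i) ≡ 2 * q
          at≡ = trans (cong (at (unfoldP (q ∷ p ∷ h))) (*-suc 2 i)) (at-q {i} {h} {p} {q} l)
        go (no v≢) rewrite ≡ᵇ-false v≢ = trans
          (cong (_≡ᵇ 2 * v) (at-old {i} {h} {p} {q} l (2 * v) (*-monoʳ-≤ 2 (≤-pred (≤∧≢⇒< v≤ v≢)))))
          (at-decP i c (<⇒≤ i<n) SB.marks SS.okTail v 1≤v (≤-pred (≤∧≢⇒< v≤ v≢)))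

    fix-toSP : ∀ c → Ok m 0 c → ∀ v → 1 ≤ v → v ≤ m → (at (toSP c) (2 * v) ≡ᵇ 2 * v) ≡ (aAt m c v ≡ᵇ 0)
    fix-toSP c ok v 1≤v v≤ = trans
      (cong (_≡ᵇ 2 * v) (trans
        (at-old {m} {decP (n ∸ 1) [] c} {n} {n} (length-unfoldP (dec-pre c ok)) (2 * v) (*-monoʳ-≤ 2 v≤))
        (cong (λ z → at (unfoldP (decP z [] c)) (2 * v)) n∸1)))
      (at-decP m c m<n (marks-[] m) ok v 1≤v v≤)

-- Words of columns and their shapes

module _ (k : ℕ) where

  -- Words of columns: the letter j adds on the left a column with ⌈j/2⌉ cells in ∂ᵏ, placed above all rows
  -- of length at least k − ⌊j/2⌋.

  τ : ℕ → ℕ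
  τ j = k ∸ ⌊ j /2⌋

  ht : ℕ → ℕ
  ht j = ⌈ j /2⌉

  colsW : List ℕ → List (ℕ × ℕ)
  colsW []      = []
  colsW (j ∷ w) = (colHt (sh (colsW w)) (τ j) , ht j) ∷ colsW w

  shW : List ℕ → List ℕ
  shW w = sh (colsW w)

  rlW : List ℕ → ℕ → ℕ
  rlW w = rl (colsW w)

  dW : ℕ → List ℕ → ℕ
  dW j w = colHt (shW w) (τ j)

  Letter : ℕ → Set
  Letter j = 1 ≤ j × ⌊ j /2⌋ < k

  -- Parity enters only through the two halves: for a letter, threshold plus height is `suc k` if it
  -- is odd and `k` if it is even.
  Odd : ℕ → Set
  Odd j = ⌈ j /2⌉ ≡ suc ⌊ j /2⌋

  parity : ∀ j → ⌈ j /2⌉ ≡ ⌊ j /2⌋ ⊎ Odd j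
  parity zero          = inj₁ refl
  parity (suc zero)    = inj₂ refl
  parity (suc (suc j)) with parity j
  ... | inj₁ e = inj₁ (cong suc e)
  ... | inj₂ e = inj₂ (cong suc e)

  τ+ht-odd : ∀ {j} → ⌊ j /2⌋ < k → Odd j → τ j + ht j ≡ suc k
  τ+ht-odd {j} p o = trans (cong (τ j +_) o) (trans (+-suc (τ j) ⌊ j /2⌋) (cong suc (m∸n+n≡m (<⇒≤ p))))

  τ+ht-even : ∀ {j} → ⌊ j /2⌋ < k → ht j ≡ ⌊ j /2⌋ → τ j + ht j ≡ k
  τ+ht-even {j} p e = trans (cong (τ j +_) e) (m∸n+n≡m (<⇒≤ p))

  k≤τ+ht : ∀ {j} → ⌊ j /2⌋ < k → k ≤ τ j + ht j
  k≤τ+ht {j} p with parity j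
  ... | inj₁ e = ≤-reflexive (sym (τ+ht-even {j} p e))
  ... | inj₂ o = ≤-trans (n≤1+n k) (≤-reflexive (sym (τ+ht-odd {j} p o)))

  τ+ht≤ : ∀ {j} → ⌊ j /2⌋ < k → τ j + ht j ≤ suc k
  τ+ht≤ {j} p with parity j
  ... | inj₁ e = ≤-trans (≤-reflexive (τ+ht-even {j} p e)) (n≤1+n k)
  ... | inj₂ o = ≤-reflexive (τ+ht-odd {j} p o)

  τ-anti : ∀ {i j} → i ≤ j → τ j ≤ τ i
  τ-anti p = ∸-monoʳ-≤ k (⌊n/2⌋-mono p)

  ⌊even⌋ : ∀ i → ⌊ i + i /2⌋ ≡ i
  ⌊even⌋ i = sym (n≡⌊n+n/2⌋ i)

  ⌈even⌉ : ∀ i → ⌈ i + i /2⌉ ≡ i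
  ⌈even⌉ i = sym (n≡⌈n+n/2⌉ i)

  ⌈odd⌉ : ∀ i → ⌈ suc (i + i) /2⌉ ≡ suc i
  ⌈odd⌉ i = cong suc (⌊even⌋ i)

  oddOdd : ∀ i → Odd (suc (i + i))
  oddOdd i = trans (⌈odd⌉ i) (cong suc (sym (⌈even⌉ i)))

  τ-even : ∀ i → τ (i + i) ≡ k ∸ i
  τ-even i = cong (k ∸_) (⌊even⌋ i)

  τ-odd : ∀ i → τ (suc (i + i)) ≡ k ∸ i
  τ-odd i = cong (k ∸_) (⌈even⌉ i)

  -- The first d rows are complete; the rows above them lie entirely in ∂ᵏ and can still grow up to length t.
  record Inv (d t v : ℕ) (C : List (ℕ × ℕ)) : Set where
    field
      isGood  : Good k C
      closed  : ∀ r → 1 ≤ r → r ≤ d → t ≤ rl C r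
      opened  : ∀ r → d < r → rl C r ≡ at (sh C) r
      bounded : ∀ r → d < r → at (sh C) r ≤ t
      len     : length (sh C) ≤ d + v
      decr    : Decr (rl C)

  inv-[] : ∀ t v → Inv 0 t v []
  inv-[] t v = record
    { isGood  = []
    ; closed  = λ r p q → contradiction (≤-trans p q) λ ()
    ; opened  = λ r p → refl
    ; bounded = λ r p → z≤n
    ; len     = z≤n
    ; decr    = λ r p → z≤n
    }

  module _ {d₀ t₀ v₀ C t v} (I : Inv d₀ t₀ v₀ C) (t≤t₀ : t ≤ t₀) (v₀≤v : v₀ ≤ v)
           (1≤t : 1 ≤ t) (1≤v : 1 ≤ v) (k≤t+v : k ≤ t + v) (t+v≤ : t + v ≤ suc k) where

    private
      open Inv I
      s = sh C
      d = colHt s t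
      dec-s = good-decr isGood

      d₀≤d : d₀ ≤ d
      d₀≤d = lower d₀ ≤-refl
        where
        lower : ∀ r → r ≤ d₀ → r ≤ d
        lower zero    _ = z≤n
        lower (suc r) q = colHt-at s dec-s 1≤t (s≤s z≤n)
          (≤-trans t≤t₀ (≤-trans (closed (suc r) (s≤s z≤n) q) (rl≤at isGood (suc r) (s≤s z≤n))))

      len' : length s ≤ d + v
      len' = ≤-trans len (+-mono-≤ d₀≤d v₀≤v)

      C' = (d , v) ∷ C

      at< : ∀ {r} → d < r → at s r < t
      at< p = at<colHt s dec-s 1≤t p

      good' : Good k C'
      good' = good 1≤v len' (λ p → ≤-trans k≤t+v (+-monoˡ-≤ v (at-colHt s dec-s 1≤t p ≤-refl)))
                (≤-pred (≤-trans (+-monoˡ-≤ v (at< ≤-refl)) t+v≤)) isGood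

      closed' : ∀ r → 1 ≤ r → r ≤ d → t ≤ rl C' r
      closed' r p q rewrite rl-out {d} {v} {C} {r} (λ { (x , _) → <⇒≱ x q }) with r ≤? d₀
      ... | yes r≤d₀ = ≤-trans t≤t₀ (closed r p r≤d₀)
      ... | no  r≰d₀ rewrite opened r (≰⇒> r≰d₀) = at-colHt s dec-s 1≤t p q

      opened' : ∀ r → d < r → rl C' r ≡ at (sh C') r
      opened' r p with r ≤? d + v
      ... | yes q rewrite rl-in {d} {v} {C} {r} p q | at-addcol (d + v) s r len' (≤-trans (s≤s z≤n) p) q =
              cong suc (opened r (≤-<-trans d₀≤d p))
      ... | no ¬q rewrite rl-out {d} {v} {C} {r} (λ { (_ , x) → ¬q x }) | at-addcol> (d + v) s r len' (≰⇒> ¬q) =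
              trans (opened r (≤-<-trans d₀≤d p)) (at-beyond s r (≤-<-trans len' (≰⇒> ¬q)))

      bounded' : ∀ r → d < r → at (sh C') r ≤ t
      bounded' r p with r ≤? d + v
      ... | yes q rewrite at-addcol (d + v) s r len' (≤-trans (s≤s z≤n) p) q = at< p
      ... | no ¬q rewrite at-addcol> (d + v) s r len' (≰⇒> ¬q) = z≤n

      decr' : Decr (rl C')
      decr' r p with suc r ≤? d
      ... | yes q rewrite rl-out {d} {v} {C} {r} (λ { (x , _) → <⇒≱ x (<⇒≤ q) })
                        | rl-out {d} {v} {C} {suc r} (λ { (x , _) → <⇒≱ x q }) = decr r p
      ... | no ¬q with r ≤? d
      ...   | yes q' = ≤-trans (≤-reflexive (opened' (suc r) (≰⇒> ¬q)))
                         (≤-trans (bounded' (suc r) (≰⇒> ¬q)) (closed' r p q'))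
      ...   | no ¬q' = subst₂ _≤_ (sym (opened' (suc r) (≰⇒> ¬q))) (sym (opened' r (≰⇒> ¬q')))
                         (good-decr good' r p)

    -- The rows up to the new depth have length at least `t` and the following ones less, so
    -- `k ≤ t + v ≤ suc k` makes the hook lengths pass `k` exactly at this depth. A row closed only
    -- now lay wholly in ∂ᵏ, so its length there is at least `t`.
    inv-step : Inv (colHt (sh C) t) t v ((colHt (sh C) t , v) ∷ C)
    inv-step = record
      { isGood  = good'
      ; closed  = closed'
      ; opened  = opened'
      ; bounded = bounded'
      ; len     = ≤-reflexive (length-addcol (d + v) s len')
      ; decr    = decr'
      }

  1≤ht : ∀ {j} → 1 ≤ j → 1 ≤ ht j
  1≤ht {suc j} p = s≤s z≤n

  SortedWord : List ℕ → Set
  SortedWord w = Linked _≥_ w × All Letter w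

  tailW : ∀ {j w} → SortedWord (j ∷ w) → SortedWord w
  tailW (l , _ ∷ a) = Linked.tail l , a

  inv-word : ∀ {j w} → SortedWord (j ∷ w) → Inv (dW j w) (τ j) (ht j) (colsW (j ∷ w))
  inv-word {j} {[]} (l , (p , q) ∷ _) =
    inv-step (inv-[] (τ j) (ht j)) ≤-refl ≤-refl (m<n⇒0<n∸m q) (1≤ht p) (k≤τ+ht {j} q) (τ+ht≤ {j} q)
  inv-word {j} {j₀ ∷ w} sw@(j≥j₀ ∷ _ , (p , q) ∷ _) =
    inv-step (inv-word (tailW sw)) (τ-anti j≥j₀) (⌈n/2⌉-mono j≥j₀) (m<n⇒0<n∸m q) (1≤ht p) (k≤τ+ht {j} q) (τ+ht≤ {j} q)

  goodW : ∀ {w} → SortedWord w → Good k (colsW w)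
  goodW {[]}    sw = []
  goodW {j ∷ w} sw = Inv.isGood (inv-word sw)

  decrW : ∀ {w} → SortedWord w → Decr (at (shW w))
  decrW sw = good-decr (goodW sw)

  decr-rlW : ∀ {w} → SortedWord w → Decr (rlW w)
  decr-rlW {[]}    sw = λ r p → z≤n
  decr-rlW {j ∷ w} sw = Inv.decr (inv-word sw)

  lenW : ∀ {j w} → SortedWord (j ∷ w) → length (shW w) ≤ dW j w + ht j
  lenW sw with goodW sw
  ... | good _ l _ _ _ = l

  -- Letters and final row lengths

  OnCols : (ℕ → ℕ → Set) → List ℕ → Set
  OnCols P []      = ⊤
  OnCols P (j ∷ w) = P j (dW j w) × OnCols P w

  onCols-map : ∀ {P Q : ℕ → ℕ → Set} {R : ℕ → Set} {w} → (∀ j d → R j → P j d → Q j d) →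
               All R w → OnCols P w → OnCols Q w
  onCols-map f []       tt       = tt
  onCols-map f (r ∷ rs) (p , ps) = f _ _ r p , onCols-map f rs ps

  Up : (ℕ → ℕ) → ℕ → ℕ → Set
  Up ρ j d = ∀ r → d < r → ρ r ≤ τ j

  -- `Up` holds for every sorted word, with `ρ` its row lengths. `Lo` is the extra condition that
  -- makes a word recoverable: the lowest cell of an odd column then lies in a row of final length
  -- exactly `τ j`.
  Lo : (ℕ → ℕ) → ℕ → ℕ → Set
  Lo ρ j d = Odd j → τ j ≤ ρ (suc d)

  rlW-up : ∀ {j w} → SortedWord (j ∷ w) → ∀ {t} r → τ j ≤ t → rlW w r ≤ t → rlW (j ∷ w) r ≤ t
  rlW-up {j} {w} sw r p q with r ≤? dW j w
  ... | yes r≤d = subst (_≤ _) (sym (rl-out {dW j w} {ht j} {colsW w} {r} λ { (x , _) → <⇒≱ x r≤d })) q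
  ... | no  r≰d = ≤-trans (≤-reflexive (Inv.opened (inv-word sw) r (≰⇒> r≰d)))
                    (≤-trans (Inv.bounded (inv-word sw) r (≰⇒> r≰d)) p)

  linked⇒All≤ : ∀ {j w} → Linked _≥_ (j ∷ w) → All (_≤ j) w
  linked⇒All≤ [-]     = []
  linked⇒All≤ (p ∷ l) = p ∷ All.map (λ q → ≤-trans q p) (linked⇒All≤ l)

  upW : ∀ {w} → SortedWord w → OnCols (Up (rlW w)) w
  upW {[]}    sw = tt
  upW {j ∷ w} sw =
      (λ r p → ≤-trans (≤-reflexive (Inv.opened (inv-word sw) r p)) (Inv.bounded (inv-word sw) r p))
    , onCols-map (λ j' d j'≤j u r p → rlW-up sw r (τ-anti j'≤j) (u r p)) (linked⇒All≤ (proj₁ sw)) (upW (tailW sw))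

  Typed : (ℕ → ℕ) → List ℕ → Set
  Typed ρ w = OnCols (Up ρ) w × OnCols (Lo ρ) w

  odd⇒eq : ∀ {ρ j d} → Up ρ j d → Lo ρ j d → Odd j → ρ (suc d) ≡ τ j
  odd⇒eq u l o = ≤-antisym (u _ ≤-refl) (l o)

  halves-injective : ∀ {j j'} → ⌊ j /2⌋ ≡ ⌊ j' /2⌋ → ⌈ j /2⌉ ≡ ⌈ j' /2⌉ → j ≡ j'
  halves-injective {j} {j'} e e' = trans (sym (⌊n/2⌋+⌈n/2⌉≡n j)) (trans (cong₂ _+_ e e') (⌊n/2⌋+⌈n/2⌉≡n j'))

  -- The parity of a letter is read off the final length of the row of the lowest cell.
  odd-iff : ∀ {ρ j d} → ⌊ j /2⌋ < k → Up ρ j d → Lo ρ j d → ρ (suc d) + ht j ≡ suc k → Odd j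
  odd-iff {ρ} {j} {d} q u l e with parity j
  ... | inj₂ o  = o
  ... | inj₁ ev = contradiction (≤-reflexive (sym e)) (<⇒≱ (s≤s (≤-trans (+-monoˡ-≤ (ht j) (u _ ≤-refl))
                     (≤-reflexive (τ+ht-even {j} q ev)))))

  -- Only two letters share a given height, one odd and one even, and `ρ` decides between them.
  typed-unique : ∀ {ρ w w'} → All Letter w → All Letter w' → Typed ρ w → Typed ρ w' → colsW w ≡ colsW w' → w ≡ w'
  typed-unique {w = []}    {[]}     _ _ _ _ _ = refl
  typed-unique {ρ} {j ∷ w} {j' ∷ w'} ((_ , q) ∷ a) ((_ , q') ∷ a') ((u , us) , (l , ls)) ((u' , us') , (l' , ls')) e
    with ∷-injective e
  ... | e₁ , e₂ = cong₂ _∷_ j≡j' (typed-unique a a' (us , ls) (us' , ls') e₂)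
    where
    ed : dW j w ≡ dW j' w'
    ed = cong proj₁ e₁
    eh : ht j ≡ ht j'
    eh = cong proj₂ e₁
    transfer : Odd j → Odd j'
    transfer o = odd-iff q' u' l' (trans (cong₂ (λ d h → ρ (suc d) + h) (sym ed) (sym eh))
                   (trans (cong (_+ ht j) (odd⇒eq {ρ} u l o)) (τ+ht-odd {j} q o)))
    transfer' : Odd j' → Odd j
    transfer' o = odd-iff q u l (trans (cong₂ (λ d h → ρ (suc d) + h) ed eh)
                   (trans (cong (_+ ht j') (odd⇒eq {ρ} u' l' o)) (τ+ht-odd {j'} q' o)))
    j≡j' : j ≡ j'
    j≡j' with parity j | parity j'
    ... | inj₁ ev | inj₁ ev' = halves-injective (trans (sym ev) (trans eh ev')) eh
    ... | inj₁ ev | inj₂ o'  = contradiction (trans (sym (transfer' o')) ev) 1+n≢n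
    ... | inj₂ o  | inj₁ ev' = contradiction (trans (sym (transfer o)) ev') 1+n≢n
    ... | inj₂ o  | inj₂ o'  = halves-injective (suc-injective (trans (sym o) (trans eh o'))) eh

  count-cols≤ : ∀ {P : ℕ → ℕ → Set} (p : ℕ × ℕ → Bool) (j : ℕ) {w} →
    (∀ j' d → Letter j' → P j' d → p (d , ht j') ≡ true → j' ≡ j) →
    All Letter w → OnCols P w → count p (colsW w) ≤ count (_≡ᵇ j) w
  count-cols≤ p j {[]} h a o = z≤n
  count-cols≤ p j {j' ∷ w} h (a ∷ as) (o , os) with p (dW j' w , ht j') in e | j' ≡ᵇ j in e'
  ... | true  | true  = s≤s (count-cols≤ p j h as os)
  ... | false | true  = m≤n⇒m≤1+n (count-cols≤ p j h as os)
  ... | false | false = count-cols≤ p j h as os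
  ... | true  | false = contradiction (trans (sym (≡ᵇ-true (h j' _ a o e))) e') λ ()

  isStep-true⁻ : ∀ {ρ u v d v'} → isStep ρ u v (d , v') ≡ true → v' ≡ v × ρ (suc d) ≡ u
  isStep-true⁻ {ρ} {u} {v} {d} {v'} e with ∧-true⁻ {1 ≤ᵇ v} e
  ... | _ , e₁ with ∧-true⁻ {v' ≡ᵇ v} e₁
  ... | e₂ , e₃ = ≡ᵇ-true⁻ e₂ , ≡ᵇ-true⁻ e₃

  isStep-true : ∀ {ρ u v d v'} → 1 ≤ v → v' ≡ v → ρ (suc d) ≡ u → isStep ρ u v (d , v') ≡ true
  isStep-true p e e' = ∧-true (≤ᵇ-true p) (∧-true (≡ᵇ-true e) (≡ᵇ-true e'))

  -- A step of H_i ∩ V_{k-i} can only come from the letter 2(k-i), since for an odd letter row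
  -- length plus height is `suc k`. A step of H_i ∩ V_{k+1-i} can only come from 2(k-i) + 1, by
  -- `odd-iff`. Both letters have threshold `i`.
  sorted⇒irreducible : ∀ {w} → SortedWord w → OnCols (Lo (rlW w)) w →
    (∀ j → count (_≡ᵇ j) w ≤ τ j ∸ 1) → IsIrreducible k (shW w)
  sorted⇒irreducible {w} sw lo bound =
      good⇒kshape (goodW sw) (heights (proj₁ sw)) (decr-rlW sw)
    , λ i p q → even-case i q , odd-case i q
    where
    ρ = rlW w
    heights : ∀ {w} → Linked _≥_ w → Linked _≥_ (map proj₂ (colsW w))
    heights []      = []
    heights [-]     = [-]
    heights (p ∷ l) = ⌈n/2⌉-mono p ∷ heights l
    typed : OnCols (λ j d → Up ρ j d × Lo ρ j d) w
    typed = go w (upW sw) lo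
      where
      go : ∀ w' → OnCols (Up ρ) w' → OnCols (Lo ρ) w' → OnCols (λ j d → Up ρ j d × Lo ρ j d) w'
      go []       _ _ = tt
      go (_ ∷ w') (u , us) (l , ls) = (u , l) , go w' us ls
    even-case : ∀ i → i ≤ k → steps k (shW w) i (k ∸ i) ≤ i ∸ 1
    even-case i i≤k = ≤-trans (≤-reflexive (steps≡count (goodW sw) i v))
        (≤-trans (count-cols≤ (isStep ρ i v) (v + v) only (proj₂ sw) typed)
        (≤-trans (bound (v + v)) (≤-reflexive (cong (_∸ 1) (trans (τ-even v) (m∸[m∸n]≡n i≤k))))))
      where
      v = k ∸ i
      only : ∀ j d → Letter j → Up ρ j d × Lo ρ j d → isStep ρ i v (d , ht j) ≡ true → j ≡ v + v
      only j d (_ , q) (u , l) e with isStep-true⁻ {ρ} {i} {v} {d} e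
      ... | e₁ , e₂ with parity j
      ...   | inj₁ ev = halves-injective (trans (sym ev) (trans e₁ (sym (⌊even⌋ v)))) (trans e₁ (sym (⌈even⌉ v)))
      ...   | inj₂ o  = contradiction (trans (sym (τ+ht-odd {j} q o))
                          (trans (cong₂ _+_ (trans (sym (odd⇒eq {ρ} u l o)) e₂) e₁) (m+[n∸m]≡n i≤k))) 1+n≢n
    odd-case : ∀ i → i ≤ k → steps k (shW w) i (suc k ∸ i) ≤ i ∸ 1
    odd-case i i≤k = subst (λ z → steps k (shW w) i z ≤ i ∸ 1) (sym (+-∸-assoc 1 i≤k))
        (≤-trans (≤-reflexive (steps≡count (goodW sw) i (suc v)))
        (≤-trans (count-cols≤ (isStep ρ i (suc v)) (suc (v + v)) only (proj₂ sw) typed)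
        (≤-trans (bound (suc (v + v))) (≤-reflexive (cong (_∸ 1) (trans (τ-odd v) (m∸[m∸n]≡n i≤k)))))))
      where
      v = k ∸ i
      only : ∀ j d → Letter j → Up ρ j d × Lo ρ j d → isStep ρ i (suc v) (d , ht j) ≡ true → j ≡ suc (v + v)
      only j d (_ , q) (u , l) e with isStep-true⁻ {ρ} {i} {suc v} {d} e
      ... | e₁ , e₂ = halves-injective (suc-injective (trans (sym o) (trans e₁ (cong suc (sym (⌈even⌉ v))))))
                                       (trans e₁ (sym (⌈odd⌉ v)))
        where
        o : Odd j
        o = odd-iff q u l (trans (cong₂ _+_ e₂ e₁) (trans (+-suc i v) (cong suc (m+[n∸m]≡n i≤k))))

  -- Height `suc i` belongs to the letters 2i + 1 and 2i + 2, and above the depth of a column with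
  -- the latter all rows have final length less than `k ∸ i`.
  meets-odd : ∀ {w} → SortedWord w → ∀ i → i ≤ k →
    meets k (shW w) (k ∸ i) (suc i) ≡ true → suc (i + i) ∈ w
  meets-odd {w} sw i i≤k e with meets-true⁻ (goodW sw) e
  ... | d , r , m , d<r , e' = go w (proj₂ sw) (upW sw) m
    where
    go : ∀ w' → All Letter w' → OnCols (Up (rlW w)) w' → (d , suc i) ∈ colsW w' → suc (i + i) ∈ w'
    go (j ∷ w') (_ ∷ as) (_ , us) (there m) = there (go w' as us m)
    go (j ∷ w') ((_ , q) ∷ as) (u , us) (here e₁) with parity j
    ... | inj₂ o  = here (halves-injective (suc-injective (trans (cong suc (⌈even⌉ i)) (trans (cong proj₂ e₁) o))) (trans (⌈odd⌉ i) (cong proj₂ e₁)))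
    ... | inj₁ ev = contradiction (≤-trans (≤-reflexive (sym e')) (u r (subst (_< r) (cong proj₁ e₁) d<r)))
                      (<⇒≱ (subst (λ a → k ∸ a < k ∸ i) h (∸-monoʳ-< (n<1+n i) (subst (_≤ k) (sym h) (<⇒≤ q)))))
      where h : suc i ≡ ⌊ j /2⌋
            h = trans (cong proj₂ e₁) ev

  odd-meets : ∀ {w} → SortedWord w → OnCols (Lo (rlW w)) w → ∀ i →
    suc (i + i) ∈ w → meets k (shW w) (k ∸ i) (suc i) ≡ true
  odd-meets {w} sw lo i m with go w (upW sw) lo m
    where
    go : ∀ w' → OnCols (Up (rlW w)) w' → OnCols (Lo (rlW w)) w' → suc (i + i) ∈ w' →
         ∃ λ d → (d , suc i) ∈ colsW w' × rlW w (suc d) ≡ k ∸ i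
    go (j ∷ w') (_ , us) (_ , ls) (there m) with go w' us ls m
    ... | d , m' , e = d , there m' , e
    go (j ∷ w') (u , _) (l , _) (here refl) =
      dW j w' , here (cong (dW j w' ,_) (sym (⌈odd⌉ i))) , trans (odd⇒eq {rlW w} u l (oddOdd i)) (τ-odd i)
  ... | d , m' , e = subst (λ z → meets k (shW w) z (suc i) ≡ true) e (meets-true (goodW sw) m')

  -- Words arranged in stages

  blk : ℕ → ℕ → ℕ → List ℕ → List ℕ
  blk i x o w = replicate x (suc (i + i)) ++ replicate o (i + i) ++ w

  -- Both runs of a stage have the threshold k − i. Asking that a nonempty run of odd letters ends with a
  -- row of length k − i makes the word of a shape unique: a column meeting no row of length k − i − 1 could
  -- also be read as the next even letter.
  data Blocks : ℕ → List ℕ → Set where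
    done  : Blocks 0 []
    block : ∀ {i w} x o → Blocks i w → o < k ∸ suc i → x < k ∸ suc i →
            (1 ≤ x → k ∸ suc i ∈ shW (blk (suc i) x o w)) → Blocks (suc i) (blk (suc i) x o w)

  suc+suc : ∀ i → suc i + suc i ≡ suc (suc (i + i))
  suc+suc i = cong suc (+-suc i i)

  evenLetter : ∀ i → suc i < k → Letter (suc i + suc i)
  evenLetter i p = s≤s z≤n , subst (_< k) (sym (⌊even⌋ (suc i))) p

  oddLetter : ∀ i → suc i < k → Letter (suc (suc i + suc i))
  oddLetter i p = s≤s z≤n , subst (_< k) (sym (⌈even⌉ (suc i))) p

  sorted-∷ : ∀ {j w} → Letter j → All (_≤ j) w → SortedWord w → SortedWord (j ∷ w)
  sorted-∷ {w = []}    p _        _         = [-] , p ∷ []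
  sorted-∷ {w = _ ∷ _} p (le ∷ _) (l , a) = (le ∷ l) , p ∷ a

  All≤-rep : ∀ x {a w} → All (_≤ a) w → All (_≤ a) (replicate x a ++ w)
  All≤-rep zero    h = h
  All≤-rep (suc x) h = ≤-refl ∷ All≤-rep x h

  sorted-rep : ∀ x {a w} → Letter a → All (_≤ a) w → SortedWord w → SortedWord (replicate x a ++ w)
  sorted-rep zero    p h sw = sw
  sorted-rep (suc x) p h sw = sorted-∷ p (All≤-rep x h) (sorted-rep x p h sw)

  blocks-sorted : ∀ {i w} → Blocks i w → SortedWord w × All (_≤ suc (i + i)) w
  blocks-sorted done = ([] , []) , []
  blocks-sorted (block {i} {w} x o b o< x< _) with blocks-sorted b
  ... | sw , a = sorted-rep x (oddLetter i i<k) a₂ (sorted-rep o (evenLetter i i<k) a₁ sw) , All≤-rep x a₂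
    where
    i<k : suc i < k
    i<k = m∸n≢0⇒n<m λ e → contradiction (subst (o <_) e o<) λ ()
    a₁ : All (_≤ suc i + suc i) w
    a₁ = All.map (λ q → ≤-trans q (≤-trans (n≤1+n _) (≤-reflexive (sym (suc+suc i))))) a
    a₂ : All (_≤ suc (suc i + suc i)) (replicate o (suc i + suc i) ++ w)
    a₂ = All.map m≤n⇒m≤1+n (All≤-rep o a₁)

  blocks-< : ∀ {i w} → Blocks i w → All (_< suc i + suc i) w
  blocks-< {i} b = All.map (λ q → ≤-trans (s≤s q) (≤-reflexive (sym (suc+suc i)))) (proj₂ (blocks-sorted b))

  blocks-i<k : ∀ {i w} → Blocks (suc i) w → suc i < k
  blocks-i<k (block {i} x o b o< _ _) = m∸n≢0⇒n<m λ e → contradiction (subst (o <_) e o<) λ ()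

  mid-sorted : ∀ {i w} → Blocks i w → suc i < k → ∀ o → SortedWord (replicate o (suc i + suc i) ++ w)
  mid-sorted {i} b p o = sorted-rep o (evenLetter i p) (All.map <⇒≤ (blocks-< b)) (proj₁ (blocks-sorted b))

  top-sorted : ∀ {i w} → Blocks i w → suc i < k → ∀ o x → SortedWord (blk (suc i) x o w)
  top-sorted {i} b p o x = sorted-rep x (oddLetter i p)
    (All.map m≤n⇒m≤1+n (All≤-rep o (All.map <⇒≤ (blocks-< b)))) (mid-sorted b p o)

  colHt-mono : ∀ s s' {c} → Decr (at s) → Decr (at s') → 1 ≤ c → (∀ r → 1 ≤ r → at s r ≤ at s' r) →
               colHt s c ≤ colHt s' c
  colHt-mono s s' {c} ds ds' p h = go (colHt s c) ≤-refl
    where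
    go : ∀ d → d ≤ colHt s c → d ≤ colHt s' c
    go zero    q = z≤n
    go (suc d) q = colHt-at s' ds' p (s≤s z≤n) (≤-trans (at-colHt s ds p (s≤s z≤n) q) (h (suc d) (s≤s z≤n)))

  colHt-anti : ∀ s {c c'} → Decr (at s) → 1 ≤ c → c ≤ c' → colHt s c' ≤ colHt s c
  colHt-anti s {c} {c'} ds p h = go (colHt s c') ≤-refl
    where
    go : ∀ d → d ≤ colHt s c' → d ≤ colHt s c
    go zero    q = z≤n
    go (suc d) q = colHt-at s ds p (s≤s z≤n) (≤-trans h (at-colHt s ds (≤-trans p h) (s≤s z≤n) q))

  1≤τ : ∀ {j} → Letter j → 1 ≤ τ j
  1≤τ (_ , q) = m<n⇒0<n∸m q

  colHt-grow : ∀ {j w} → SortedWord (j ∷ w) → ∀ {c} → 1 ≤ c → colHt (shW w) c ≤ colHt (shW (j ∷ w)) c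
  colHt-grow {j} {w} sw p = colHt-mono (shW w) (shW (j ∷ w)) (decrW (tailW sw)) (decrW sw) p
    λ r q → at-shift≥ (dW j w + ht j) (shW w) r (lenW sw) q

  length-shW : ∀ {j w} → SortedWord (j ∷ w) → length (shW (j ∷ w)) ≡ dW j w + ht j
  length-shW {j} {w} sw = length-addcol (dW j w + ht j) (shW w) (lenW sw)

  module _ {j w} (sw : SortedWord (j ∷ w)) (τ∈ : τ j ∈ shW (j ∷ w)) where

    private
      row = ∈⇒at τ∈
      r₀ = proj₁ row
      1≤r₀ = proj₁ (proj₂ row)
      at-r₀ = proj₂ (proj₂ (proj₂ row))
      1≤τj = 1≤τ (All.head (proj₂ sw))

      d<r₀ : dW j w < r₀
      d<r₀ = ≰⇒> λ r₀≤d → <⇒≱ (s≤s (at-colHt (shW w) (decrW (tailW sw)) 1≤τj 1≤r₀ r₀≤d))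
        (≤-reflexive (trans (sym (at-addcol (dW j w + ht j) (shW w) r₀ (lenW sw) 1≤r₀ (m≤n⇒m≤n+o (ht j) r₀≤d))) at-r₀))

    -- A row of length exactly `τ j` after the column lies above its depth, because the rows below
    -- have become longer than `τ j`. By monotonicity row `suc (dW j w)` is as long.
    full-rows : ∀ r → 1 ≤ r → r ≤ suc (dW j w) → τ j ≤ rlW (j ∷ w) r
    full-rows r p q with r ≤? dW j w
    ... | yes r≤d = Inv.closed (inv-word sw) r p r≤d
    ... | no  r≰d rewrite Inv.opened (inv-word sw) r (≰⇒> r≰d) =
            subst (_≤ at (shW (j ∷ w)) r) at-r₀ (decr-anti (decrW sw) p (≤-trans q d<r₀))

    full-grow : dW j w < colHt (shW (j ∷ w)) (τ j)
    full-grow = ≤-trans d<r₀ (colHt-at (shW (j ∷ w)) (decrW sw) 1≤τj 1≤r₀ (≤-reflexive (sym at-r₀)))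

  -- This makes the first column of the next stage open a row, whose length plays the part of the
  -- permanent residue 0. If the stage just ended has odd columns, its row of length `k ∸ i` raises
  -- the depth; if it has none, the new column is taller by one than its even columns.
  fresh : ∀ {i w} → Blocks i w → suc i < k → length (shW w) < colHt (shW w) (k ∸ suc i) + suc i

  -- The inequality need not be strict after an even run: the odd columns that follow are one cell
  -- taller, so the first of them opens a row in any case.
  mid-len : ∀ {i w} → Blocks i w → suc i < k → ∀ o →
    length (shW (replicate o (suc i + suc i) ++ w)) ≤ colHt (shW (replicate o (suc i + suc i) ++ w)) (k ∸ suc i) + suc i
  mid-len b p zero = <⇒≤ (fresh b p)
  mid-len {i} {w} b p (suc o) =
    ≤-trans (≤-reflexive (trans (length-shW sw) (cong₂ (λ a c → colHt (shW W) a + c) (τ-even (suc i)) (⌈even⌉ (suc i)))))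
            (+-monoˡ-≤ (suc i) (colHt-grow sw (m<n⇒0<n∸m p)))
    where
    W = replicate o (suc i + suc i) ++ w
    sw = mid-sorted b p (suc o)

  fresh done p = s≤s z≤n
  fresh (block {i} {w} x o b o< x< full) p = go x full
    where
    i' = suc i
    t = k ∸ i'
    p' : i' < k
    p' = <⇒≤ p
    1≤t' : 1 ≤ k ∸ suc i'
    1≤t' = m<n⇒0<n∸m p
    go : ∀ x → (1 ≤ x → t ∈ shW (blk i' x o w)) →
         length (shW (blk i' x o w)) < colHt (shW (blk i' x o w)) (k ∸ suc i') + suc i'
    go zero _ = ≤-trans (s≤s (≤-trans (mid-len b p' o)
      (+-monoˡ-≤ i' (colHt-anti (shW (replicate o (i' + i') ++ w)) (decrW (mid-sorted b p' o)) 1≤t' (∸-monoʳ-≤ k (n≤1+n i'))))))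
      (≤-reflexive (sym (+-suc _ i')))
    go (suc x) full = subst (λ z → z < colHt S (k ∸ suc i') + suc i') (sym (trans (length-shW sw) (cong (dW J W +_) (⌈odd⌉ i'))))
        (+-monoˡ-≤ (suc i') (≤-trans (full-grow sw (subst (_∈ S) (sym (τ-odd i')) (full (s≤s z≤n))))
          (colHt-anti S (decrW sw) 1≤t' (subst (k ∸ suc i' ≤_) (sym (τ-odd i')) (∸-monoʳ-≤ k (n≤1+n i'))))))
      where
      J = suc (i' + i')
      W = blk i' x o w
      S = shW (J ∷ W)
      sw = top-sorted b p' o (suc x)

  lo-weaken : ∀ {ρ ρ' : ℕ → ℕ} {w} → (∀ r → ρ r ≤ ρ' r) → OnCols (Lo ρ) w → OnCols (Lo ρ') w
  lo-weaken {w = w} h = onCols-map {R = λ _ → ⊤} (λ j d _ l o → ≤-trans (l o) (h (suc d))) (All.universal (λ _ → tt) w)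

  rlW-mono : ∀ u w r → rlW w r ≤ rlW (u ++ w) r
  rlW-mono []      w r = ≤-refl
  rlW-mono (j ∷ u) w r = ≤-trans (rlW-mono u w r) (rl-mono-∷ _ (colsW (u ++ w)) r)

  blocks-lo : ∀ {i w} → Blocks i w → OnCols (Lo (rlW w)) w
  blocks-lo done = tt
  blocks-lo B@(block {i} {w} x o b o< x< full) = odds x full
    where
    i' = suc i
    i'<k = blocks-i<k B
    evens : ∀ o → OnCols (Lo (rlW (replicate o (i' + i') ++ w))) (replicate o (i' + i') ++ w)
    evens zero    = blocks-lo b
    evens (suc o) = (λ odd → contradiction (trans (sym odd) (trans (⌈even⌉ i') (sym (⌊even⌋ i')))) 1+n≢n)
                  , lo-weaken (rlW-mono (i' + i' ∷ []) (replicate o (i' + i') ++ w)) (evens o)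
    W = replicate o (i' + i') ++ w
    J = suc (i' + i')
    grow : ∀ {y y'} → y ≤′ y' → dW J (replicate y J ++ W) ≤ dW J (replicate y' J ++ W)
    grow ≤′-refl         = ≤-refl
    grow (≤′-step {y} p) = ≤-trans (grow p) (colHt-grow (top-sorted b i'<k o (suc y)) (1≤τ (oddLetter i i'<k)))
    -- Depths grow along a run, so the rows known to be full at its last, leftmost column include
    -- the lowest row of every other column of the run.
    fill : ∀ {ρ : ℕ → ℕ} {D} → OnCols (Lo ρ) W → (∀ r → 1 ≤ r → r ≤ suc D → τ J ≤ ρ r) →
           ∀ y → dW J (replicate y J ++ W) ≤ D → OnCols (Lo ρ) (replicate (suc y) J ++ W)
    fill base h zero    q = (λ _ → h _ (s≤s z≤n) (s≤s q)) , base
    fill base h (suc y) q = (λ _ → h _ (s≤s z≤n) (s≤s q)) , fill base h y (≤-trans (grow {y} (≤′-step ≤′-refl)) q)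
    odds : ∀ x → (1 ≤ x → k ∸ i' ∈ shW (blk i' x o w)) → OnCols (Lo (rlW (blk i' x o w))) (blk i' x o w)
    odds zero    _    = evens o
    odds (suc x) full = fill (lo-weaken (rlW-mono (replicate (suc x) J) W) (evens o))
      (full-rows (top-sorted b i'<k o (suc x)) (subst (_∈ shW (blk i' (suc x) o w)) (sym (τ-odd i')) (full (s≤s z≤n))))
      x ≤-refl

  count-rep : ∀ a x j w → count (_≡ᵇ j) (replicate x a ++ w) ≡ (if a ≡ᵇ j then x else 0) + count (_≡ᵇ j) w
  count-rep a zero    j w with a ≡ᵇ j
  ... | true  = refl
  ... | false = refl
  count-rep a (suc x) j w with a ≡ᵇ j | count-rep a x j w
  ... | true  | e = cong suc e
  ... | false | e = e

  count-none : ∀ {j w} → All (_< j) w → count (_≡ᵇ j) w ≡ 0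
  count-none []       = refl
  count-none {j} {a ∷ w} (p ∷ ps) rewrite ≡ᵇ-false (<⇒≢ p) = count-none ps

  count-blk-odd : ∀ i x o w → All (_< i + i) w → count (_≡ᵇ suc (i + i)) (blk i x o w) ≡ x
  count-blk-odd i x o w h
    rewrite count-rep (suc (i + i)) x (suc (i + i)) (replicate o (i + i) ++ w)
          | ≡ᵇ-true {suc (i + i)} refl
          | count-rep (i + i) o (suc (i + i)) w
          | ≡ᵇ-false (<⇒≢ (n<1+n (i + i)))
          | count-none (All.map m<n⇒m<1+n h) = +-identityʳ x

  count-blk-even : ∀ i x o w → All (_< i + i) w → count (_≡ᵇ i + i) (blk i x o w) ≡ o
  count-blk-even i x o w h
    rewrite count-rep (suc (i + i)) x (i + i) (replicate o (i + i) ++ w)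
          | ≡ᵇ-false {suc (i + i)} {i + i} 1+n≢n
          | count-rep (i + i) o (i + i) w
          | ≡ᵇ-true {i + i} refl
          | count-none h = +-identityʳ o

  count-blk-other : ∀ i x o w j → suc (i + i) ≢ j → i + i ≢ j → count (_≡ᵇ j) (blk i x o w) ≡ count (_≡ᵇ j) w
  count-blk-other i x o w j p q
    rewrite count-rep (suc (i + i)) x j (replicate o (i + i) ++ w)
          | ≡ᵇ-false p
          | count-rep (i + i) o j w
          | ≡ᵇ-false q = refl

  blocks-count : ∀ {i w} → Blocks i w → ∀ j → count (_≡ᵇ j) w ≤ τ j ∸ 1
  blocks-count done j = z≤n
  blocks-count (block {i} {w} x o b o< x< _) j with suc (suc i + suc i) ≟ j | suc i + suc i ≟ j
  ... | yes refl | _ = subst₂ _≤_ (sym (count-blk-odd (suc i) x o w (blocks-< b))) (cong (_∸ 1) (sym (τ-odd (suc i)))) (∸-monoˡ-≤ 1 x<)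
  ... | no _ | yes refl = subst₂ _≤_ (sym (count-blk-even (suc i) x o w (blocks-< b))) (cong (_∸ 1) (sym (τ-even (suc i)))) (∸-monoˡ-≤ 1 o<)
  ... | no p | no q = subst (_≤ τ j ∸ 1) (sym (count-blk-other (suc i) x o w j p q)) (blocks-count b j)

  blk-injective : ∀ i {x o w x' o' w'} → All (_< i + i) w → All (_< i + i) w' →
    blk i x o w ≡ blk i x' o' w' → x ≡ x' × o ≡ o' × w ≡ w'
  blk-injective i {x} {o} {w} {x'} {o'} {w'} h h' e
    with trans (sym (count-blk-odd i x o w h)) (trans (cong (count (_≡ᵇ suc (i + i))) e) (count-blk-odd i x' o' w' h'))
       | trans (sym (count-blk-even i x o w h)) (trans (cong (count (_≡ᵇ i + i)) e) (count-blk-even i x' o' w' h'))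
  ... | refl | refl = refl , refl ,
    ++-cancelˡ (replicate o (i + i)) w w' (++-cancelˡ (replicate x (suc (i + i))) _ _ e)

  blocks-irreducible : ∀ {i w} → Blocks i w → IsIrreducible k (shW w)
  blocks-irreducible b = sorted⇒irreducible (proj₁ (blocks-sorted b)) (blocks-lo b) (blocks-count b)

  blocks-injective : ∀ {i w w'} → Blocks i w → Blocks i w' → shW w ≡ shW w' → w ≡ w'
  blocks-injective {w = w} {w'} b b' e = typed-unique (proj₂ sw) (proj₂ sw')
      (upW sw , blocks-lo b)
      (subst (λ C → Typed (rl C) w') (sym C≡) (upW sw' , blocks-lo b')) C≡
    where
    sw  = proj₁ (blocks-sorted b)
    sw' = proj₁ (blocks-sorted b')
    C≡ : colsW w ≡ colsW w'
    C≡ = good-unique (goodW sw) (goodW sw') e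

  -- From an irreducible k-shape to its word

  -- If `d < d₀`, then rows up to `d₀` would be so long by `lo₀` that the new column, being at least
  -- as tall, would have hook length more than `k` already in row `suc d`, against `hi`.
  good-dmono : ∀ {d v d₀ v₀ C} → Good k ((d , v) ∷ (d₀ , v₀) ∷ C) → v₀ ≤ v → d₀ ≤ d
  good-dmono {d} {v} {d₀} {v₀} {C} (good _ len lo hi g@(good 1≤v₀ len₀ lo₀ _ g₀)) v₀≤v = ≮⇒≥ λ d<d₀ →
    let 1≤d₀ = ≤-trans (s≤s z≤n) d<d₀ in
    <⇒≱ (s≤s (lo₀ 1≤d₀)) (≤-trans (+-monoʳ-≤ (suc (at (sh C) d₀)) v₀≤v)
      (≤-trans (+-monoˡ-≤ v (≤-trans
         (≤-reflexive (sym (at-addcol (d₀ + v₀) (sh C) d₀ len₀ 1≤d₀ (m≤m+n d₀ v₀))))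
         (decr-anti (good-decr g) (s≤s z≤n) d<d₀))) hi))

  -- As depths grow to the left, a row above the present depth is above the depth of every column to
  -- the right, so none of its cells is cut off.
  good-opened : ∀ {d v C} → Good k ((d , v) ∷ C) → Linked _≥_ (v ∷ map proj₂ C) →
    ∀ r → d < r → rl ((d , v) ∷ C) r ≡ at (sh ((d , v) ∷ C)) r
  good-opened {d} {v} {C} G@(good _ len _ _ g) l r p with r ≤? d + v
  ... | yes q rewrite rl-in {d} {v} {C} {r} p q | at-addcol (d + v) (sh C) r len (≤-trans (s≤s z≤n) p) q = cong suc (rest C G l)
    where
    rest : ∀ C → Good k ((d , v) ∷ C) → Linked _≥_ (v ∷ map proj₂ C) → rl C r ≡ at (sh C) r
    rest []              _                  _       = refl
    rest ((d₀ , v₀) ∷ C) G@(good _ _ _ _ g) (q ∷ l) = good-opened g l r (≤-<-trans (good-dmono G q) p)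
  ... | no ¬q rewrite rl-out {d} {v} {C} {r} (λ { (_ , x) → ¬q x }) | at-addcol> (d + v) (sh C) r len (≰⇒> ¬q) =
      n≤0⇒n≡0 (subst (rl C r ≤_) (at-beyond (sh C) r (≤-<-trans len (≰⇒> ¬q))) (rl≤at g r (≤-trans (s≤s z≤n) p)))

  -- How the final row lengths ρ restrict to a final segment of the columns.
  record Ext (ρ : ℕ → ℕ) (d v : ℕ) (C : List (ℕ × ℕ)) : Set where
    field
      isGood : Good k ((d , v) ∷ C)
      sorted : Linked _≥_ (v ∷ map proj₂ C)
      below  : ∀ r → rl ((d , v) ∷ C) r ≤ ρ r
      closed : ∀ r → r ≤ d → ρ r ≡ rl ((d , v) ∷ C) r
      upper  : ∀ r → d < r → ρ r + v ≤ suc k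

  good-upper : ∀ {d v C} → Good k ((d , v) ∷ C) → Linked _≥_ (v ∷ map proj₂ C) →
    ∀ r → d < r → rl ((d , v) ∷ C) r + v ≤ suc k
  good-upper {d} {v} {C} G@(good 1≤v len _ hi _) l r p = ≤-trans
    (+-monoˡ-≤ v (≤-trans (≤-reflexive (good-opened G l r p))
      (≤-trans (decr-anti (good-decr G) (s≤s z≤n) p)
        (≤-reflexive (at-addcol (d + v) (sh C) (suc d) len (s≤s z≤n)
          (≤-trans (≤-reflexive (+-comm 1 d)) (+-monoʳ-≤ d 1≤v))))))) (s≤s hi)

  ext-whole : ∀ {d v C} → Good k ((d , v) ∷ C) → Linked _≥_ (v ∷ map proj₂ C) → Ext (rl ((d , v) ∷ C)) d v C
  ext-whole G l = record
    { isGood = G ; sorted = l ; below = λ _ → ≤-refl ; closed = λ _ _ → refl ; upper = good-upper G l }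

  ext-tail : ∀ {ρ d v d₀ v₀ C} → Ext ρ d v ((d₀ , v₀) ∷ C) → Ext ρ d₀ v₀ C
  ext-tail {ρ} {d} {v} {d₀} {v₀} {C} E with Ext.isGood E | Ext.sorted E
  ... | G@(good _ _ _ _ g) | v₀≤v ∷ l = record
    { isGood = g
    ; sorted = l
    ; below  = λ r → ≤-trans (rl-mono-∷ (d , v) ((d₀ , v₀) ∷ C) r) (Ext.below E r)
    ; closed = λ r q → shorter r (≤-trans q (good-dmono G v₀≤v))
    ; upper  = λ r p → up r p
    }
    where
    shorter : ∀ r → r ≤ d → ρ r ≡ rl ((d₀ , v₀) ∷ C) r
    shorter r q = trans (Ext.closed E r q) (rl-out {d} {v} {(d₀ , v₀) ∷ C} λ { (x , _) → <⇒≱ x q })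
    up : ∀ r → d₀ < r → ρ r + v₀ ≤ suc k
    up r p with r ≤? d
    ... | yes q = subst (λ z → z + v₀ ≤ suc k) (sym (shorter r q)) (good-upper g l r p)
    ... | no ¬q = ≤-trans (+-monoʳ-≤ (ρ r) v₀≤v) (Ext.upper E r (≰⇒> ¬q))

  -- A column of height v gets 2v - 1 if its lowest row has final length `suc k` minus v, and 2v if
  -- that row stays shorter. The clause for height 0 is a default that good columns never reach.
  letter : (ℕ → ℕ) → ℕ × ℕ → ℕ
  letter ρ (d , zero)  = 0
  letter ρ (d , suc v) = if ρ (suc d) + suc v ≡ᵇ suc k then suc (v + v) else suc v + suc v

  module _ {ρ : ℕ → ℕ} (dec : Decr ρ) where

    record LetterOk (d v : ℕ) (C : List (ℕ × ℕ)) (j : ℕ) : Set where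
      field
        isLetter : Letter j
        height   : ht j ≡ v
        depth    : colHt (sh C) (τ j) ≡ d
        isUp     : Up ρ j d
        isLo     : Lo ρ j d
        oddEq    : Odd j → ρ (suc d) + v ≡ suc k
        cases    : Odd j ⊎ ρ (suc d) + v ≤ k

    ρ-pos : ∀ {d v C} → Ext ρ d v C → 1 ≤ ρ (suc d)
    ρ-pos {d} {v} {C} E with Ext.isGood E
    ... | good 1≤v _ _ _ _ = ≤-trans (≤-trans (s≤s z≤n) (≤-reflexive (sym (rl-in {d} {v} {C} ≤-refl
              (≤-trans (≤-reflexive (+-comm 1 d)) (+-monoʳ-≤ d 1≤v)))))) (Ext.below E (suc d))

    -- The point is `depth`: the threshold of the chosen letter has to cut the rows exactly at `d`.
    -- For an odd letter the lower rows are long enough because `ρ` decreases, and row `suc d` is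
    -- short by the hook bound. For an even letter the hook bound serves the lower rows, and
    -- `ρ (suc d) + v ≤ k` serves row `suc d`.
    letter-ok : ∀ {d v C} → Ext ρ d v C → LetterOk d v C (letter ρ (d , v))
    letter-ok {d} {zero} E with Ext.isGood E
    ... | good () _ _ _ _
    letter-ok {d} {suc v} {C} E with ρ (suc d) + suc v ≡ᵇ suc k in e | Ext.isGood E
    ... | true | good 1≤v len lo hi g = record
        { isLetter = s≤s z≤n , v<k'
        ; height   = ⌈odd⌉ v
        ; depth    = sym (colHt-unique (sh C) (good-decr g) (1≤τ (s≤s z≤n , v<k')) lo' hi')
        ; isUp     = λ r p → +-cancelʳ-≤ (suc v) (ρ r) (τ J) (≤-trans (Ext.upper E r p) (≤-reflexive (sym τ+v)))
        ; isLo     = λ _ → ≤-reflexive (sym ρ≡τ)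
        ; oddEq    = λ _ → ρ+v
        ; cases    = inj₁ (oddOdd v)
        }
      where
      J = suc (v + v)
      ρ+v : ρ (suc d) + suc v ≡ suc k
      ρ+v = ≡ᵇ-true⁻ e
      v<k : v < k
      v<k = ≤-pred (≤-trans (+-monoˡ-≤ (suc v) (ρ-pos E)) (≤-reflexive ρ+v))
      v<k' : ⌊ J /2⌋ < k
      v<k' = subst (_< k) (sym (⌈even⌉ v)) v<k
      τ+v : τ J + suc v ≡ suc k
      τ+v = trans (cong (τ J +_) (sym (⌈odd⌉ v))) (τ+ht-odd {J} v<k' (oddOdd v))
      ρ≡τ : ρ (suc d) ≡ τ J
      ρ≡τ = +-cancelʳ-≡ (suc v) (ρ (suc d)) (τ J) (trans ρ+v (sym τ+v))
      lo' : 1 ≤ d → τ J ≤ at (sh C) d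
      lo' p = ≤-trans (≤-reflexive (sym ρ≡τ)) (≤-trans (dec d p)
        (≤-trans (≤-reflexive (trans (Ext.closed E d ≤-refl) (rl-out {d} {suc v} {C} λ { (x , _) → n≮n d x })))
                 (rl≤at g d p)))
      hi' : at (sh C) (suc d) < τ J
      hi' = +-cancelʳ-≤ (suc v) _ _ (≤-trans (s≤s hi) (≤-reflexive (sym τ+v)))
    ... | false | G@(good 1≤v len lo hi g) = record
        { isLetter = s≤s z≤n , v<k'
        ; height   = ⌈even⌉ (suc v)
        ; depth    = sym (colHt-unique (sh C) (good-decr g) (1≤τ (s≤s z≤n , v<k')) lo' hi')
        ; isUp     = λ r p → ≤-trans (decr-anti dec (s≤s z≤n) p) ρ≤τ
        ; isLo     = λ o → contradiction o even
        ; oddEq    = λ o → contradiction o even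
        ; cases    = inj₂ ρ+v
        }
      where
      J = suc v + suc v
      ρ+v : ρ (suc d) + suc v ≤ k
      ρ+v = ≤-pred (≤∧≢⇒< (Ext.upper E (suc d) ≤-refl) λ e' → contradiction (trans (sym (≡ᵇ-true e')) e) λ ())
      v<k' : ⌊ J /2⌋ < k
      v<k' = subst (_< k) (sym (⌊even⌋ (suc v))) (≤-trans (+-monoˡ-≤ (suc v) (ρ-pos E)) ρ+v)
      even : ¬ Odd J
      even o = 1+n≢n (trans (sym o) (trans (⌈even⌉ (suc v)) (sym (⌊even⌋ (suc v)))))
      τ+v : τ J + suc v ≡ k
      τ+v = trans (cong (τ J +_) (sym (⌈even⌉ (suc v)))) (τ+ht-even {J} v<k' (trans (⌈even⌉ (suc v)) (sym (⌊even⌋ (suc v)))))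
      ρ≤τ : ρ (suc d) ≤ τ J
      ρ≤τ = +-cancelʳ-≤ (suc v) _ _ (≤-trans ρ+v (≤-reflexive (sym τ+v)))
      lo' : 1 ≤ d → τ J ≤ at (sh C) d
      lo' p = +-cancelʳ-≤ (suc v) _ _ (≤-trans (≤-reflexive τ+v) (lo p))
      d<h : suc d ≤ d + suc v
      d<h = ≤-trans (≤-reflexive (+-comm 1 d)) (+-monoʳ-≤ d (s≤s z≤n))
      hi' : at (sh C) (suc d) < τ J
      hi' = ≤-trans (≤-reflexive (trans (sym (at-addcol (d + suc v) (sh C) (suc d) len (s≤s z≤n) d<h))
                                        (sym (good-opened G (Ext.sorted E) (suc d) ≤-refl))))
                    (≤-trans (Ext.below E (suc d)) ρ≤τ)

    letter-mono : ∀ {d v d₀ v₀ C} → Ext ρ d v ((d₀ , v₀) ∷ C) → letter ρ (d₀ , v₀) ≤ letter ρ (d , v)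
    letter-mono {d} {v} {d₀} {v₀} {C} E = subst₂ _≤_ (⌊n/2⌋+⌈n/2⌉≡n j₀) (⌊n/2⌋+⌈n/2⌉≡n j) (+-mono-≤ floors
        (subst₂ _≤_ (sym L₀.height) (sym L.height) v₀≤v))
      where
      j = letter ρ (d , v)
      j₀ = letter ρ (d₀ , v₀)
      module L = LetterOk (letter-ok E)
      module L₀ = LetterOk (letter-ok (ext-tail E))
      v₀≤v : v₀ ≤ v
      v₀≤v with Ext.sorted E
      ... | q ∷ _ = q
      strict : v₀ < v → ⌊ j₀ /2⌋ ≤ ⌊ j /2⌋
      strict lt = ≤-trans (⌊n/2⌋≤⌈n/2⌉ j₀) (≤-pred (≤-trans (subst₂ _<_ (sym L₀.height) (sym L.height) lt) (ceil≤ j)))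
        where
        ceil≤ : ∀ j → ⌈ j /2⌉ ≤ suc ⌊ j /2⌋
        ceil≤ j with parity j
        ... | inj₁ e = m≤n⇒m≤1+n (≤-reflexive e)
        ... | inj₂ e = ≤-reflexive e
      same : v₀ ≡ v → ⌊ j₀ /2⌋ ≤ ⌊ j /2⌋
      same e with parity j | L₀.cases
      ... | inj₁ ev | _              = ≤-trans (⌊n/2⌋≤⌈n/2⌉ j₀) (≤-reflexive (trans L₀.height (trans e (trans (sym L.height) ev))))
      ... | inj₂ o  | inj₁ o₀ = ≤-reflexive (suc-injective (trans (sym o₀) (trans L₀.height (trans e (trans (sym L.height) o)))))
      -- This would put the letter 2v - 1 to the left of 2v. Its depth is at least as large, so its
      -- lowest row cannot be longer than that of the other column.
      ... | inj₂ o  | inj₂ small = contradiction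
              (≤-trans (≤-reflexive (sym (trans (cong (ρ (suc d) +_) e) (L.oddEq o))))
                (≤-trans (+-monoˡ-≤ v₀ (decr-anti dec (s≤s z≤n) (s≤s (good-dmono (Ext.isGood E) v₀≤v)))) small))
              (<⇒≱ (n<1+n k))
      floors : ⌊ j₀ /2⌋ ≤ ⌊ j /2⌋
      floors with m≤n⇒m<n∨m≡n v₀≤v
      ... | inj₁ lt = strict lt
      ... | inj₂ e  = same e

    wordOf : List (ℕ × ℕ) → List ℕ
    wordOf = map (letter ρ)

    colsW-wordOf : ∀ d v C → Ext ρ d v C → colsW (wordOf ((d , v) ∷ C)) ≡ (d , v) ∷ C
    colsW-wordOf d v [] E = cong (_∷ []) (cong₂ _,_ (LetterOk.depth (letter-ok E)) (LetterOk.height (letter-ok E)))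
    colsW-wordOf d v ((d₀ , v₀) ∷ C) E with colsW-wordOf d₀ v₀ C (ext-tail E)
    ... | e = cong₂ _∷_ (cong₂ _,_ (trans (cong (λ z → colHt (sh z) (τ (letter ρ (d , v)))) e) (LetterOk.depth (letter-ok E)))
                                   (LetterOk.height (letter-ok E))) e

    wordOf-sorted : ∀ d v C → Ext ρ d v C → SortedWord (wordOf ((d , v) ∷ C))
    wordOf-sorted d v [] E = [-] , LetterOk.isLetter (letter-ok E) ∷ []
    wordOf-sorted d v ((d₀ , v₀) ∷ C) E with wordOf-sorted d₀ v₀ C (ext-tail E)
    ... | l , a = (letter-mono E ∷ l) , LetterOk.isLetter (letter-ok E) ∷ a

    wordOf-lo : ∀ d v C → Ext ρ d v C → OnCols (Lo ρ) (wordOf ((d , v) ∷ C))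
    wordOf-lo d v C E = subst (Lo ρ (letter ρ (d , v))) (sym (cong proj₁ (∷-injectiveˡ (colsW-wordOf d v C E))))
                          (LetterOk.isLo (letter-ok E)) , rest C E
      where
      rest : ∀ C → Ext ρ d v C → OnCols (Lo ρ) (wordOf C)
      rest []              E = tt
      rest ((d₀ , v₀) ∷ C) E = wordOf-lo d₀ v₀ C (ext-tail E)

  -- l is the letter to the left of the word.
  data Completed : ℕ → List ℕ → Set where
    []  : ∀ {l} → Completed l []
    _∷_ : ∀ {l j w} → (Odd j → τ j ∈ shW (j ∷ w) ⊎ l ≡ j) → Completed j w → Completed l (j ∷ w)

  module _ {ρ : ℕ → ℕ} (dec : Decr ρ) where

    complete-row : ∀ {d v C} → Ext ρ d v C → ρ (suc d) ≡ rl ((d , v) ∷ C) (suc d) →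
      Odd (letter ρ (d , v)) → τ (letter ρ (d , v)) ∈ shW (wordOf dec ((d , v) ∷ C))
    complete-row {d} {v} {C} E e o = subst₂ _∈_ row (cong sh (sym (colsW-wordOf dec d v C E)))
        (at⇒∈ (sh ((d , v) ∷ C)) (suc d) (s≤s z≤n) (at-pos⇒≤length (sh ((d , v) ∷ C)) (suc d)
          (≤-trans (ρ-pos dec E) (≤-reflexive (trans (odd⇒eq {ρ} L.isUp L.isLo o) (sym row))))))
      where
      module L = LetterOk (letter-ok dec E)
      row : at (sh ((d , v) ∷ C)) (suc d) ≡ τ (letter ρ (d , v))
      row = trans (sym (good-opened (Ext.isGood E) (Ext.sorted E) (suc d) ≤-refl))
                  (trans (sym e) (odd⇒eq {ρ} L.isUp L.isLo o))

    -- If the depth grows, row `suc d₀` is closed by the next column, so it had its final length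
    -- already. If the depth stays, both columns have the same lowest row, the bound `upper` forces
    -- equal heights, and a letter depends only on depth and height.
    completed-next : ∀ {d v d₀ v₀ C} → Ext ρ d v ((d₀ , v₀) ∷ C) → Odd (letter ρ (d₀ , v₀)) →
      τ (letter ρ (d₀ , v₀)) ∈ shW (wordOf dec ((d₀ , v₀) ∷ C)) ⊎ letter ρ (d , v) ≡ letter ρ (d₀ , v₀)
    completed-next {d} {v} {d₀} {v₀} {C} E o with Ext.isGood E | Ext.sorted E
    ... | G | v₀≤v ∷ _ with d ≟ d₀
    ...   | no d≢d₀ = inj₁ (complete-row (ext-tail E) (trans (Ext.closed E (suc d₀) d₀<d)
              (rl-out {d} {v} {(d₀ , v₀) ∷ C} λ { (x , _) → <⇒≱ x d₀<d })) o)
      where d₀<d = ≤∧≢⇒< (good-dmono G v₀≤v) (d≢d₀ ∘ sym)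
    ...   | yes refl with ≤-antisym v₀≤v (+-cancelˡ-≤ (ρ (suc d)) v v₀ (≤-trans (Ext.upper E (suc d) ≤-refl)
                              (≤-reflexive (sym (LetterOk.oddEq (letter-ok dec (ext-tail E)) o)))))
    ...     | refl = inj₂ refl

    completed-tail : ∀ d v C → Ext ρ d v C → Completed (letter ρ (d , v)) (wordOf dec C)
    completed-tail d v []              E = []
    completed-tail d v ((d₀ , v₀) ∷ C) E = completed-next E ∷ completed-tail d₀ v₀ C (ext-tail E)

  -- Bounding the runs in an irreducible shape

  onCols-suffix : ∀ {P} u {w} → OnCols P (u ++ w) → OnCols P w
  onCols-suffix []      p       = p
  onCols-suffix (j ∷ u) (_ , p) = onCols-suffix u p

  onCols-rep : ∀ {P : ℕ → ℕ → Set} {j w} y → OnCols P (replicate y j ++ w) → ∀ y' → y' < y → P j (dW j (replicate y' j ++ w))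
  onCols-rep {P} {j} {w} (suc y) (p , ps) y' (s≤s q) with y' ≟ y
  ... | yes refl = p
  ... | no  y'≢y = onCols-rep {P} y ps y' (≤∧≢⇒< q y'≢y)

  count-suffix≤ : ∀ (p : ℕ × ℕ → Bool) u w → count p (colsW w) ≤ count p (colsW (u ++ w))
  count-suffix≤ p []      w = ≤-refl
  count-suffix≤ p (j ∷ u) w with p (dW j (u ++ w) , ht j)
  ... | true  = m≤n⇒m≤1+n (count-suffix≤ p u w)
  ... | false = count-suffix≤ p u w

  count-rep≥ : ∀ (p : ℕ × ℕ → Bool) j w y → (∀ y' → y' < y → p (dW j (replicate y' j ++ w) , ht j) ≡ true) →
               y ≤ count p (colsW (replicate y j ++ w))
  count-rep≥ p j w zero    h = z≤n
  count-rep≥ p j w (suc y) h rewrite h y ≤-refl = s≤s (count-rep≥ p j w y λ y' q → h y' (m<n⇒m<1+n q))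

  replicate-++ : ∀ {A : Set} m n (a : A) → replicate (m + n) a ≡ replicate m a ++ replicate n a
  replicate-++ zero    n a = refl
  replicate-++ (suc m) n a = cong (a ∷_) (replicate-++ m n a)

  split-top : ∀ {a w} → Linked _≥_ w → All (_≤ suc a) w →
    ∃ λ x → ∃ λ w' → w ≡ replicate x (suc a) ++ w' × All (_≤ a) w'
  split-top {a} {[]} l h = 0 , [] , refl , []
  split-top {a} {j ∷ w} l (p ∷ ps) with j ≟ suc a
  ... | no j≢ = 0 , j ∷ w , refl , ≤-pred (≤∧≢⇒< p j≢) ∷ All.map (λ q → ≤-trans q (≤-pred (≤∧≢⇒< p j≢))) (linked⇒All≤ l)
  ... | yes refl with split-top (Linked.tail l) ps
  ...   | x , w' , refl , h' = suc x , w' , refl , h'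

  completed-split : ∀ {l j} x {w} → Completed l (replicate x j ++ w) → j < l →
    (1 ≤ x → Odd j → τ j ∈ shW (replicate x j ++ w)) × ∃ λ l' → j ≤ l' × Completed l' w
  completed-split {l} {j} zero c p = (λ ()) , l , <⇒≤ p , c
  completed-split {l} {j} (suc x) (h ∷ c) p = first , rest x c
    where
    first : 1 ≤ suc x → Odd j → τ j ∈ shW (replicate (suc x) j ++ _)
    first _ o with h o
    ... | inj₁ m = m
    ... | inj₂ e = contradiction (sym e) (<⇒≢ p)
    rest : ∀ x {w} → Completed j (replicate x j ++ w) → ∃ λ l' → j ≤ l' × Completed l' w
    rest zero    c       = j , ≤-refl , c
    rest (suc x) (_ ∷ c) = rest x c

  sorted-suffix : ∀ u {w} → SortedWord (u ++ w) → SortedWord w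
  sorted-suffix []      sw = sw
  sorted-suffix (j ∷ u) sw = sorted-suffix u (tailW sw)

  at≤length : ∀ {w} → SortedWord w → ∀ r → 1 ≤ r → at (shW w) r ≤ length w
  at≤length {[]}    sw r p = z≤n
  at≤length {j ∷ w} sw r p with r ≤? dW j w + ht j
  ... | yes q rewrite at-addcol (dW j w + ht j) (shW w) r (lenW sw) p q = s≤s (at≤length (tailW sw) r p)
  ... | no ¬q rewrite at-addcol> (dW j w + ht j) (shW w) r (lenW sw) (≰⇒> ¬q) = z≤n

  posW : ∀ {w} → SortedWord w → OnCols (λ j d → 1 ≤ rlW w (suc d)) w
  posW {[]}    sw = tt
  posW {j ∷ w} sw@(_ , (1≤j , _) ∷ _) =
      ≤-trans (s≤s z≤n) (≤-reflexive (sym (rl-in {dW j w} {ht j} {colsW w} ≤-refl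
        (≤-trans (≤-reflexive (+-comm 1 (dW j w))) (+-monoʳ-≤ (dW j w) (1≤ht 1≤j))))))
    , onCols-map {R = λ _ → ⊤} (λ _ d _ q → ≤-trans q (rl-mono-∷ (dW j w , ht j) (colsW w) (suc d)))
        (All.universal (λ _ → tt) w) (posW (tailW sw))

  module Irr {W : List ℕ} (swW : SortedWord W) (loW : OnCols (Lo (rlW W)) W) (irr : IsIrreducible k (shW W)) where

    private
      ρ = rlW W

    -- All columns of the run contribute to one and the same intersection bounded by irreducibility,
    -- with row length `k ∸ i` and height `i` or `suc i`.
    rep-bound : ∀ i u y j w → W ≡ u ++ replicate y j ++ w → i < k → 1 ≤ ht j →
      (ht j ≡ i ⊎ ht j ≡ suc i) → (∀ y' → y' < y → ρ (suc (dW j (replicate y' j ++ w))) ≡ k ∸ i) → y < k ∸ i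
    rep-bound i u y j w e i<k 1≤h hj h = <-≤-trans (s≤s (y≤' hj)) (≤-reflexive (m+[n∸m]≡n (m<n⇒0<n∸m i<k)))
      where
      t = k ∸ i
      cnt : y ≤ steps k (shW W) t (ht j)
      cnt = ≤-trans (count-rep≥ (isStep ρ t (ht j)) j w y (λ y' q → isStep-true {ρ} 1≤h refl (h y' q)))
           (≤-trans (count-suffix≤ (isStep ρ t (ht j)) u (replicate y j ++ w))
           (≤-reflexive (trans (cong (λ z → count (isStep ρ t (ht j)) (colsW z)) (sym e))
                               (sym (steps≡count (goodW swW) t (ht j))))))
      bnd = proj₂ irr t (m<n⇒0<n∸m i<k) (m∸n≤m k i)
      y≤' : ht j ≡ i ⊎ ht j ≡ suc i → y ≤ t ∸ 1
      y≤' (inj₁ e') = ≤-trans cnt (≤-trans (≤-reflexive (cong (steps k (shW W) t) (trans e' (sym (m∸[m∸n]≡n (<⇒≤ i<k)))))) (proj₁ bnd))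
      y≤' (inj₂ e') = ≤-trans cnt (≤-trans (≤-reflexive (cong (steps k (shW W) t) (trans e'
                        (trans (cong suc (sym (m∸[m∸n]≡n (<⇒≤ i<k)))) (sym (+-∸-assoc 1 (m∸n≤m k i))))))) (proj₂ bnd))

    odd-bound : ∀ i u x w → W ≡ u ++ replicate x (suc (i + i)) ++ w → i < k → x < k ∸ i
    odd-bound i u x w e i<k = rep-bound i u x (suc (i + i)) w e i<k (s≤s z≤n) (inj₂ (⌈odd⌉ i)) λ y' q →
      trans (odd⇒eq {ρ} (onCols-rep {Up ρ} x (onCols-suffix u (subst (OnCols (Up ρ)) e (upW swW))) y' q)
                        (onCols-rep {Lo ρ} x (onCols-suffix u (subst (OnCols (Lo ρ)) e loW)) y' q) (oddOdd i)) (τ-odd i)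

    -- The first column of an even block starts a new row R; it is still open after k − i columns.
    module _ {i u o w} (e : W ≡ u ++ replicate o (suc i + suc i) ++ w) (i<k : suc i < k) (b : Blocks i w) where

      private
        J = suc i + suc i
        t = k ∸ suc i
        R = colHt (shW w) t + suc i
        τJ : τ J ≡ t
        τJ = τ-even (suc i)
        1≤t : 1 ≤ t
        1≤t = m<n⇒0<n∸m i<k

        grow : ∀ s → colHt (shW w) t ≤ colHt (shW (replicate s J ++ w)) t
        grow zero    = ≤-refl
        grow (suc s) = ≤-trans (grow s) (colHt-grow (mid-sorted b i<k (suc s)) 1≤t)

        d<R : ∀ s → at (shW (replicate s J ++ w)) R ≡ s → s < t → dW J (replicate s J ++ w) < R
        d<R s q s<t = ≰⇒> λ R≤d → <⇒≱ s<t (≤-trans (≤-reflexive (sym τJ)) (≤-trans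
          (at-colHt (shW (replicate s J ++ w)) (decrW (mid-sorted b i<k s)) (≤-trans 1≤t (≤-reflexive (sym τJ)))
            (≤-trans (s≤s z≤n) (m≤n+m (suc i) (colHt (shW w) t))) R≤d) (≤-reflexive q)))

        R≤h : ∀ s → R ≤ dW J (replicate s J ++ w) + ht J
        R≤h s = +-mono-≤ (subst (λ z → colHt (shW w) t ≤ colHt (shW (replicate s J ++ w)) z) (sym τJ) (grow s))
                         (≤-reflexive (sym (⌈even⌉ (suc i))))

        1≤R : 1 ≤ R
        1≤R = ≤-trans (s≤s z≤n) (m≤n+m (suc i) (colHt (shW w) t))

        row : ∀ s → s ≤ t → at (shW (replicate s J ++ w)) R ≡ s × s ≤ rlW (replicate s J ++ w) R
        row zero    _   = at-beyond (shW w) R (fresh b i<k) , z≤n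
        row (suc s) s<t with row s (<⇒≤ s<t)
        ... | q , q' = trans (at-addcol _ (shW (replicate s J ++ w)) R (lenW (mid-sorted b i<k (suc s))) 1≤R (R≤h s)) (cong suc q)
                     , ≤-trans (s≤s q') (≤-reflexive (sym (rl-in {dW J (replicate s J ++ w)} {ht J} {colsW (replicate s J ++ w)} (d<R s q s<t) (R≤h s))))

      even-bound : o < t
      -- If the run had `t` columns or more, the lowest rows of its first `t`, counted from the
      -- right, would lie no higher than `R`, hence have final length at least `t`. With the bound
      -- `Up` all these steps lie in rows of length exactly `t`, which is one too many.
      even-bound = ≰⇒> λ t≤o →
        let u' = u ++ replicate (o ∸ t) J
            e' : W ≡ u' ++ replicate t J ++ w
            e' = trans e (trans (cong (u ++_) (trans (cong (λ z → replicate z J ++ w) (sym (m∸n+n≡m t≤o)))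
                   (trans (cong (_++ w) (replicate-++ (o ∸ t) t J)) (++-assoc (replicate (o ∸ t) J) (replicate t J) w))))
                   (sym (++-assoc u (replicate (o ∸ t) J) (replicate t J ++ w))))
        in n≮n t (rep-bound (suc i) u' t J w e' i<k (s≤s z≤n) (inj₁ (⌈even⌉ (suc i))) λ y' q →
             ≤-antisym
               (≤-trans (onCols-rep {Up ρ} t (onCols-suffix u' (subst (OnCols (Up ρ)) e' (upW swW))) y' q _ ≤-refl) (≤-reflexive τJ))
               (≤-trans (proj₂ (row t ≤-refl))
               (≤-trans (rlW-mono u' (replicate t J ++ w) R)
               (≤-trans (≤-reflexive (cong (λ z → rlW z R) (sym e')))
                        (decr-anti (decr-rlW swW) (s≤s z≤n) (d<R y' (proj₁ (row y' (<⇒≤ q))) q))))))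

    toBlocks : ∀ i u w l → W ≡ u ++ w → i < k → All (_≤ suc (i + i)) w → suc (i + i) < l → Completed l w → Blocks i w
    toBlocks zero u w l e i<k h l> c with split-top (proj₁ (sorted-suffix u (subst SortedWord e swW))) h
    ... | zero , [] , refl , _ = done
    ... | x , j ∷ w' , refl , z≤n ∷ _ = contradiction (proj₂ (sorted-suffix (u ++ replicate x 1) (subst SortedWord
              (trans e (sym (++-assoc u (replicate x 1) (0 ∷ w')))) swW))) λ { ((() , _) ∷ _) }
    -- A completed run of the letter 1 would need a row of length `k`, but a row is no longer than
    -- the number of columns, which is less than `k`.
    ... | suc x , [] , refl , _ with ∈⇒at (proj₁ (completed-split (suc x) c l>) (s≤s z≤n) refl)
    ...   | r , 1≤r , _ , eq = contradiction
              (≤-trans (≤-reflexive (sym eq)) (≤-trans (at≤length (sorted-suffix u (subst SortedWord e swW)) r 1≤r)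
                (≤-reflexive (trans (length-++ (replicate (suc x) 1)) (trans (+-identityʳ _) (length-replicate (suc x)))))))
              (<⇒≱ (odd-bound 0 u (suc x) [] e i<k))
    toBlocks (suc i) u w l e i<k h l> c with split-top (proj₁ (sorted-suffix u (subst SortedWord e swW))) h
    ... | x , w₁ , refl , h₁ with split-top (proj₁ (sorted-suffix (u ++ replicate x (suc (suc i + suc i))) (subst SortedWord e₁ swW))) h₁
      where
      e₁ : W ≡ (u ++ replicate x (suc (suc i + suc i))) ++ w₁
      e₁ = trans e (sym (++-assoc u (replicate x (suc (suc i + suc i))) w₁))
    ... | o , w₂ , refl , h₂ with completed-split x c l>
    ... | full , l₁ , le₁ , c₁ with completed-split o c₁ le₁
    ... | _ , l₂ , le₂ , c₂ = block x o b (even-bound {u = u ++ replicate x (suc J)} e₁ i<k b) (odd-bound (suc i) u x _ e i<k)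
                               λ p → subst (_∈ shW (blk (suc i) x o w₂)) (τ-odd (suc i)) (full p (oddOdd (suc i)))
      where
      J = suc i + suc i
      e₁ : W ≡ (u ++ replicate x (suc J)) ++ replicate o J ++ w₂
      e₁ = trans e (sym (++-assoc u (replicate x (suc J)) (replicate o J ++ w₂)))
      e₂ : W ≡ ((u ++ replicate x (suc J)) ++ replicate o J) ++ w₂
      e₂ = trans e₁ (sym (++-assoc (u ++ replicate x (suc J)) (replicate o J) w₂))
      b : Blocks i w₂
      b = toBlocks i _ w₂ l₂ e₂ (<⇒≤ i<k) (All.map (λ q → ≤-trans q (≤-reflexive (+-suc i i))) h₂)
            (≤-trans (≤-reflexive (sym (suc+suc i))) le₂) c₂

    -- A larger letter has threshold at most 1. The lowest row of its column then has final length
    -- exactly 1, and irreducibility allows fewer than one such column.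
    letters≤ : ∀ m → k ≡ suc (suc m) → All (_≤ suc (m + m)) W
    letters≤ m k≡ = go [] W refl
      where
      small : ∀ u j w → W ≡ u ++ j ∷ w → j ≤ suc (m + m)
      small u j w e = ≮⇒≥ λ j> →
        let sw = sorted-suffix u (subst SortedWord e swW)
            lj = All.head (proj₂ sw)
            f≥ : suc m ≤ ⌊ j /2⌋
            f≥ = subst (_≤ ⌊ j /2⌋) (cong suc (⌊even⌋ m)) (⌊n/2⌋-mono j>)
            k∸f≤1 : k ∸ ⌊ j /2⌋ ≤ 1
            k∸f≤1 = ≤-trans (∸-monoʳ-≤ k f≥) (≤-reflexive (trans (cong (_∸ suc m) k≡) (m+n∸n≡m 1 (suc m))))
        in contradiction (rep-bound ⌊ j /2⌋ u 1 j w e (proj₂ lj) (1≤ht (proj₁ lj)) (parity j)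
             λ { zero _ → ≤-antisym (onCols-rep {Up ρ} {j} {w} 1 (onCols-suffix u (subst (OnCols (Up ρ)) e (upW swW))) 0 ≤-refl _ ≤-refl)
                            (≤-trans k∸f≤1 (onCols-rep {λ _ d → 1 ≤ ρ (suc d)} {j} {w} 1 (onCols-suffix u (subst (OnCols (λ _ d → 1 ≤ ρ (suc d))) e (posW swW))) 0 ≤-refl))
               ; (suc _) (s≤s ()) })
             (≤⇒≯ k∸f≤1)
      go : ∀ u w → W ≡ u ++ w → All (_≤ suc (m + m)) w
      go u []      e = []
      go u (j ∷ w) e = small u j w e ∷ go (u ++ j ∷ []) w (trans e (sym (++-assoc u (j ∷ []) w)))

  irreducible⇒blocks : ∀ m → k ≡ suc (suc m) → ∀ s → IsIrreducible k s → ∃ λ w → Blocks m w × shW w ≡ s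
  irreducible⇒blocks m k≡ s irr@((part , rd , cd) , _) with kshape⇒good (subst (1 ≤_) (sym k≡) (s≤s z≤n)) s part cd
  ... | C , g , refl = word C g (subst (Linked _≥_) (cs≡heights g) cd) (kshape-rows g rd) irr
    where
    m<k : m < k
    m<k = subst (m <_) (sym k≡) (m≤n⇒m≤1+n ≤-refl)
    word : ∀ C → Good k C → Linked _≥_ (map proj₂ C) → Decr (rl C) → IsIrreducible k (sh C) →
           ∃ λ w → Blocks m w × shW w ≡ sh C
    word [] _ _ _ irr = [] , Irr.toBlocks {[]} ([] , []) tt irr m [] [] (suc (suc (m + m))) refl m<k [] ≤-refl [] , refl
    -- `suc (suc (m + m))` stands for a letter to the left of the word, beyond all its letters. So
    -- the leftmost run has to be completed on its own, which holds because its row lengths are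
    -- final.
    word ((d , v) ∷ C) g l dec irr = W , I.toBlocks m [] W (suc (suc (m + m))) refl m<k (I.letters≤ m k≡) ≤-refl
        ((λ o → inj₁ (complete-row dec E refl o)) ∷ completed-tail dec d v C E) , cong sh W≡
      where
      E = ext-whole g l
      W = wordOf dec ((d , v) ∷ C)
      W≡ : colsW W ≡ (d , v) ∷ C
      W≡ = colsW-wordOf dec d v C E
      module I = Irr {W} (wordOf-sorted dec d v C E)
        (subst (λ D → OnCols (Lo (rl D)) W) (sym W≡) (wordOf-lo dec d v C E))
        (subst (λ D → IsIrreducible k (sh D)) (sym W≡) irr)

  -- Rotations: the marks of a shape for the threshold t are the row lengths below t, as residues
  -- modulo t; 0 is permanently marked, and a column with threshold t adds 1 to every mark.

  sub : ℕ → ℕ → ℕ → ℕ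
  sub t zero    y       = y
  sub t (suc z) zero    = t ∸ suc z
  sub t (suc z) (suc y) = sub t z y

  -- The residue 0 appears in a shape as a row of length `t`, full but not yet closed.
  wrap : ℕ → ℕ → ℕ
  wrap t zero    = t
  wrap t (suc y) = suc y

  wrap-pos : ∀ t {y} → 1 ≤ y → wrap t y ≡ y
  wrap-pos t (s≤s _) = refl

  sub-≤ : ∀ t {z y} → z ≤ y → sub t z y ≡ y ∸ z
  sub-≤ t z≤n     = refl
  sub-≤ t (s≤s p) = sub-≤ t p

  sub-range : ∀ {t} z y → z < t → y < t → y ≢ z → 1 ≤ sub t z y × sub t z y < t
  sub-range zero    zero    p q h = contradiction refl h
  sub-range zero    (suc y) p q h = s≤s z≤n , q
  sub-range (suc z) zero    p q h = m<n⇒0<n∸m p , ∸-monoʳ-< {o = 0} (s≤s z≤n) (<⇒≤ p)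
  sub-range (suc z) (suc y) p q h = sub-range z y (<⇒≤ p) (<⇒≤ q) (h ∘ cong suc)

  -- Going around the circle: 0 − (z + 1) = (t − 1) − z modulo t.
  sub-last : ∀ {t} z → suc z < t → sub t (suc z) 0 ≡ sub t z (t ∸ 1)
  sub-last {suc t} z (s≤s p) = sym (sub-≤ (suc t) (<⇒≤ p))

  sub-injective : ∀ {t} z {y y'} → z < t → y < t → y' < t → sub t z y ≡ sub t z y' → y ≡ y'
  sub-injective zero    p q q' e = e
  sub-injective (suc z) {zero}  {zero}   p q q' e = refl
  sub-injective (suc z) {suc y} {suc y'} p q q' e = cong suc (sub-injective z (<⇒≤ p) (<⇒≤ q) (<⇒≤ q') e)
  sub-injective {suc t} (suc z) {zero} {suc y'} p q q' e =
    contradiction (sub-injective z (<⇒≤ p) ≤-refl (<⇒≤ q') (trans (sym (sub-last z p)) e)) (λ { refl → n≮n _ q' })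
  sub-injective {suc t} (suc z) {suc y} {zero} p q q' e =
    contradiction (sub-injective z (<⇒≤ p) ≤-refl (<⇒≤ q) (trans (sym (sub-last z p)) (sym e))) (λ { refl → n≮n _ q })

  sub-surjective : ∀ {t} z y' → z < t → 1 ≤ y' → y' < t → ∃ λ y → y < t × y ≢ z × sub t z y ≡ y'
  sub-surjective zero (suc y') p q r = suc y' , r , (λ ()) , refl
  sub-surjective {suc t} (suc z) y' p q r with sub-surjective z y' (<⇒≤ p) q r
  ... | y , y<t , y≢z , e with y ≟ t
  ...   | yes refl = 0 , s≤s z≤n , (λ ()) , trans (sub-last z p) e
  ...   | no  y≢t  = suc y , s≤s (≤∧≢⇒< (≤-pred y<t) y≢t) , (y≢z ∘ suc-injective) , e

  module _ {j w} (sw : SortedWord (j ∷ w)) where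

    private
      m = dW j w + ht j ∸ length (shW w)

      ∈-replicate⁻ : ∀ m {y : ℕ} → y ∈ replicate m 1 → y ≡ 1
      ∈-replicate⁻ (suc m) (here e)  = e
      ∈-replicate⁻ (suc m) (there p) = ∈-replicate⁻ m p

    ∈-col-suc⁺ : ∀ {y} → y ∈ shW w → suc y ∈ shW (j ∷ w)
    ∈-col-suc⁺ p = ∈-++⁺ˡ (∈-map⁺ suc p)

    ∈-col-suc⁻ : ∀ {y} → 1 ≤ y → suc y ∈ shW (j ∷ w) → y ∈ shW w
    ∈-col-suc⁻ {y} 1≤y p with ∈-++⁻ (map suc (shW w)) p
    ... | inj₁ q with ∈-map⁻ suc q
    ...   | _ , q' , refl = q'
    ∈-col-suc⁻ {y} 1≤y p | inj₂ q = contradiction 1≤y (subst (λ z → ¬ 1 ≤ z) (sym (suc-injective (∈-replicate⁻ m q))) λ ())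

    ∈-col-one⁺ : length (shW w) < dW j w + ht j → 1 ∈ shW (j ∷ w)
    ∈-col-one⁺ p = ∈-++⁺ʳ (map suc (shW w)) (first m (m<n⇒0<n∸m p))
      where
      first : ∀ m → 1 ≤ m → 1 ∈ replicate m 1
      first (suc m) _ = here refl

    ∈-col-one⁻ : 1 ∈ shW (j ∷ w) → length (shW w) < dW j w + ht j
    ∈-col-one⁻ p with ∈-++⁻ (map suc (shW w)) p
    ... | inj₁ q with ∈-map⁻ suc q
    ...   | zero , q' , refl = contradiction (All.lookup (sh-pos (colsW w)) q') λ ()
    ∈-col-one⁻ p | inj₂ q = m∸n≢0⇒n<m λ e → contradiction (subst (λ z → 1 ∈ replicate z 1) e q) λ ()

    τ∈⁻ : dW j w < colHt (shW (j ∷ w)) (τ j) → τ j ∈ shW (j ∷ w)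
    τ∈⁻ p = subst (_∈ S) at≡ (at⇒∈ S (suc (dW j w)) (s≤s z≤n) (≤-trans p (colHt≤length S (τ j))))
      where
      S = shW (j ∷ w)
      at≡ : at S (suc (dW j w)) ≡ τ j
      at≡ = ≤-antisym (Inv.bounded (inv-word sw) _ ≤-refl)
              (at-colHt S (decrW sw) (1≤τ (All.head (proj₂ sw))) (s≤s z≤n) p)

  module _ {j w} (sorted : ∀ z → SortedWord (replicate z j ++ w))
           (isFresh : length (shW w) < colHt (shW w) (τ j) + ht j) where

    private
      t = τ j
      S : ℕ → List ℕ
      S z = shW (replicate z j ++ w)

      -- Closing a row of length `t` lifts the next column, which thereby reaches beyond the top
      -- row: the residue 0 becomes 1. For `z = 0` a row is opened unconditionally, by `isFresh`.
      new⁺ : ∀ z → 1 ≤ z → t ∈ S z → 1 ∈ S (suc z)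
      new⁺ (suc z) _ m = ∈-col-one⁺ (sorted (suc (suc z)))
        (subst (_< colHt (S (suc z)) t + ht j) (sym (length-shW (sorted (suc z)))) (+-monoˡ-< (ht j) (full-grow (sorted (suc z)) m)))

      new⁻ : ∀ z → 1 ≤ z → 1 ∈ S (suc z) → t ∈ S z
      new⁻ (suc z) _ m = τ∈⁻ (sorted (suc z)) (+-cancelʳ-< (ht j) _ _
        (subst (_< colHt (S (suc z)) t + ht j) (length-shW (sorted (suc z))) (∈-col-one⁻ (sorted (suc (suc z))) m)))

      suc-pred-t : ∀ {z} → suc z < t → suc (t ∸ 1) ≡ t
      suc-pred-t p = m+[n∸m]≡n (≤-trans (s≤s z≤n) p)

      1≤pred : ∀ {z} → suc z < t → 1 ≤ t ∸ 1
      1≤pred p = ≤-trans (s≤s z≤n) (∸-monoˡ-≤ 1 p)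

      pred≢ : ∀ {z} → suc z < t → t ∸ 1 ≢ z
      pred≢ p e = <⇒≢ p (trans (cong suc (sym e)) (suc-pred-t p))

    -- Follows the row opened by the first column of the run, the permanent residue 0 carried along.
    self∈ : ∀ z → 1 ≤ z → z ∈ S z
    self∈ (suc zero)    _ = ∈-col-one⁺ (sorted 1) isFresh
    self∈ (suc (suc z)) _ = ∈-col-suc⁺ (sorted (suc (suc z))) (self∈ (suc z) (s≤s z≤n))

    -- Takes the columns off one at a time: a length from 2 to `t` comes from the length one less,
    -- and the length 1 from a row of length `t`. The residue `y = z` is excluded because it is
    -- there whatever `w` is.
    rotate⁺ : ∀ z y → z < t → y < t → y ≢ z → sub t z y ∈ shW w → wrap t y ∈ S z
    rotate⁺ zero zero p q h m = contradiction refl h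
    rotate⁺ zero (suc y) p q h m = m
    rotate⁺ (suc z) (suc (suc y)) p q h m =
      ∈-col-suc⁺ (sorted (suc z)) (rotate⁺ z (suc y) (<⇒≤ p) (<⇒≤ q) (h ∘ cong suc) m)
    rotate⁺ (suc zero) (suc zero) p q h m = contradiction refl h
    rotate⁺ (suc (suc z)) (suc zero) p q h m = new⁺ (suc z) (s≤s z≤n) (rotate⁺ (suc z) 0 (<⇒≤ p) (<⇒≤ q) (λ ()) m)
    rotate⁺ (suc z) zero p q h m = subst (_∈ S (suc z)) (suc-pred-t p) (∈-col-suc⁺ (sorted (suc z))
      (subst (_∈ S z) (wrap-pos t (1≤pred p)) (rotate⁺ z (t ∸ 1) (<⇒≤ p) (≤-reflexive (suc-pred-t p)) (pred≢ p)
        (subst (_∈ shW w) (sub-last z p) m))))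

    rotate⁻ : ∀ z y → z < t → y < t → y ≢ z → wrap t y ∈ S z → sub t z y ∈ shW w
    rotate⁻ zero zero p q h m = contradiction refl h
    rotate⁻ zero (suc y) p q h m = m
    rotate⁻ (suc z) (suc (suc y)) p q h m =
      rotate⁻ z (suc y) (<⇒≤ p) (<⇒≤ q) (h ∘ cong suc) (∈-col-suc⁻ (sorted (suc z)) (s≤s z≤n) m)
    rotate⁻ (suc zero) (suc zero) p q h m = contradiction refl h
    rotate⁻ (suc (suc z)) (suc zero) p q h m = rotate⁻ (suc z) 0 (<⇒≤ p) (<⇒≤ q) (λ ()) (new⁻ (suc z) (s≤s z≤n) m)
    rotate⁻ (suc z) zero p q h m = subst (_∈ shW w) (sym (sub-last z p))
      (rotate⁻ z (t ∸ 1) (<⇒≤ p) (≤-reflexive (suc-pred-t p)) (pred≢ p) (subst (_∈ S z) (sym (wrap-pos t (1≤pred p)))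
        (∈-col-suc⁻ (sorted (suc z)) (1≤pred p) (subst (_∈ S (suc z)) (sym (suc-pred-t p)) m))))

  -- Rotations acting on lists of residues

  record Rotation (t z : ℕ) (s s' : List ℕ) : Set where
    field
      z<t  : z < t
      self : 1 ≤ z → z ∈ s'
      fwd  : ∀ y → y < t → y ≢ z → sub t z y ∈ s → wrap t y ∈ s'
      bwd  : ∀ y → y < t → y ≢ z → wrap t y ∈ s' → sub t z y ∈ s

  rotation : ∀ {j w t} → τ j ≡ t → (∀ z → SortedWord (replicate z j ++ w)) →
    length (shW w) < colHt (shW w) t + ht j → ∀ z → z < t → Rotation t z (shW w) (shW (replicate z j ++ w))
  rotation refl sorted fr z p = record
    { z<t = p ; self = self∈ sorted fr z ; fwd = λ y → rotate⁺ sorted fr z y p ; bwd = λ y → rotate⁻ sorted fr z y p }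

  -- Undoes a run of columns. The selected residue is the place reached by the permanent 0, so it is
  -- also the length of the run; the others are turned back by as much.
  rotDel : ℕ → ℕ → List ℕ → List ℕ
  rotDel t a V = map (sub t (nth a V)) (del a V)

  record Pool (t : ℕ) (V : List ℕ) : Set where
    field
      small  : All (_< t) V
      unique : Unique V

  record Residues (t : ℕ) (N : List ℕ) : Set where
    field
      inRange : All (λ y → 1 ≤ y × y < t) N
      unique  : Unique N

    0∉ : 0 ∉ N
    0∉ m = contradiction (proj₁ (All.lookup inRange m)) λ ()

    bound : ∀ {y} → y ∈ N → y < t
    bound m = proj₂ (All.lookup inRange m)

  SameMarks : ℕ → List ℕ → List ℕ → Set
  SameMarks t N s = ∀ y → 1 ≤ y → y < t → (y ∈ N → y ∈ s) × (y ∈ s → y ∈ N)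

  SameWrapped : ℕ → ℕ → List ℕ → List ℕ → Set
  SameWrapped t z V s = ∀ y → y < t → y ≢ z → (y ∈ V → wrap t y ∈ s) × (wrap t y ∈ s → y ∈ V)

  module _ {t a V} (pool : Pool t V) (a< : a < length V) where

    open Pool pool

    private
      z = nth a V
      z<t : z < t
      z<t = All.lookup small (nth-∈ a V a<)

      del≢ : ∀ {y} → y ∈ del a V → y ≢ z
      del≢ m refl = nth∉del a V unique a< m

      del< : ∀ {y} → y ∈ del a V → y < t
      del< m = All.lookup small (∈-del⁻ a V m)

    residues-rotDel : Residues t (rotDel t a V)
    residues-rotDel = record
      { inRange = All.tabulate ranged
      ; unique  = unique-map (del a V) (λ m → m) (unique-del a V unique)
      }
      where
      ranged : ∀ {y} → y ∈ rotDel t a V → 1 ≤ y × y < t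
      ranged m with ∈-map⁻ (sub t z) m
      ... | y , m' , refl = sub-range z y z<t (del< m') (del≢ m')
      unique-map : ∀ xs → (∀ {y} → y ∈ xs → y ∈ del a V) → Unique xs → Unique (map (sub t z) xs)
      unique-map []       _ []      = []
      unique-map (x ∷ xs) h (p ∷ u) = ∉-All (map (sub t z) xs) notIn ∷ unique-map xs (h ∘ there) u
        where
        notIn : sub t z x ∉ map (sub t z) xs
        notIn m with ∈-map⁻ (sub t z) m
        ... | y , m' , e with sub-injective z z<t (del< (h (here refl))) (del< (h (there m'))) e
        ...   | refl = All-∉ p m'

    length-rotDel : length (rotDel t a V) ≡ length V ∸ 1
    length-rotDel = trans (length-map (sub t z) (del a V)) (cong (_∸ 1) (length-del a V a<))

    module _ {s s'} (rot : Rotation t (nth a V) s s') where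

      open Rotation rot using (self; fwd; bwd)

      same⇒wrapped : SameMarks t (rotDel t a V) s → SameWrapped t (nth a V) V s'
      same⇒wrapped nm y y<t y≢z = to , from
        where
        r = sub-range z y z<t y<t y≢z
        to : y ∈ V → wrap t y ∈ s'
        to m = fwd y y<t y≢z (proj₁ (nm _ (proj₁ r) (proj₂ r)) (∈-map⁺ (sub t z) (∈-del a V y≢z m)))
        from : wrap t y ∈ s' → y ∈ V
        from m with ∈-map⁻ (sub t z) (proj₂ (nm _ (proj₁ r) (proj₂ r)) (bwd y y<t y≢z m))
        ... | y' , m' , e with sub-injective z z<t y<t (del< m') e
        ...   | refl = ∈-del⁻ a V m'

      wrapped⇒same : SameWrapped t (nth a V) V s' → SameMarks t (rotDel t a V) s
      wrapped⇒same vm y' 1≤y' y'<t = to , from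
        where
        to : y' ∈ rotDel t a V → y' ∈ s
        to m with ∈-map⁻ (sub t z) m
        ... | y , m' , refl = bwd y (del< m') (del≢ m') (proj₁ (vm y (del< m') (del≢ m')) (∈-del⁻ a V m'))
        from : y' ∈ s → y' ∈ rotDel t a V
        from m with sub-surjective z y' z<t 1≤y' y'<t
        ... | y , y<t , y≢z , refl = ∈-map⁺ (sub t z) (∈-del a V y≢z (proj₂ (vm y y<t y≢z) (fwd y y<t y≢z m)))

      wrapped⇒same' : SameWrapped t (nth a V) V s' → SameMarks t V s'
      wrapped⇒same' vm y 1≤y y<t with y ≟ z
      ... | yes refl = (λ _ → self 1≤y) , (λ _ → nth-∈ a V a<)
      ... | no  y≢z  = (λ m → subst (_∈ s') (wrap-pos t 1≤y) (proj₁ (vm y y<t y≢z) m))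
                     , (λ m → proj₂ (vm y y<t y≢z) (subst (_∈ s') (sym (wrap-pos t 1≤y)) m))

  same⇒wrapped' : ∀ {t z V s} → SameMarks t V s → (0 ≢ z → (0 ∈ V → t ∈ s) × (t ∈ s → 0 ∈ V)) → SameWrapped t z V s
  same⇒wrapped' nm h zero    y<t y≢z = h y≢z
  same⇒wrapped' nm h (suc y) y<t y≢z = nm (suc y) (s≤s z≤n) y<t

  -- The residues modulo `t` at the end of a stage, where `N` holds those modulo `t ∸ 1`. The bit
  -- restores `t ∸ 1`, lost by merging with 0. The residue 0 is always there: as the permanent one
  -- if the odd run is empty, and otherwise by the condition in `Blocks`. Its place at the head
  -- makes position 0 select the empty run.
  poolA : ℕ → List ℕ → Bool → List ℕ
  poolA t N e = if e then 0 ∷ (t ∸ 1) ∷ N else 0 ∷ N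

  -- The residues in the middle of a stage. The odd columns hide whether a row of length `t` was
  -- present before them; a false bit says that the residue 0 was.
  poolB : List ℕ → Bool → List ℕ
  poolB N g = if g then N else 0 ∷ N

  poolA-ok : ∀ {t N} → 2 ≤ t → Residues (t ∸ 1) N → ∀ e → Pool t (poolA t N e)
  poolA-ok {t} {N} 2≤t res true = record
    { small  = ≤-trans (s≤s z≤n) 2≤t ∷ ≤-reflexive (m+[n∸m]≡n 1≤t) ∷ All.map (λ p → <-≤-trans (proj₂ p) (m∸n≤m t 1)) inRange
    ; unique = ((λ e → <⇒≢ (∸-monoˡ-≤ 1 2≤t) e) ∷ ∉-All N 0∉) ∷ ∉-All N (λ m → n≮n _ (bound m)) ∷ unique
    }
    where
    open Residues res
    1≤t = ≤-trans (s≤s z≤n) 2≤t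
  poolA-ok {t} {N} 2≤t res false = record
    { small  = ≤-trans (s≤s z≤n) 2≤t ∷ All.map (λ p → <-≤-trans (proj₂ p) (m∸n≤m t 1)) inRange
    ; unique = ∉-All N 0∉ ∷ unique
    }
    where open Residues res

  length-poolA : ∀ t N e → length (poolA t N e) ≡ suc (if e then suc (length N) else length N)
  length-poolA t N true  = refl
  length-poolA t N false = refl

  poolB-ok : ∀ {t N} → 1 ≤ t → Residues t N → ∀ g → Pool t (poolB N g)
  poolB-ok 1≤t res true  = record { small = All.map proj₂ (Residues.inRange res) ; unique = Residues.unique res }
  poolB-ok {N = N} 1≤t res false = record
    { small = 1≤t ∷ All.map proj₂ (Residues.inRange res) ; unique = ∉-All N (Residues.0∉ res) ∷ Residues.unique res }

  length-poolB : ∀ N g → length (poolB N g) ≡ (if g then length N else suc (length N))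
  length-poolB N true  = refl
  length-poolB N false = refl

  nth0 : ∀ t N e → nth 0 (poolA t N e) ≡ 0
  nth0 t N true  = refl
  nth0 t N false = refl

  pred-if : ∀ g m → (if g then m else suc m) ∸ 1 ≡ (if g then m ∸ 1 else m)
  pred-if true  m = refl
  pred-if false m = refl

  same-poolB : ∀ {t N s} g → SameMarks t (poolB N g) s → SameMarks t N s
  same-poolB true  h = h
  same-poolB false h y 1≤y y<t = (λ m → proj₁ (h y 1≤y y<t) (there m)) , λ m → strip (proj₂ (h y 1≤y y<t) m)
    where
    strip : y ∈ 0 ∷ _ → y ∈ _
    strip (here refl) = contradiction 1≤y λ ()
    strip (there m)   = m

  -- `N` lists the marks for the threshold `k ∸ suc i` of the following stage. The positions select
  -- run lengths: `a` for the odd columns and `b` for the even ones.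
  decC : ℕ → List ℕ → List Step → List ℕ
  decC i N [] = []
  decC i N ((e , a , g , b) ∷ c) =
    let t = k ∸ i
        T = poolA t N e
        V = poolB (rotDel t a T) g
    in blk i (nth a T) (nth b V) (decC (i ∸ 1) (rotDel t b V) c)

  -- Decoding shapes: soundness, injectivity, completeness

  module _ {i w} (bl : Blocks i w) (i<k : suc i < k) where

    rotB : ∀ o → o < k ∸ suc i → Rotation (k ∸ suc i) o (shW w) (shW (replicate o (suc i + suc i) ++ w))
    rotB = rotation (τ-even (suc i)) (mid-sorted bl i<k)
      (subst (λ z → length (shW w) < colHt (shW w) (k ∸ suc i) + z) (sym (⌈even⌉ (suc i))) (fresh bl i<k))

    rotA : ∀ o x → x < k ∸ suc i →
      Rotation (k ∸ suc i) x (shW (replicate o (suc i + suc i) ++ w)) (shW (blk (suc i) x o w))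
    rotA o = rotation (τ-odd (suc i)) (top-sorted bl i<k o)
      (subst (λ z → length (shW W) < colHt (shW W) (k ∸ suc i) + z) (sym (⌈odd⌉ (suc i)))
        (≤-trans (s≤s (mid-len bl i<k o)) (≤-reflexive (sym (+-suc _ (suc i))))))
      where W = replicate o (suc i + suc i) ++ w

  module StepC (i : ℕ) (N : List ℕ) (s : Step) (c : List Step) where

    e = proj₁ s
    a = proj₁ (proj₂ s)
    g = proj₁ (proj₂ (proj₂ s))
    b = proj₂ (proj₂ (proj₂ s))
    t = k ∸ suc i
    T = poolA t N e
    x = nth a T
    N' = rotDel t a T
    V = poolB N' g
    o = nth b V
    S = rotDel t b V
    w = decC i S c
    sB = shW (replicate o (suc i + suc i) ++ w)
    sA = shW (blk (suc i) x o w)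

  record SoundC (i : ℕ) (N : List ℕ) (s : Step) (c : List Step) : Set where
    open StepC i N s c
    field
      poolT  : Pool t T
      a<     : a < length T
      poolV  : Pool t V
      b<     : b < length V
      resN'  : Residues t N'
      resS   : Residues t S
      okS    : Ok i (length S) c
      bl     : Blocks i w
      wrapV  : SameWrapped t o V sB
      wrapT  : SameWrapped t x T sA
      markT  : SameMarks t T sA

  k∸suc : ∀ m → k ∸ suc m ≡ (k ∸ m) ∸ 1
  k∸suc m = trans (cong (k ∸_) (+-comm 1 m)) (sym (∸-+-assoc k m 1))

  2≤k∸ : ∀ {m} → suc m < k → 2 ≤ k ∸ m
  2≤k∸ {m} p = subst (_≤ k ∸ m) (m+n∸n≡m 2 m) (∸-monoˡ-≤ m p)

  soundC : ∀ i {N} c → suc i < k → Residues (k ∸ suc i) N → Ok i (length N) c →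
           Blocks i (decC i N c) × SameMarks (k ∸ suc i) N (shW (decC i N c))

  soundStepC : ∀ i {N} s c → suc (suc i) < k → Residues (k ∸ suc (suc i)) N → Ok (suc i) (length N) (s ∷ c) → SoundC i N s c
  soundStepC i {N} s@(e , a , g , b) c i<k res (a<' , b<' , ok) = record
    { poolT = poolT ; a< = a< ; poolV = poolV ; b< = b< ; resN' = resN' ; resS = resS ; okS = okS
    ; bl = proj₁ rec ; wrapV = wrapV ; wrapT = wrapT
    ; markT = wrapped⇒same' poolT a< rA wrapT }
    where
    open StepC i N s c using (t; T; x; N'; V; o; S; w; sB; sA)
    2≤t : 2 ≤ t
    2≤t = 2≤k∸ i<k
    poolT : Pool t T
    poolT = poolA-ok 2≤t (subst (λ z → Residues z N) (k∸suc (suc i)) res) e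
    a< : a < length T
    a< = subst (a <_) (sym (length-poolA t N e)) a<'
    resN' : Residues t N'
    resN' = residues-rotDel poolT a<
    m' = if e then suc (length N) else length N
    lenN' : length N' ≡ m'
    lenN' = trans (length-rotDel poolT a<) (cong (_∸ 1) (length-poolA t N e))
    poolV : Pool t V
    poolV = poolB-ok (≤-trans (s≤s z≤n) 2≤t) resN' g
    lenV : length V ≡ (if g then m' else suc m')
    lenV = trans (length-poolB N' g) (cong (λ z → if g then z else suc z) lenN')
    b< : b < length V
    b< = subst (b <_) (sym lenV) b<'
    resS : Residues t S
    resS = residues-rotDel poolV b<
    okS : Ok i (length S) c
    okS = subst (λ z → Ok i z c) (sym (trans (length-rotDel poolV b<) (trans (cong (_∸ 1) lenV) (pred-if g m')))) ok
    rec = soundC i c (<⇒≤ i<k) resS okS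
    rB : Rotation t o (shW w) sB
    rB = rotB (proj₁ rec) (<⇒≤ i<k) o (All.lookup (Pool.small poolV) (nth-∈ b V b<))
    rA : Rotation t x sB sA
    rA = rotA (proj₁ rec) (<⇒≤ i<k) o x (All.lookup (Pool.small poolT) (nth-∈ a T a<))
    wrapV : SameWrapped t o V sB
    wrapV = same⇒wrapped poolV b< rB (proj₂ rec)
    markN' : SameMarks t N' sB
    markN' = same-poolB g (wrapped⇒same' poolV b< rB wrapV)
    wrapT : SameWrapped t x T sA
    wrapT = same⇒wrapped poolT a< rA markN'

  ∈-poolA : ∀ t {N y} e → y ∈ N → y ∈ poolA t N e
  ∈-poolA t true  m = there (there m)
  ∈-poolA t false m = there m

  ∈-poolA⁻ : ∀ t {N y} e → 1 ≤ y → y ≢ t ∸ 1 → y ∈ poolA t N e → y ∈ N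
  ∈-poolA⁻ t true  1≤y h (here refl)      = contradiction 1≤y λ ()
  ∈-poolA⁻ t true  1≤y h (there (here e)) = contradiction e h
  ∈-poolA⁻ t true  1≤y h (there (there m)) = m
  ∈-poolA⁻ t false 1≤y h (here refl)      = contradiction 1≤y λ ()
  ∈-poolA⁻ t false 1≤y h (there m)        = m

  0∈poolA : ∀ t N e → 0 ∈ poolA t N e
  0∈poolA t N true  = here refl
  0∈poolA t N false = here refl

  soundC zero [] i<k res ok = done , λ y _ _ → (λ m → contradiction m (length-0⇒∉ ok)) , λ ()
  soundC (suc i) {N} (s ∷ c) i<k res ok = block x o bl o<t x<t full , mark
    where
    open StepC i N s c
    open SoundC (soundStepC i s c i<k res ok)
    o<t : o < t
    o<t = All.lookup (Pool.small poolV) (nth-∈ b V b<)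
    x<t : x < t
    x<t = All.lookup (Pool.small poolT) (nth-∈ a T a<)
    -- The residue 0 belongs to the pool and differs from `x`, so it must show as a row of length
    -- `t`.
    full : 1 ≤ x → t ∈ sA
    full p = proj₁ (wrapT 0 (≤-trans (s≤s z≤n) x<t) (<⇒≢ p)) (0∈poolA t N e)
    mark : SameMarks (k ∸ suc (suc i)) N sA
    mark y 1≤y y< = (λ m → proj₁ (markT y 1≤y y<t) (∈-poolA t e m)) , (λ m → ∈-poolA⁻ t e 1≤y (<⇒≢ y<') (proj₂ (markT y 1≤y y<t) m))
      where
      y<' : y < t ∸ 1
      y<' = subst (y <_) (k∸suc (suc i)) y<
      y<t : y < t
      y<t = <-≤-trans y<' (m∸n≤m t 1)

  last∈poolA : ∀ {t N} → 2 ≤ t → Residues (t ∸ 1) N → ∀ e → t ∸ 1 ∈ poolA t N e → e ≡ true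
  last∈poolA 2≤t res true  m           = refl
  last∈poolA 2≤t res false (here e)    = contradiction (sym e) (<⇒≢ (∸-monoˡ-≤ 1 2≤t))
  last∈poolA 2≤t res false (there m)   = contradiction (Residues.bound res m) (n≮n _)

  ∈last-poolA : ∀ t {N} e → e ≡ true → t ∸ 1 ∈ poolA t N e
  ∈last-poolA t true refl = there (here refl)

  0∈poolB : ∀ {t N} → Residues t N → ∀ g → 0 ∈ poolB N g → g ≡ false
  0∈poolB res true  m = contradiction m (Residues.0∉ res)
  0∈poolB res false m = refl

  ∈0-poolB : ∀ {N} g → g ≡ false → 0 ∈ poolB N g
  ∈0-poolB false refl = here refl

  -- The word gives the run lengths, and with them all intermediate shapes. The bits are read off
  -- from the rows of length `t ∸ 1` after the stage and of length `t` in its middle; then the run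
  -- lengths determine the positions in the pools.
  decC-injective : ∀ i {N} c c' → suc i < k → Residues (k ∸ suc i) N → Ok i (length N) c → Ok i (length N) c' →
                   decC i N c ≡ decC i N c' → c ≡ c'
  decC-injective zero [] [] _ _ _ _ _ = refl
  decC-injective (suc i) {N} (s ∷ c) (s' ∷ c') i<k res ok ok' eq =
      cong₂ _∷_ (cong₂ _,_ e≡ (cong₂ _,_ a≡ (cong₂ _,_ g≡ b≡))) c≡
    where
    module P  = StepC i N s c
    module P' = StepC i N s' c'
    module Q  = SoundC (soundStepC i s c i<k res ok)
    module Q' = SoundC (soundStepC i s' c' i<k res ok')
    t = k ∸ suc i
    2≤t : 2 ≤ t
    2≤t = 2≤k∸ i<k
    res' = subst (λ z → Residues z N) (k∸suc (suc i)) res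
    inj = blk-injective (suc i) (blocks-< Q.bl) (blocks-< Q'.bl) eq
    x≡ = proj₁ inj
    o≡ = proj₁ (proj₂ inj)
    w≡ = proj₂ (proj₂ inj)
    1≤t-1 : 1 ≤ t ∸ 1
    1≤t-1 = ∸-monoˡ-≤ 1 2≤t
    t-1<t : t ∸ 1 < t
    t-1<t = ≤-reflexive (m+[n∸m]≡n (≤-trans (s≤s z≤n) 2≤t))
    e≡ : P.e ≡ P'.e
    e≡ = bool-ext
      (λ h → last∈poolA 2≤t res' P'.e (proj₂ (Q'.markT _ 1≤t-1 t-1<t) (subst (λ z → t ∸ 1 ∈ shW z) eq (proj₁ (Q.markT _ 1≤t-1 t-1<t) (∈last-poolA t P.e h)))))
      (λ h → last∈poolA 2≤t res' P.e (proj₂ (Q.markT _ 1≤t-1 t-1<t) (subst (λ z → t ∸ 1 ∈ shW z) (sym eq) (proj₁ (Q'.markT _ 1≤t-1 t-1<t) (∈last-poolA t P'.e h)))))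
    sB≡ : P.sB ≡ P'.sB
    sB≡ = cong₂ (λ o w → shW (replicate o (suc i + suc i) ++ w)) o≡ w≡
    -- For an empty even run the rows of length `t` say nothing about 0, but then 0 is the selected
    -- residue and so lies in the pool.
    move0 : ∀ {V V' o o' s s'} → o ≡ o' → s ≡ s' → SameWrapped t o V s → SameWrapped t o' V' s' → o' ∈ V' → 0 ∈ V → 0 ∈ V'
    move0 {o = zero}  refl refl vm vm' m _  = m
    move0 {o = suc o} refl refl vm vm' _ m0 = proj₂ (vm' 0 (≤-trans (s≤s z≤n) 2≤t) λ ()) (proj₁ (vm 0 (≤-trans (s≤s z≤n) 2≤t) λ ()) m0)
    g≡ : P.g ≡ P'.g
    g≡ = bool-ext-false
      (λ h → 0∈poolB Q'.resN' P'.g (move0 o≡ sB≡ Q.wrapV Q'.wrapV (nth-∈ P'.b P'.V Q'.b<) (∈0-poolB P.g h)))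
      (λ h → 0∈poolB Q.resN' P.g (move0 (sym o≡) (sym sB≡) Q'.wrapV Q.wrapV (nth-∈ P.b P.V Q.b<) (∈0-poolB P'.g h)))
    a≡ : P.a ≡ P'.a
    a≡ = same-a P.a P'.a e≡ Q.poolT Q.a< Q'.a< x≡
      where
      same-a : ∀ {e e'} a a' → e ≡ e' → Pool t (poolA t N e) → a < length (poolA t N e) → a' < length (poolA t N e') →
               nth a (poolA t N e) ≡ nth a' (poolA t N e') → a ≡ a'
      same-a a a' refl pool p q h = nth-injective a a' _ (Pool.unique pool) p q h
    N'≡ : P.N' ≡ P'.N'
    N'≡ = cong₂ (λ e a → rotDel t a (poolA t N e)) e≡ a≡
    b≡ : P.b ≡ P'.b
    b≡ = same-b P.b P'.b N'≡ g≡ Q.poolV Q.b< Q'.b< o≡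
      where
      same-b : ∀ {M M' g g'} b b' → M ≡ M' → g ≡ g' → Pool t (poolB M g) → b < length (poolB M g) →
               b' < length (poolB M' g') → nth b (poolB M g) ≡ nth b' (poolB M' g') → b ≡ b'
      same-b b b' refl refl pool p q h = nth-injective b b' _ (Pool.unique pool) p q h
    S≡ : P.S ≡ P'.S
    S≡ = cong₂ (rotDel t) b≡ (cong₂ poolB N'≡ g≡)
    c≡ : c ≡ c'
    c≡ = decC-injective i c c' (<⇒≤ i<k) Q.resS Q.okS (subst (λ S → Ok i (length S) c') (sym S≡) Q'.okS)
           (trans w≡ (cong (λ S → decC i S c') (sym S≡)))

  completeC : ∀ {i w} N → suc i < k → Blocks i w → Residues (k ∸ suc i) N → SameMarks (k ∸ suc i) N (shW w) →
              ∃ λ c → Ok i (length N) c × decC i N c ≡ w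
  completeC []      i<k done res nm = [] , refl , refl
  completeC (y ∷ N) i<k done res nm = contradiction (proj₁ (nm y (proj₁ r) (proj₂ r)) (here refl)) λ ()
    where r = All.head (Residues.inRange res)
  completeC {suc i} N i<k (block {w = w} x o bl o< x< full) res nm = (e , a , g , b) ∷ proj₁ rec , (ok-a , ok-b , ok-c) , dec≡
    where
    t = k ∸ suc i
    2≤t : 2 ≤ t
    2≤t = 2≤k∸ i<k
    1≤t-1 : 1 ≤ t ∸ 1
    1≤t-1 = ∸-monoˡ-≤ 1 2≤t
    t-1<t : t ∸ 1 < t
    t-1<t = ≤-reflexive (m+[n∸m]≡n (≤-trans (s≤s z≤n) 2≤t))
    res' = subst (λ z → Residues z N) (k∸suc (suc i)) res
    sB = shW (replicate o (suc i + suc i) ++ w)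
    sA = shW (blk (suc i) x o w)
    rB : Rotation t o (shW w) sB
    rB = rotB bl (<⇒≤ i<k) o o<
    rA : Rotation t x sB sA
    rA = rotA bl (<⇒≤ i<k) o x x<
    pickE : ∃ λ e → (t ∸ 1 ∈ poolA t N e → t ∸ 1 ∈ sA) × (t ∸ 1 ∈ sA → t ∸ 1 ∈ poolA t N e)
    pickE with t ∸ 1 ∈? sA
    ... | yes m = true , (λ _ → m) , (λ _ → there (here refl))
    ... | no ¬m = false , (λ m → contradiction (last∈poolA 2≤t res' false m) λ ()) , (λ m → contradiction m ¬m)
    e = proj₁ pickE
    T = poolA t N e
    markT : SameMarks t T sA
    markT y 1≤y y<t with y ≟ t ∸ 1
    ... | yes refl = proj₂ pickE
    ... | no  y≢   = (λ m → proj₁ (nm y 1≤y y<') (∈-poolA⁻ t e 1≤y y≢ m)) , (λ m → ∈-poolA t e (proj₂ (nm y 1≤y y<') m))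
      where
      y<' : y < k ∸ suc (suc i)
      y<' = subst (y <_) (sym (k∸suc (suc i))) (≤∧≢⇒< (∸-monoˡ-≤ 1 y<t) y≢)
    member : ∀ {z V s s'} → (z ≡ 0 → 0 ∈ V) → SameMarks t V s' → Rotation t z s s' → z ∈ V
    member {zero}  h nm rot = h refl
    member {suc z} h nm rot = proj₂ (nm (suc z) (s≤s z≤n) (Rotation.z<t rot)) (Rotation.self rot (s≤s z≤n))
    wrapT : SameWrapped t x T sA
    wrapT = same⇒wrapped' markT λ x≢0 → (λ _ → full (n≢0⇒n>0 (x≢0 ∘ sym))) , (λ _ → 0∈poolA t N e)
    iA = ∈⇒nth (member {V = T} (λ _ → 0∈poolA t N e) markT rA)
    a = proj₁ iA
    a< = proj₁ (proj₂ iA)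
    x≡ : nth a T ≡ x
    x≡ = proj₂ (proj₂ iA)
    poolT = poolA-ok 2≤t res' e
    N' = rotDel t a T
    resN' = residues-rotDel poolT a<
    markN' : SameMarks t N' sB
    markN' = wrapped⇒same poolT a< (subst (λ z → Rotation t z sB sA) (sym x≡) rA)
               (subst (λ z → SameWrapped t z T sA) (sym x≡) wrapT)
    -- If `o = 0`, the pool must contain 0 to select it, whether or not there is a row of length
    -- `t`.
    pickG : ∃ λ g → (o ≡ 0 → 0 ∈ poolB N' g) × (0 ≢ o → (0 ∈ poolB N' g → t ∈ sB) × (t ∈ sB → 0 ∈ poolB N' g))
    pickG with o ≟ 0 | t ∈? sB
    ... | yes z | _     = false , (λ _ → here refl) , (λ h → contradiction (sym z) h)
    ... | no ¬z | yes m = false , (λ z → here refl) , (λ _ → (λ _ → m) , (λ _ → here refl))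
    ... | no ¬z | no ¬m = true , (λ z → contradiction z ¬z) , (λ _ → (λ m → contradiction m (Residues.0∉ resN')) , (λ m → contradiction m ¬m))
    g = proj₁ pickG
    V = poolB N' g
    poolV = poolB-ok (≤-trans (s≤s z≤n) 2≤t) resN' g
    markV : ∀ g → SameMarks t (poolB N' g) sB
    markV true  = markN'
    markV false y 1≤y y<t = (λ { (here refl) → contradiction 1≤y λ () ; (there m) → proj₁ (markN' y 1≤y y<t) m })
                          , (λ m → there (proj₂ (markN' y 1≤y y<t) m))
    iB = ∈⇒nth (member {V = V} (proj₁ (proj₂ pickG)) (markV g) rB)
    b = proj₁ iB
    b< = proj₁ (proj₂ iB)
    o≡ : nth b V ≡ o
    o≡ = proj₂ (proj₂ iB)
    S = rotDel t b V
    markS : SameMarks t S (shW w)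
    markS = wrapped⇒same poolV b< (subst (λ z → Rotation t z (shW w) sB) (sym o≡) rB)
              (subst (λ z → SameWrapped t z V sB) (sym o≡) (same⇒wrapped' (markV g) (proj₂ (proj₂ pickG))))
    rec = completeC S (<⇒≤ i<k) bl (residues-rotDel poolV b<) markS
    m' = if e then suc (length N) else length N
    lenN' : length N' ≡ m'
    lenN' = trans (length-rotDel poolT a<) (cong (_∸ 1) (length-poolA t N e))
    lenV : length V ≡ (if g then m' else suc m')
    lenV = trans (length-poolB N' g) (cong (λ z → if g then z else suc z) lenN')
    ok-a = subst (a <_) (length-poolA t N e) a<
    ok-b = subst (b <_) lenV b<
    ok-c = subst (λ z → Ok i z (proj₁ rec)) (trans (length-rotDel poolV b<) (trans (cong (_∸ 1) lenV) (pred-if g m'))) (proj₁ (proj₂ rec))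
    dec≡ : blk (suc i) (nth a T) (nth b V) (decC i S (proj₁ rec)) ≡ blk (suc i) x o w
    dec≡ = trans (cong₂ (λ x o → blk (suc i) x o (decC i S (proj₁ rec))) x≡ o≡) (cong (blk (suc i) x o) (proj₂ (proj₂ rec)))

  -- Free sites in terms of codes

  ∈-replicate⇒≡ : ∀ m {y x : ℕ} → y ∈ replicate m x → y ≡ x × 1 ≤ m
  ∈-replicate⇒≡ (suc m) (here e)  = e , s≤s z≤n
  ∈-replicate⇒≡ (suc m) (there p) = proj₁ (∈-replicate⇒≡ m p) , s≤s z≤n

  -- The letter 2v + 1 occurs only in the odd run of stage `v`, and position 0 of the pool there
  -- selects the empty run.
  odd∈⇒a≢0 : ∀ i {N} c → suc i < k → Residues (k ∸ suc i) N → Ok i (length N) c → ∀ v → 1 ≤ v → v ≤ i →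
    suc (v + v) ∈ decC i N c → aAt i c v ≢ 0
  odd∈⇒a≢0 zero c _ _ _ v p q = contradiction (≤-trans p q) λ ()
  odd∈⇒a≢0 (suc i) {N} (s ∷ c) i<k res ok v 1≤v v≤ m with v ≟ suc i
  ... | yes refl rewrite ≡ᵇ-true {suc i} refl = λ a≡0 → x≢0 (trans (cong (λ z → nth z T) a≡0) (nth0 t N e))
    where
    open StepC i N s c
    open SoundC (soundStepC i s c i<k res ok)
    x≢0 : x ≢ 0
    x≢0 x≡0 with ∈-++⁻ (replicate x (suc (suc i + suc i))) m
    ... | inj₁ p = contradiction (proj₂ (∈-replicate⇒≡ x p)) (subst (λ z → ¬ 1 ≤ z) (sym x≡0) λ ())
    ... | inj₂ p with ∈-++⁻ (replicate o (suc i + suc i)) p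
    ...   | inj₁ q = contradiction (proj₁ (∈-replicate⇒≡ o q)) 1+n≢n
    ...   | inj₂ q = contradiction (All.lookup (blocks-< bl) q) (≤⇒≯ (n≤1+n _))
  ... | no v≢ rewrite ≡ᵇ-false v≢ = odd∈⇒a≢0 i c (<⇒≤ i<k) resS okS v 1≤v v≤i (strip m)
    where
    open StepC i N s c
    open SoundC (soundStepC i s c i<k res ok)
    v≤i = ≤-pred (≤∧≢⇒< v≤ v≢)
    lt : suc (v + v) < suc i + suc i
    lt = ≤-trans (s≤s (s≤s (+-mono-≤ v≤i v≤i))) (≤-reflexive (sym (suc+suc i)))
    strip : suc (v + v) ∈ blk (suc i) x o w → suc (v + v) ∈ w
    strip m with ∈-++⁻ (replicate x (suc (suc i + suc i))) m
    ... | inj₁ p = contradiction (proj₁ (∈-replicate⇒≡ x p)) (<⇒≢ (m<n⇒m<1+n lt))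
    ... | inj₂ p with ∈-++⁻ (replicate o (suc i + suc i)) p
    ...   | inj₁ q = contradiction (proj₁ (∈-replicate⇒≡ o q)) (<⇒≢ lt)
    ...   | inj₂ q = q

  a≢0⇒odd∈ : ∀ i {N} c → suc i < k → Residues (k ∸ suc i) N → Ok i (length N) c → ∀ v → 1 ≤ v → v ≤ i →
    aAt i c v ≢ 0 → suc (v + v) ∈ decC i N c
  a≢0⇒odd∈ zero c _ _ _ v p q = contradiction (≤-trans p q) λ ()
  a≢0⇒odd∈ (suc i) {N} (s ∷ c) i<k res ok v 1≤v v≤ h with v ≟ suc i
  ... | yes refl rewrite ≡ᵇ-true {suc i} refl = ∈-++⁺ˡ (rep x (n≢0⇒n>0 x≢0))
    where
    open StepC i N s c
    open SoundC (soundStepC i s c i<k res ok)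
    rep : ∀ x {j : ℕ} → 1 ≤ x → j ∈ replicate x j
    rep (suc x) _ = here refl
    0<T : 0 < length T
    0<T = ≤-trans (s≤s z≤n) a<
    x≢0 : x ≢ 0
    x≢0 x≡0 = h (nth-injective a 0 T (Pool.unique poolT) a< 0<T (trans x≡0 (sym (nth0 t N e))))
  ... | no v≢ rewrite ≡ᵇ-false v≢ = ∈-++⁺ʳ (replicate x (suc (suc i + suc i))) (∈-++⁺ʳ (replicate o (suc i + suc i))
        (a≢0⇒odd∈ i c (<⇒≤ i<k) resS okS v 1≤v (≤-pred (≤∧≢⇒< v≤ v≢)) h))
    where
    open StepC i N s c
    open SoundC (soundStepC i s c i<k res ok)

-- Composing the two codings

module _ (m : ℕ) where

  private
    k = suc (suc m)
    n = suc m

    -- The threshold following the last stage is 1, for which there is no residue but 0. So codes of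
    -- shapes start with no marks, as those of pistols do.
    res : Residues k (k ∸ suc m) []
    res = record { inRange = [] ; unique = [] }

  toIS : List Step → List ℕ
  toIS c = shW k (decC k m [] c)

  toIS-blocks : ∀ {c} → Ok m 0 c → Blocks k m (decC k m [] c)
  toIS-blocks {c} ok = proj₁ (soundC k m c ≤-refl res ok)

  toIS-injective : ∀ {c c'} → Ok m 0 c → Ok m 0 c' → toIS c ≡ toIS c' → c ≡ c'
  toIS-injective {c} {c'} ok ok' e = decC-injective k m c c' ≤-refl res ok ok'
    (blocks-injective k (toIS-blocks ok) (toIS-blocks ok') e)

  toIS-surjective : ∀ s → IsIrreducible k s → ∃ λ c → Ok m 0 c × toIS c ≡ s
  toIS-surjective s irr with irreducible⇒blocks k m refl s irr
  ... | w , bl , e with completeC k [] ≤-refl bl res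
                          (λ y p q → contradiction (≤-trans q (≤-reflexive (m+n∸n≡m 1 m))) (≤⇒≯ p))
  ... | c , ok , e' = c , ok , trans (cong (shW k) e') e

  fr-toIS : ∀ {c} → Ok m 0 c → ∀ v → 1 ≤ v → v ≤ m → not (meets k (toIS c) (k ∸ v) (suc v)) ≡ (aAt m c v ≡ᵇ 0)
  fr-toIS {c} ok v 1≤v v≤ with meets k (toIS c) (k ∸ v) (suc v) in eq
  ... | true  = sym (≡ᵇ-false (odd∈⇒a≢0 k m c ≤-refl res ok v 1≤v v≤
                  (meets-odd k sw v (≤-trans v≤ (≤-trans (n≤1+n m) (n≤1+n n))) eq)))
    where sw = proj₁ (blocks-sorted k (toIS-blocks ok))
  ... | false with aAt m c v ≟ 0
  ...   | yes z = sym (≡ᵇ-true z)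
  ...   | no ¬z = contradiction (trans (sym (odd-meets k (proj₁ (blocks-sorted k bl)) (blocks-lo k bl) v
                    (a≢0⇒odd∈ k m c ≤-refl res ok v 1≤v v≤ ¬z))) eq) λ ()
    where bl = toIS-blocks ok

  bijection : Bijection (SP n) (IS k)
  bijection = record
    { to        = λ { (f , sp) → toIS (code f sp) , blocks-irreducible k (toIS-blocks (code-ok f sp)) }
    ; cong      = λ { {f , sp} {f' , sp'} e → cong toIS (code-cong f sp f' sp' e) }
    ; bijective = injective , surjective
    }
    where
    code : ∀ f → IsSP n f → List Step
    code f sp = proj₁ (toSP-surjective n m refl f sp)
    code-ok : ∀ f sp → Ok m 0 (code f sp)
    code-ok f sp = proj₁ (proj₂ (toSP-surjective n m refl f sp))
    code-eq : ∀ f sp → toSP n (code f sp) ≡ f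
    code-eq f sp = proj₂ (proj₂ (toSP-surjective n m refl f sp))
    -- `code` takes the proof that `f` is a pistol as an argument; injectivity of `toSP` shows that
    -- its value depends on `f` alone.
    code-cong : ∀ f sp f' sp' → f ≡ f' → code f sp ≡ code f' sp'
    code-cong f sp f' sp' e = toSP-injective n m refl _ _ (code-ok f sp) (code-ok f' sp')
      (trans (code-eq f sp) (trans e (sym (code-eq f' sp'))))
    injective : ∀ {x y : Σ (List ℕ) (IsSP n)} → toIS (code (proj₁ x) (proj₂ x)) ≡ toIS (code (proj₁ y) (proj₂ y)) → proj₁ x ≡ proj₁ y
    injective {f , sp} {f' , sp'} e = trans (sym (code-eq f sp))
      (trans (cong (toSP n) (toIS-injective (code-ok f sp) (code-ok f' sp') e)) (code-eq f' sp'))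
    surjective : ∀ (y : Σ (List ℕ) (IsIrreducible k)) → Σ (Σ (List ℕ) (IsSP n)) λ x →
      ∀ {z : Σ (List ℕ) (IsSP n)} → proj₁ z ≡ proj₁ x → toIS (code (proj₁ z) (proj₂ z)) ≡ proj₁ y
    surjective (s , irr) with toIS-surjective s irr
    ... | c , ok , e = (toSP n c , toSP-isSP n m refl c ok) , λ { {f , sp} h → trans (cong toIS
      (toSP-injective n m refl _ _ (code-ok f sp) ok (trans (code-eq f sp) h))) e }

  bijection-fr : ∀ f → fr k (proj₁ (Bijection.to bijection f)) ≡ fix n (proj₁ f)
  bijection-fr (f , sp) with toSP-surjective n m refl f sp
  ... | c , ok , refl = map-range-cong m λ v 1≤v v≤ → trans (fr-toIS ok v 1≤v v≤) (sym (fix-toSP n m refl c ok v 1≤v v≤))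

theorem2 : (k : ℕ) → 3 ≤ k →
    Σ (Bijection (SP (k ∸ 1)) (IS k)) λ φ →
    ∀ f → fr k (proj₁ (Bijection.to φ f)) ≡ fix (k ∸ 1) (proj₁ f)
theorem2 (suc zero)    (s≤s ())
theorem2 (suc (suc m)) _ = bijection m , bijection-fr m
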